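{- Let $W$ be a Coxeter group, $y, w \in W$ with $y < w$ in Bruhat order, and fix a reduced expression $\mathsf{w} = \mathsf{w}_1 \cdots \mathsf{w}_p$ for $w$. Let $R_y$ be the set of relative masks on $\mathsf{w}$ associated to pairs $(y, x)$ with $y \leq x \leq w$, so that $\sigma \mapsto \mathsf{w}^{\Xi(\sigma)}$ identifies $R_y$ with the Bruhat interval $[y,w]$. Then $\varphi$ gives a complete matching of the Hasse diagram of Bruhat order on $[y,w]$: $\varphi$ is defined on every $\sigma \in R_y$, maps $R_y$ to $R_y$, is a fixed-point-free involution of $R_y$, and for every $\sigma \in R_y$ the elements $\mathsf{w}^{\Xi(\sigma)}$ and $\mathsf{w}^{\Xi(\varphi(\sigma))}$ are related by a cover relation in Bruhat order. Equivalently, every element of $[y,w]$ lies in exactly one matched pair, and each matched pair is an edge of the Hasse diagram of $[y,w]$.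
   Context: $W$ is a Coxeter group with generating set $S$, $l$ is the length function, and $\leq$ is the (strong) Bruhat order: $u \leq v$ iff some reduced expression for $u$ is a (not necessarily consecutive) subword of some reduced expression for $v$. A complete matching of the Hasse diagram of a finite poset is a set of cover pairs such that each element lies in exactly one of them. Masks. A mask on $\mathsf{w}$ is a vector $\sigma = (\sigma_1, \ldots, \sigma_p) \in \{0,1\}^p$. For $0 \leq j \leq p$ write $\mathsf{w}^{\sigma[j]}$ for the element $\prod_{i \leq j,\ \sigma_i = 1} \mathsf{w}_i$ (product in increasing order of $i$; empty product $=1$), and $\mathsf{w}^\sigma = \mathsf{w}^{\sigma[p]}$. A position $j$ is a defect of $\sigma$ if $\mathsf{w}^{\sigma[j-1]} \mathsf{w}_j < \mathsf{w}^{\sigma[j-1]}$. A mask with no defects is called a constant mask on $\mathsf{w}$ for the element $\mathsf{w}^\sigma$. The same definitions apply to any reduced expression in place of $\mathsf{w}$. It is known (Deodhar) that for any reduced expression $\mathsf{v}$ of $v$ and any $u \leq v$ there is a unique constant mask on $\mathsf{v}$ for $u$; moreover if $\tau$ is a constant mask on $\mathsf{w}$ then the subword of $\mathsf{w}$ formed by the letters $\mathsf{w}_i$ with $\tau_i = 1$ (denoted $\mathsf{w}^\tau$, indexed by those positions $i$) is a reduced expression for the element $\mathsf{w}^\tau$; similarly $\mathsf{w}^{\tau[j]}$ denotes the reduced subword consisting of the $\mathsf{w}_i$ with $i \leq j$, $\tau_i = 1$. Relative masks. Given $y \leq x \leq w$, let $\tau$ be the unique constant mask on $\mathsf{w}$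 for $x$ and $\nu$ the unique constant mask on the reduced expression $\mathsf{w}^\tau$ for $y$ (its entries indexed by the positions $i$ with $\tau_i = 1$). The relative mask $\sigma \in \{0,1,X\}^p$ associated to $(y,x)$ is $\sigma_j = X$ if $\tau_j = 0$ and $\sigma_j = \nu_j$ if $\tau_j = 1$. The mask $\tau$ is called the $X$-mask of $\sigma$, written $\Xi(\sigma)$; thus $\mathsf{w}^{\Xi(\sigma)} = x$. For $0\le j\le p$ put $\mathsf{w}^{\sigma[j]} = \prod_{i \leq j,\ \sigma_i = 1} \mathsf{w}_i$ and $\mathsf{w}^{\tau[j]} = \prod_{i \le j,\ \tau_i = 1}\mathsf{w}_i$. A position $j$ is a defect of $\sigma$ if $\mathsf{w}^{\sigma[j-1]} \mathsf{w}_j < \mathsf{w}^{\sigma[j-1]}$. A position $j$ is a shifted descent of $\sigma$ if $\mathsf{w}^{\tau[j-1]} \geq \mathsf{w}^{\sigma[j]}$. The map $\varphi$. Given a relative mask $\sigma$ with $X$-mask $\tau$, let $j$ be the rightmost position satisfying one of the following, and define $\varphi(\sigma)$ accordingly (all entries not mentioned are unchanged): (1) $\sigma_j = X$ and $j$ is not a defect: change $\sigma_j$ to $0$. (2) $\sigma_j = 0$: change $\sigma_j$ to $X$. (3) $\sigma_j = X$ and $j$ is a defect (then $\mathsf{w}^{\tau[j-1]} \geq \mathsf{w}^{\sigma[j-1]}\mathsf{w}_j$): let $\rho$ be the unique constant mask on the reduced expression $\mathsf{w}^{\tau[j-1]}$ for the element $\mathsf{w}^{\sigma[j-1]}\mathsf{w}_j$;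 replace $\sigma_i$ by $\rho_i$ for every $i < j$ with $\tau_i = 1$, and set $\sigma_j = 1$. (4) $\sigma_j = 1$ and $j$ is a shifted descent: let $\rho$ be the unique constant mask on $\mathsf{w}^{\tau[j-1]}$ for the element $\mathsf{w}^{\sigma[j]}$; replace $\sigma_i$ by $\rho_i$ for every $i<j$ with $\tau_i = 1$, and set $\sigma_j = X$. -}

module Defs where

open import Data.Nat using (ℕ; zero; suc; _≤_; _<_)
open import Data.List using (List; []; _∷_; _++_; [_]; length; take; drop)
open import Data.List.Relation.Binary.Sublist.Propositional using (_⊆_)
open import Data.Maybe using (Maybe; just; nothing)
open import Data.Bool using (Bool; true; false)
open import Data.Product using (Σ; _×_; _,_)
open import Data.Sum using (_⊎_)
open import Relation.Nullary using (¬_)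
open import Relation.Binary.PropositionalEquality using (_≡_; _≢_)

_‼_ : {A : Set} → List A → ℕ → Maybe A
[] ‼ _ = nothing
(a ∷ as) ‼ zero = just a
(a ∷ as) ‼ suc j = as ‼ j

replaceAt : {A : Set} → List A → ℕ → A → List A
replaceAt xs j a = take j xs ++ a ∷ drop (suc j) xs

-- Coxeter matrices; nothing = ∞

record CoxeterMatrix (S : Set) : Set where
  field
    m     : S → S → Maybe ℕ
    m-diag : ∀ s → m s s ≡ just 1
    m-sym  : ∀ s t → m s t ≡ m t s
    m-off  : ∀ s t → s ≢ t → ∀ k → m s t ≡ just k → 2 ≤ k

data Entry : Set where
  O I X : Entry

Ξ : List Entry → List Bool
Ξ [] = []
Ξ (X ∷ σ) = false ∷ Ξ σ
Ξ (_ ∷ σ) = true ∷ Ξ σ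

ones : List Entry → List Bool
ones [] = []
ones (I ∷ σ) = true ∷ ones σ
ones (_ ∷ σ) = false ∷ ones σ

-- the mask ν on w^{Ξ(σ)}: the non-X entries of σ, in order
restrict : List Entry → List Bool
restrict [] = []
restrict (X ∷ σ) = restrict σ
restrict (O ∷ σ) = false ∷ restrict σ
restrict (I ∷ σ) = true ∷ restrict σ

toEntry : Bool → Entry
toEntry true = I
toEntry false = O

overwrite : List Entry → List Bool → List Entry
overwrite [] _ = []
overwrite (X ∷ σ) ρ = X ∷ overwrite σ ρ
overwrite (e ∷ σ) [] = e ∷ σ
overwrite (e ∷ σ) (b ∷ ρ) = toEntry b ∷ overwrite σ ρ

-- The Coxeter group W presented by a Coxeter matrix: elements are words
-- in S modulo the congruence generated by ss = 1 and the braid relations.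

module Coxeter {S : Set} (M : CoxeterMatrix S) where
  open CoxeterMatrix M

  alt : S → S → ℕ → List S
  alt s t zero = []
  alt s t (suc k) = s ∷ alt t s k

  infix 4 _≈_ _≤B_ _<B_ _⋖_
  data _≈_ : List S → List S → Set where
    refl≈  : ∀ {u} → u ≈ u
    sym≈   : ∀ {u v} → u ≈ v → v ≈ u
    trans≈ : ∀ {u v z} → u ≈ v → v ≈ z → u ≈ z
    cancel : ∀ u s v → (u ++ s ∷ s ∷ v) ≈ (u ++ v)
    braid  : ∀ u s t k v → m s t ≡ just k →
             (u ++ alt s t k ++ v) ≈ (u ++ alt t s k ++ v)

  Reduced : List S → Set
  Reduced a = ∀ b → b ≈ a → length a ≤ length b

  -- Bruhat order (subword property definition)
  _≤B_ : List S → List S → Set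
  u ≤B v = Σ (List S) λ a → Σ (List S) λ b →
           a ≈ u × b ≈ v × Reduced a × Reduced b × a ⊆ b

  _<B_ : List S → List S → Set
  u <B v = u ≤B v × ¬ (u ≈ v)

  _⋖_ : List S → List S → Set
  u ⋖ v = u <B v × ¬ (Σ (List S) λ z → u <B z × z <B v)

  -- masks on an expression w (positions are 0-indexed)

  sel : List S → List Bool → List S
  sel (s ∷ w) (true ∷ σ) = s ∷ sel w σ
  sel (s ∷ w) (false ∷ σ) = sel w σ
  sel _ _ = []

  prefix : List S → List Bool → ℕ → List S
  prefix w σ j = sel (take j w) (take j σ)

  IsDefect : List S → List Bool → ℕ → Set
  IsDefect w σ j = Σ S λ s → (w ‼ j ≡ just s) × (prefix w σ j ++ [ s ] <B prefix w σ j)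

  ConstantMask : List S → List Bool → Set
  ConstantMask w σ = length σ ≡ length w × (∀ j → j < length w → ¬ IsDefect w σ j)

  ConstantMaskFor : List S → List Bool → List S → Set
  ConstantMaskFor w σ x = ConstantMask w σ × sel w σ ≈ x

  RelMaskFor : List S → List S → List S → List Entry → Set
  RelMaskFor w y x σ =
    length σ ≡ length w ×
    ConstantMaskFor w (Ξ σ) x ×
    ConstantMaskFor (sel w (Ξ σ)) (restrict σ) y

  InR : List S → List S → List Entry → Set
  InR w y σ = Σ (List S) λ x → y ≤B x × x ≤B w × RelMaskFor w y x σ

  -- the map φ, as a relation  Φ w σ σ'  ("φ(σ) = σ'")

  σpre : List S → List Entry → ℕ → List S
  σpre w σ j = prefix w (ones σ) j

  τpre : List S → List Entry → ℕ → List S       -- w^{τ[j]} (reduced subword)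
  τpre w σ j = prefix w (Ξ σ) j

  Defect : List S → List Entry → ℕ → Set
  Defect w σ j = IsDefect w (ones σ) j

  -- w^{τ[j-1]} ≥ w^{σ[j]}  (1-indexed), i.e. with 0-indexed j:
  ShiftedDescent : List S → List Entry → ℕ → Set
  ShiftedDescent w σ j = σpre w σ (suc j) ≤B τpre w σ j

  C1 C2 C3 C4 Cond : List S → List Entry → ℕ → Set
  C1 w σ j = σ ‼ j ≡ just X × ¬ Defect w σ j
  C2 w σ j = σ ‼ j ≡ just O
  C3 w σ j = σ ‼ j ≡ just X × Defect w σ j
  C4 w σ j = σ ‼ j ≡ just I × ShiftedDescent w σ j
  Cond w σ j = C1 w σ j ⊎ C2 w σ j ⊎ C3 w σ j ⊎ C4 w σ j

  Step : List S → List Entry → ℕ → List Entry → Set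
  Step w σ j σ' =
      (C1 w σ j × σ' ≡ replaceAt σ j O)
    ⊎ (C2 w σ j × σ' ≡ replaceAt σ j X)
    ⊎ (C3 w σ j × Σ S λ s → w ‼ j ≡ just s × Σ (List Bool) λ ρ →
         ConstantMaskFor (τpre w σ j) ρ (σpre w σ j ++ [ s ]) ×
         σ' ≡ overwrite (take j σ) ρ ++ I ∷ drop (suc j) σ)
    ⊎ (C4 w σ j × Σ (List Bool) λ ρ →
         ConstantMaskFor (τpre w σ j) ρ (σpre w σ (suc j)) ×
         σ' ≡ overwrite (take j σ) ρ ++ X ∷ drop (suc j) σ)

  Φ : List S → List Entry → List Entry → Set
  Φ w σ σ' = Σ ℕ λ j → j < length w × Step w σ j σ' ×
             (∀ k → j < k → k < length w → ¬ Cond w σ k)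

{-# OPTIONS --safe #-}
module Submission where

-- The word problem for W is decided by a numbers game: W acts on functions S → (ℕ → ℤ) through a Cartan matrix in
-- which 2cos(π/m) is replaced by the adjacency operator of a path with m - 1 vertices, and the value that a word w
-- produces at s is positive exactly if w < ws.  Hence lengths, the Bruhat order and constant masks are computable.
--
-- Let φ act on σ at the position of the letter r of w = c r d.  On d the masks σ and φ(σ) consist of ones, so they
-- belong to x d and x r d for some x, and y = θ d with θ ≤ x.  The point is that passing from x to x r creates no
-- shifted descent in d, that is, θ d₁⋯dᵢ ≤ x r d₁⋯dᵢ₋₁ implies θ d₁⋯dₖ ≤ x d₁⋯dₖ₋₁ for some k ≤ i.  Write
-- x = h x′ with h a left descent of x.  If h is a descent of θ, pass to hθ and x′.  Otherwise θ ≤ x′.  If h is not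
-- a descent of θ d₁⋯dᵢ either, pass to θ and x′; if it is, then h θ d₁⋯dₖ₋₁ = θ d₁⋯dₖ for some k, and the left
-- side is ≤ h x′ d₁⋯dₖ₋₁.  At x = 1 the hypothesis says d₁⋯dᵢ = r d₁⋯dᵢ₋₁, but r d₁⋯dᵢ is reduced.

open import Defs
open import Algebra.Properties.CommutativeSemigroup using (interchange)
open import Data.Bool using (Bool; true; false; not; _xor_)
import Data.Bool.Properties as Boolₚ
open import Data.Empty using (⊥; ⊥-elim)
open import Data.Integer as ℤ using (ℤ; 0ℤ; 1ℤ; _+_; -_)
import Data.Integer.Properties as ℤₚ
open import Data.Integer.Tactic.RingSolver using (solve-∀)
open import Data.List using (List; []; _∷_; _++_; [_]; length; reverse; take; drop; replicate; initLast; _∷ʳ′_)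
import Data.List.Properties as Listₚ
open import Data.List.Relation.Binary.Equality.Propositional using (≋⇒≡)
open import Data.List.Relation.Binary.Sublist.Propositional using (_⊆_; []; _∷_; _∷ʳ_; ⊆-refl; ⊆-trans)
import Data.List.Relation.Binary.Sublist.Propositional.Properties as Subₚ
open import Data.List.Reverse using (Reverse; []; _∶_∶ʳ_; reverseView)
open import Data.Maybe using (Maybe; just; nothing)
open import Data.Maybe.Properties using (just-injective; ≡-dec)
open import Data.Nat as ℕ using (ℕ; zero; suc; _≤_; _<_; z≤n; s≤s)
open import Data.Nat.Divisibility using (n∣m*n)
open import Data.Nat.DivMod using (_/_; _%_; m≡m%n+[m/n]*n; m%n<n; [m+kn]%n≡m%n; m<n⇒m%n≡m; m<n⇒m/n≡0; +-distrib-/-∣ʳ; m*n/n≡m)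
import Data.Nat.Properties as ℕₚ
open import Data.Product using (Σ; ∃; _×_; _,_; proj₁; proj₂)
open import Data.Sum using (_⊎_; inj₁; inj₂; swap)
open import Relation.Binary.Bundles using (Setoid)
open import Relation.Binary.Definitions using (tri<; tri≈; tri>)
open import Relation.Binary.PropositionalEquality using (_≡_; _≢_; _≗_; refl; sym; trans; cong; cong₂; subst; subst₂; module ≡-Reasoning)
import Relation.Binary.Reasoning.Setoid as SetoidReasoning
open import Relation.Nullary using (Dec; yes; no; ¬_; does)
open import Relation.Nullary.Decidable using (decidable-stable; map′; _⊎-dec_)

-- Path graphs and Chebyshev polynomials

-- The partner `σ'` has to be constructed, and `S` comes without decidable equality, so every case
-- distinction on ascents, on equality in the group and on the Bruhat order must be decided from the
-- Coxeter matrix alone. The geometric representation would do this with the real numbers 2cos(π/m).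
-- The path with m - 1 vertices has the eigenvalues 2cos(kπ/m) for 0 < k < m, and its adjacency
-- operator has the two properties that the computations with two generators need: the polynomial
-- that expresses sin(mt)/sin(t) in 2cos(t) vanishes at it, and the earlier polynomials of this kind
-- keep positive vectors positive. All arithmetic stays in ℤ, where signs are decidable. One space
-- must carry these operators for all m at once; therefore it is the functions on ℕ, and ℕ is cut
-- into consecutive paths of whatever length is required. Operators for different m need not
-- commute, since a computation with two generators involves polynomials in one operator and only
-- the additivity of the others.

V : Set
V = ℕ → ℤ

infixl 6 _⊕_
_⊕_ : V → V → V
(f ⊕ g) n = f n + g n

⊝_ : V → V
(⊝ f) n = - f n

𝟘 : V
𝟘 _ = 0ℤ

Pos : V → Set
Pos f = ∀ n → 0ℤ ℤ.< f n

-- Functions are compared pointwise, without extensionality, so compatibility with `≗` is a field of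
-- its own.
record Linear (C : V → V) : Set where
  field
    cong-C : ∀ {f g} → f ≗ g → C f ≗ C g
    add-C  : ∀ f g → C (f ⊕ g) ≗ C f ⊕ C g
    neg-C  : ∀ f → C (⊝ f) ≗ ⊝ C f

-- Chebyshev polynomials of the second kind with the index shifted by one: for a scalar C = 2cos(t)
-- the factor of `f` is sin(kt)/sin(t).
U : (V → V) → ℕ → V → V
U C zero          f = 𝟘
U C (suc zero)    f = f
U C (suc (suc k)) f = C (U C (suc k) f) ⊕ (⊝ U C k f)

private
  difference-add : ∀ a b c d → (a + b) + - (c + d) ≡ (a + - c) + (b + - d)
  difference-add = solve-∀

  difference-neg : ∀ a b → - a + - (- b) ≡ - (a + - b)
  difference-neg = solve-∀

linear-𝟘 : ∀ {C} → Linear C → C 𝟘 ≗ 𝟘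
linear-𝟘 {C} lin n = trans (expand (C 𝟘 n))
  (trans (cong (_+ - C 𝟘 n) (sym (Linear.add-C lin 𝟘 𝟘 n))) (ℤₚ.+-inverseʳ (C 𝟘 n)))
  where
    expand : ∀ x → x ≡ (x + x) + - x
    expand = solve-∀

module _ {C : V → V} (lin : Linear C) where
  open Linear lin

  -- The recursion for `U` reaches back two steps, so this and the next inductions carry two
  -- consecutive indices.
  U-linear : ∀ k → Linear (U C k) × Linear (U C (suc k))
  U-linear zero = record { cong-C = λ _ _ → refl ; add-C = λ _ _ _ → refl ; neg-C = λ _ _ → refl }
                , record { cong-C = λ e → e ; add-C = λ _ _ _ → refl ; neg-C = λ _ _ → refl }
  U-linear (suc k) with U-linear k
  ... | l₀ , l₁ = l₁ , record
    { cong-C = λ e n → cong₂ (λ a b → a + - b) (cong-C (L₁.cong-C e) n) (L₀.cong-C e n)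
    ; add-C = λ f g n → trans
        (cong₂ (λ a b → a + - b) (trans (cong-C (L₁.add-C f g) n) (add-C _ _ n)) (L₀.add-C f g n))
        (difference-add (C (U C (suc k) f) n) (C (U C (suc k) g) n) (U C k f n) (U C k g n))
    ; neg-C = λ f n → trans
        (cong₂ (λ a b → a + - b) (trans (cong-C (L₁.neg-C f) n) (neg-C _ n)) (L₀.neg-C f n))
        (difference-neg (C (U C (suc k) f) n) (U C k f n))
    }
    where
      module L₀ = Linear l₀
      module L₁ = Linear l₁

  module U-linear k = Linear (proj₁ (U-linear k))

  U-𝟘 : ∀ k → U C k 𝟘 ≗ 𝟘
  U-𝟘 k = linear-𝟘 (proj₁ (U-linear k))

  C-U-comm : ∀ k f → (C (U C k f) ≗ U C k (C f)) × (C (U C (suc k) f) ≗ U C (suc k) (C f))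
  C-U-comm zero    f = linear-𝟘 lin , λ _ → refl
  C-U-comm (suc k) f with C-U-comm k f
  ... | e₀ , e₁ = e₁ , λ n → trans (add-C _ _ n)
        (cong₂ _+_ (cong-C e₁ n) (trans (neg-C _ n) (cong -_ (e₀ n))))

  U-U-comm : ∀ i k f → (U C i (U C k f) ≗ U C k (U C i f)) × (U C (suc i) (U C k f) ≗ U C k (U C (suc i) f))
  U-U-comm zero    k f = (λ n → sym (U-𝟘 k n)) , λ _ → refl
  U-U-comm (suc i) k f with U-U-comm i k f
  ... | e₀ , e₁ = e₁ , λ n → sym (trans (U-linear.add-C k _ _ n)
        (cong₂ _+_ (trans (sym (proj₁ (C-U-comm k _) n)) (sym (cong-C e₁ n)))
                   (trans (U-linear.neg-C k _ n) (cong -_ (sym (e₀ n))))))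

-- path is the adjacency operator of a disjoint union of path graphs with M vertices each, on the vertex set ℕ.
-- slice f b lists f along the b-th path, at positions 1, …, M, and is 0 elsewhere.

module Path (M-1 : ℕ) where

  M : ℕ
  M = suc M-1

  guard : ∀ {P : Set} → Dec P → ℤ → ℤ
  guard (yes _) x = x
  guard (no _)  x = 0ℤ

  slice : V → ℕ → V
  slice f b zero    = 0ℤ
  slice f b (suc i) = guard (i ℕ.<? M) (f (i ℕ.+ b ℕ.* M))

  path : V → V
  path f n = slice f (n / M) (n % M) + slice f (n / M) (suc (suc (n % M)))

  slice-in : ∀ f b {i} → i ℕ.< M → slice f b (suc i) ≡ f (i ℕ.+ b ℕ.* M)
  slice-in f b {i} i<M with i ℕ.<? M
  ... | yes _  = refl
  ... | no i≮M = ⊥-elim (i≮M i<M)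

  slice-out : ∀ f b → slice f b (suc M) ≡ 0ℤ
  slice-out f b with M ℕ.<? M
  ... | yes M<M = ⊥-elim (ℕₚ.<-irrefl refl M<M)
  ... | no _    = refl

  index-slice : ∀ f n → slice f (n / M) (suc (n % M)) ≡ f n
  index-slice f n = trans (slice-in f (n / M) (m%n<n n M)) (cong f (sym (m≡m%n+[m/n]*n n M)))

  slice-cong : ∀ {f g} → f ≗ g → ∀ b → slice f b ≗ slice g b
  slice-cong e b zero    = refl
  slice-cong e b (suc i) with i ℕ.<? M
  ... | yes _ = e _
  ... | no _  = refl

  slice-add : ∀ f g b → slice (f ⊕ g) b ≗ slice f b ⊕ slice g b
  slice-add f g b zero    = refl
  slice-add f g b (suc i) with i ℕ.<? M
  ... | yes _ = refl
  ... | no _  = refl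

  slice-neg : ∀ f b → slice (⊝ f) b ≗ ⊝ slice f b
  slice-neg f b zero    = refl
  slice-neg f b (suc i) with i ℕ.<? M
  ... | yes _ = refl
  ... | no _  = refl

  private
    swap-middle : ∀ a b c d → (a + b) + (c + d) ≡ (a + c) + (b + d)
    swap-middle = solve-∀

    neg-add : ∀ a b → - a + - b ≡ - (a + b)
    neg-add = solve-∀

  path-linear : Linear path
  path-linear = record
    { cong-C = λ e n → cong₂ _+_ (slice-cong e (n / M) (n % M)) (slice-cong e (n / M) (suc (suc (n % M))))
    ; add-C = λ f g n → trans (cong₂ _+_ (slice-add f g (n / M) (n % M)) (slice-add f g (n / M) (suc (suc (n % M)))))
        (swap-middle (slice f (n / M) (n % M)) _ _ _)
    ; neg-C = λ f n → trans (cong₂ _+_ (slice-neg f (n / M) (n % M)) (slice-neg f (n / M) (suc (suc (n % M)))))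
        (neg-add (slice f (n / M) (n % M)) _)
    }

  slice-path : ∀ f b {i} → i ℕ.< M → slice (path f) b (suc i) ≡ slice f b i + slice f b (suc (suc i))
  slice-path f b {i} i<M = trans (slice-in (path f) b i<M)
    (cong₂ (λ d r → slice f d r + slice f d (suc (suc r))) quotient remainder)
    where
      remainder : (i ℕ.+ b ℕ.* M) % M ≡ i
      remainder = trans ([m+kn]%n≡m%n i b M) (m<n⇒m%n≡m i<M)
      quotient : (i ℕ.+ b ℕ.* M) / M ≡ b
      quotient = trans (+-distrib-/-∣ʳ i (n∣m*n b)) (cong₂ ℕ._+_ (m<n⇒m/n≡0 i<M) (m*n/n≡m b M))

  -- With k as time and the last argument as place, this is a solution of the discrete wave equation
  -- on one path, with boundary value zero at the places 0 and M + 1.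
  W : V → ℕ → ℕ → ℕ → ℤ
  W f b k = slice (U path k f) b

  W-zero : ∀ f b i → W f b 0 i ≡ 0ℤ
  W-zero f b zero    = refl
  W-zero f b (suc i) with i ℕ.<? M
  ... | yes _ = refl
  ... | no _  = refl

  wave : ∀ f b k {i} → i ℕ.< M →
    W f b (suc (suc k)) (suc i) ≡ (W f b (suc k) i + W f b (suc k) (suc (suc i))) + - W f b k (suc i)
  wave f b k {i} i<M = trans (slice-add (path (U path (suc k) f)) (⊝ U path k f) b (suc i))
    (cong₂ _+_ (slice-path (U path (suc k) f) b i<M) (slice-neg (U path k f) b (suc i)))

  -- The k-th polynomial in the adjacency matrix sends the first basis vector to the k-th one; this
  -- is the transposed statement. The induction step uses the hypothesis for `path f` as well as for
  -- `f`.
  first-column : ∀ f b k → k ℕ.≤ M → (W f b k 1 ≡ slice f b k) × (W f b (suc k) 1 ≡ slice f b (suc k))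
  first-column f b zero    _   = W-zero f b 1 , refl
  first-column f b (suc k) k<M = proj₂ (first-column f b k (ℕₚ.<⇒≤ k<M)) , (begin
    W f b (suc (suc k)) 1
      ≡⟨ slice-add (path (U path (suc k) f)) (⊝ U path k f) b 1 ⟩
    slice (path (U path (suc k) f)) b 1 + slice (⊝ U path k f) b 1
      ≡⟨ cong₂ _+_ (slice-cong (proj₂ (C-U-comm path-linear k f)) b 1) (slice-neg (U path k f) b 1) ⟩
    W (path f) b (suc k) 1 + - W f b k 1
      ≡⟨ cong₂ (λ x y → x + - y) (proj₂ (first-column (path f) b k (ℕₚ.<⇒≤ k<M))) (proj₁ (first-column f b k (ℕₚ.<⇒≤ k<M))) ⟩
    slice (path f) b (suc k) + - slice f b k
      ≡⟨ cong (_+ - slice f b k) (slice-path f b k<M) ⟩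
    (slice f b k + slice f b (suc (suc k))) + - slice f b k
      ≡⟨ cancel-first (slice f b k) _ ⟩
    slice f b (suc (suc k)) ∎)
    where
      open ≡-Reasoning
      cancel-first : ∀ x y → (x + y) + - x ≡ y
      cancel-first = solve-∀

  -- By the first column, the entry at i of `U path k f` is the first entry of
  -- `U path i (U path k f)`, and the two polynomials commute.
  W-sym : ∀ f b k i → k ℕ.≤ suc M → i ℕ.≤ suc M → W f b k i ≡ W f b i k
  W-sym f b k i k≤ i≤ = begin
    slice (U path k f) b i              ≡⟨ sym (column (U path k f) i i≤) ⟩
    slice (U path i (U path k f)) b 1   ≡⟨ slice-cong (proj₁ (U-U-comm path-linear i k f)) b 1 ⟩
    slice (U path k (U path i f)) b 1   ≡⟨ column (U path i f) k k≤ ⟩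
    slice (U path i f) b k              ∎
    where
      open ≡-Reasoning
      column : ∀ g j → j ℕ.≤ suc M → W g b j 1 ≡ slice g b j
      column g zero    _         = W-zero g b 1
      column g (suc j) (s≤s j≤M) = proj₂ (first-column g b j j≤M)

  -- Symmetry exchanges time M + 1 with place M + 1, which lies just beyond the end of the path.
  U-path-vanishes : ∀ f → U path (suc M) f ≗ 𝟘
  U-path-vanishes f n = trans (sym (index-slice (U path (suc M) f) n))
    (trans (W-sym f (n / M) (suc M) (suc (n % M)) ℕₚ.≤-refl (s≤s (ℕₚ.<⇒≤ (m%n<n n M))))
           (slice-out (U path (suc (n % M)) f) (n / M)))

  -- The wave equation makes W(k+1, i) - W(k, i+1) constant along diagonals; at k = 0 it is the
  -- initial value. The bound stops the diagonal at the end of the path.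
  diagonal : ∀ f b k j → k ℕ.+ j ℕ.≤ M → W f b (suc k) (k ℕ.+ j) ≡ W f b k (suc (k ℕ.+ j)) + slice f b j
  diagonal f b zero j _ = sym (trans (cong (_+ slice f b j) (W-zero f b (suc j))) (ℤₚ.+-identityˡ _))
  diagonal f b (suc k) j k<M = trans (wave f b k k<M)
    (trans (cong (λ x → (x + W f b (suc k) (suc (suc (k ℕ.+ j)))) + - W f b k (suc (k ℕ.+ j)))
                 (diagonal f b k j (ℕₚ.<⇒≤ k<M)))
           (rearrange (W f b k (suc (k ℕ.+ j))) _ _))
    where
      rearrange : ∀ x y z → ((x + y) + z) + - x ≡ z + y
      rearrange = solve-∀

  module _ {f : V} (pos : Pos f) (b : ℕ) where

    -- By `diagonal` the value is a positive initial value plus the value one time step earlier and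
    -- one place further right. The latter is zero at time 0 or at place M + 1, and positive by
    -- recursion otherwise. Places to the left of the diagonal are left to `W-sym`.
    W-pos : ∀ k j → suc k ℕ.+ j ℕ.≤ M → 0ℤ ℤ.< W f b (suc k) (suc k ℕ.+ j)
    W-pos k j le = subst (λ i → 0ℤ ℤ.< W f b (suc k) i) (ℕₚ.+-suc k j)
      (subst (0ℤ ℤ.<_) (sym (diagonal f b k (suc j) le′))
        (ℤₚ.+-mono-≤-< (nonneg k le′) (slice-pos le)))
      where
        le′ : k ℕ.+ suc j ℕ.≤ M
        le′ = subst (ℕ._≤ M) (sym (ℕₚ.+-suc k j)) le

        slice-pos : suc k ℕ.+ j ℕ.≤ M → 0ℤ ℤ.< slice f b (suc j)
        slice-pos (s≤s k+j<M) = subst (0ℤ ℤ.<_) (sym (slice-in f b (s≤s (ℕₚ.≤-trans (ℕₚ.m≤n+m j k) k+j<M)))) (pos _)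

        nonneg : ∀ k → k ℕ.+ suc j ℕ.≤ M → 0ℤ ℤ.≤ W f b k (suc (k ℕ.+ suc j))
        nonneg zero    _ = ℤₚ.≤-reflexive (sym (W-zero f b (suc (suc j))))
        nonneg (suc k) q with ℕₚ.m≤n⇒m<n∨m≡n q
        ... | inj₁ lt = subst (λ i → 0ℤ ℤ.≤ W f b (suc k) i) (ℕₚ.+-suc (suc k) (suc j))
          (ℤₚ.<⇒≤ (W-pos k (suc (suc j)) (subst (ℕ._≤ M) (sym (ℕₚ.+-suc (suc k) (suc j))) lt)))
        ... | inj₂ eq = ℤₚ.≤-reflexive (sym (trans (cong (λ i → W f b (suc k) (suc i)) eq)
                                                 (slice-out (U path (suc k) f) b)))

    W-pos-≤ : ∀ {k i} → 1 ℕ.≤ k → k ℕ.≤ i → i ℕ.≤ M → 0ℤ ℤ.< W f b k i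
    W-pos-≤ {suc k} {i} _ k≤i i≤M = subst (λ i → 0ℤ ℤ.< W f b (suc k) i) (ℕₚ.m+[n∸m]≡n k≤i)
      (W-pos k (i ℕ.∸ suc k) (subst (ℕ._≤ M) (sym (ℕₚ.m+[n∸m]≡n k≤i)) i≤M))

  U-path-pos : ∀ {f} → Pos f → ∀ k → 1 ℕ.≤ k → k ℕ.≤ M → Pos (U path k f)
  U-path-pos {f} pos k 1≤k k≤M n = subst (0ℤ ℤ.<_) (index-slice (U path k f) n) position
    where
      i = suc (n % M)
      i≤M : i ℕ.≤ M
      i≤M = m%n<n n M
      position : 0ℤ ℤ.< W f (n / M) k i
      position with ℕₚ.≤-total k i
      ... | inj₁ k≤i = W-pos-≤ pos (n / M) 1≤k k≤i i≤M
      ... | inj₂ i≤k = subst (0ℤ ℤ.<_) (W-sym f (n / M) i k (ℕₚ.m≤n⇒m≤1+n i≤M) (ℕₚ.m≤n⇒m≤1+n k≤M))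
                         (W-pos-≤ pos (n / M) (s≤s z≤n) i≤k k≤M)

double : V → V
double f = f ⊕ f

double-linear : Linear double
double-linear = record
  { cong-C = λ e n → cong₂ _+_ (e n) (e n)
  ; add-C = λ f g n → add (f n) (g n)
  ; neg-C = λ f n → neg (f n)
  }
  where
    add : ∀ a b → (a + b) + (a + b) ≡ (a + a) + (b + b)
    add = solve-∀
    neg : ∀ a → - a + - a ≡ - (a + a)
    neg = solve-∀

-- For infinite order the scalar 2 replaces 2cos(π/m), and the Chebyshev values are the multiples k
-- f, which never return to zero.
U-double-suc : ∀ f k → U double (suc k) f ≗ f ⊕ U double k f
U-double-suc f zero    n = sym (ℤₚ.+-identityʳ (f n))
U-double-suc f (suc k) n = trans
  (cong (λ x → (x + x) + - U double k f n) (U-double-suc f k n))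
  (trans (rearrange (f n) (U double k f n)) (cong (f n +_) (sym (U-double-suc f k n))))
  where
    rearrange : ∀ a u → ((a + u) + (a + u)) + - u ≡ a + (a + u)
    rearrange = solve-∀

U-double-pos : ∀ {f} → Pos f → ∀ k → Pos (U double (suc k) f)
U-double-pos pos zero    n = pos n
U-double-pos {f} pos (suc k) n = subst (0ℤ ℤ.<_) (sym (U-double-suc f (suc k) n))
  (ℤₚ.+-mono-< (pos n) (U-double-pos pos k n))

-- The entries of a Cartan matrix for W with opposite sign.  In place of 2cos(π/m) stands the adjacency
-- operator of the path with m - 1 vertices; just 0 does not occur in a Coxeter matrix.

coef : Maybe ℕ → V → V
coef nothing                  = double
coef (just zero)              = ⊝_
coef (just (suc zero))        = λ f → ⊝ double f
coef (just (suc (suc m-2)))   = Path.path m-2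

coef-linear : ∀ x → Linear (coef x)
coef-linear nothing = double-linear
coef-linear (just zero) = record
  { cong-C = λ e n → cong -_ (e n) ; add-C = λ f g n → ℤₚ.neg-distrib-+ (f n) (g n) ; neg-C = λ _ _ → refl }
coef-linear (just (suc zero)) = record
  { cong-C = λ e n → cong -_ (cong-C e n)
  ; add-C = λ f g n → trans (cong -_ (add-C f g n)) (ℤₚ.neg-distrib-+ (double f n) (double g n))
  ; neg-C = λ f n → cong -_ (neg-C f n) }
  where open Linear double-linear
coef-linear (just (suc (suc m-2))) = Path.path-linear m-2

coef-vanishes : ∀ k → 2 ℕ.≤ k → ∀ f → U (coef (just k)) k f ≗ 𝟘
coef-vanishes (suc zero) (s≤s ())
coef-vanishes (suc (suc m-2)) _ = Path.U-path-vanishes m-2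

_<∞_ : ℕ → Maybe ℕ → Set
k <∞ x = ∀ j → x ≡ just j → k ℕ.< j

coef-pos : ∀ x k → x ≢ just 0 → x ≢ just 1 → suc k <∞ x → ∀ {f} → Pos f → Pos (U (coef x) (suc k) f)
coef-pos nothing k _ _ _ pos = U-double-pos pos k
coef-pos (just zero) k x≢0 _ _ _ = ⊥-elim (x≢0 refl)
coef-pos (just (suc zero)) k _ x≢1 _ _ = ⊥-elim (x≢1 refl)
coef-pos (just (suc (suc m-2))) k _ _ k< pos = Path.U-path-pos m-2 pos (suc k) (s≤s z≤n) (ℕₚ.≤-pred (k< _ refl))

module _ {S : Set} (M : CoxeterMatrix S) where
  open CoxeterMatrix M
  open Coxeter M

  -- The numbers game

  State : Set
  State = S → V

  fire : State → S → State
  fire φ s r = φ r ⊕ coef (m s r) (φ s)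

  act : State → List S → State
  act φ []      = φ
  act φ (s ∷ w) = act (fire φ s) w

  infix 4 _≃_
  _≃_ : State → State → Set
  φ ≃ ψ = ∀ r → φ r ≗ ψ r

  fire-cong : ∀ {φ ψ} → φ ≃ ψ → ∀ s → fire φ s ≃ fire ψ s
  fire-cong e s r n = cong₂ _+_ (e r n) (Linear.cong-C (coef-linear (m s r)) (e s) n)

  act-cong : ∀ {φ ψ} → φ ≃ ψ → ∀ w → act φ w ≃ act ψ w
  act-cong e []      = e
  act-cong e (s ∷ w) = act-cong (fire-cong e s) w

  act-++ : ∀ φ u v → act φ (u ++ v) ≡ act (act φ u) v
  act-++ φ []      v = refl
  act-++ φ (s ∷ u) v = act-++ (fire φ s) u v

  fire-self : ∀ φ s → fire φ s s ≗ ⊝ φ s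
  fire-self φ s n = trans (cong (λ x → φ s n + coef x (φ s) n) (m-diag s)) (reflect (φ s n))
    where
      reflect : ∀ a → a + - (a + a) ≡ - a
      reflect = solve-∀

  fire-fire : ∀ φ s → fire (fire φ s) s ≃ φ
  fire-fire φ s r n = trans
    (cong (λ x → (φ r n + coef (m s r) (φ s) n) + x)
      (trans (cong-C (fire-self φ s) n) (neg-C (φ s) n)))
    (cancel-last (φ r n) _)
    where
      open Linear (coef-linear (m s r))
      cancel-last : ∀ a b → (a + b) + - b ≡ a
      cancel-last = solve-∀

  -- The letter that would continue `alt s t n`: the first one for even n, the second one for odd n.
  par : ℕ → S → S → S
  par zero    s t = s
  par (suc n) s t = par n t s

  alt-snoc : ∀ s t n → alt s t (suc n) ≡ alt s t n ++ [ par n s t ]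
  alt-snoc s t zero    = refl
  alt-snoc s t (suc n) = cong (s ∷_) (alt-snoc t s n)

  m-par : ∀ s t n → m (par n s t) (par n t s) ≡ m s t
  m-par s t zero    = refl
  m-par s t (suc n) = trans (m-par t s n) (m-sym t s)

  -- The diagonal entries refute `s ≡ t` and the bound on the other entries refutes `s ≢ t`, so no
  -- equality test on `S` is needed.
  m≢0 : ∀ s t → m s t ≢ just 0
  m≢0 s t eq = distinct λ { refl → 1≢0 (trans (sym (m-diag s)) eq) }
    where
      1≢0 : just 1 ≢ just 0
      1≢0 ()
      distinct : ¬ (s ≢ t)
      distinct s≢t with m-off s t s≢t 0 eq
      ... | ()

  same-generator : ∀ s t → m s t ≡ just 1 → ¬ (s ≢ t)
  same-generator s t eq s≢t with m-off s t s≢t 1 eq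
  ... | s≤s ()

  act-alt-suc : ∀ φ s t n → act φ (alt s t (suc n)) ≡ fire (act φ (alt s t n)) (par n s t)
  act-alt-suc φ s t n = trans (cong (act φ) (alt-snoc s t n)) (act-++ φ (alt s t n) [ par n s t ])

  module _ (φ : State) {x : Maybe ℕ} where

    private
      C = coef x
      open Linear (coef-linear x)

      next : ∀ a b cb d → ((a + - cb) + - b) + (d + cb) ≡ (d + - b) + a
      next = solve-∀

      turn : ∀ a b c → - (a + b) ≡ ((c + - b) + - c) + - a
      turn = solve-∀

    -- The sequence of values that are fired along alt s t n satisfies the Chebyshev recursion.
    act-alt : ∀ s t → m s t ≡ x → ∀ n →
      (act φ (alt s t n) (par n s t) ≗ U C (suc n) (φ s) ⊕ U C n (φ t)) ×
      (act φ (alt s t n) (par n t s) ≗ ((U C (suc n) (φ t) ⊕ (⊝ C (U C n (φ t)))) ⊕ (⊝ U C n (φ s))))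
    act-alt s t eq zero = (λ n → sym (ℤₚ.+-identityʳ (φ s n))) , λ n →
      trans (simplify (φ t n)) (cong (λ y → (φ t n + - y) + - 0ℤ) (sym (linear-𝟘 (coef-linear x) n)))
      where
        simplify : ∀ a → a ≡ (a + - 0ℤ) + - 0ℤ
        simplify = solve-∀
    act-alt s t eq (suc n) with act-alt s t eq n
    ... | e₁ , e₂ =
      (λ i → trans (cong (λ ψ → ψ (par n t s) i) (act-alt-suc φ s t n))
        (trans (cong₂ _+_ (e₂ i)
            (trans (cong (λ y → coef y (act φ (alt s t n) (par n s t)) i) (trans (m-par s t n) eq))
              (trans (cong-C e₁ i) (add-C _ _ i))))
          (next (U C (suc n) (φ t) i) (U C n (φ s) i) (C (U C n (φ t)) i) (C (U C (suc n) (φ s)) i)))) ,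
      (λ i → trans (cong (λ ψ → ψ (par n s t) i) (act-alt-suc φ s t n))
        (trans (fire-self (act φ (alt s t n)) (par n s t) i)
          (trans (cong -_ (e₁ i))
            (turn (U C (suc n) (φ s) i) (U C n (φ t) i) (C (U C (suc n) (φ t)) i)))))

    -- By `act-alt` the next two firings add P(U(n+1) φs + U(n) φt) on one side and Q(U(n+1) φt +
    -- U(n) φs) on the other. The terms with U(n) cancel against the previous difference. At n = m s
    -- t the remaining terms vanish, which is the braid relation.
    act-alt-difference : ∀ s t → m s t ≡ x → ∀ n r →
      act φ (alt s t n) r ≗ act φ (alt t s n) r ⊕
        (coef (m (par n t s) r) (U C n (φ s)) ⊕ (⊝ coef (m (par n s t) r) (U C n (φ t))))
    act-alt-difference s t eq zero r i = trans (sym (ℤₚ.+-identityʳ (φ r i)))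
      (cong (φ r i +_) (sym (cong₂ (λ a b → a + - b) (linear-𝟘 (coef-linear (m t r)) i) (linear-𝟘 (coef-linear (m s r)) i))))
    act-alt-difference s t eq (suc n) r i = begin
      act φ (alt s t (suc n)) r i
        ≡⟨ cong (λ ψ → ψ r i) (act-alt-suc φ s t n) ⟩
      act φ (alt s t n) r i + P (act φ (alt s t n) (par n s t)) i
        ≡⟨ cong₂ _+_ (act-alt-difference s t eq n r i)
             (trans (Lp.cong-C (proj₁ (act-alt s t eq n)) i) (Lp.add-C _ _ i)) ⟩
      (act φ (alt t s n) r i + (Q (U C n (φ s)) i + - P (U C n (φ t)) i)) + (P (U C (suc n) (φ s)) i + P (U C n (φ t)) i)
        ≡⟨ regroup (act φ (alt t s n) r i) (Q (U C n (φ s)) i) (P (U C n (φ t)) i) (P (U C (suc n) (φ s)) i) (Q (U C (suc n) (φ t)) i) ⟩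
      (act φ (alt t s n) r i + (Q (U C (suc n) (φ t)) i + Q (U C n (φ s)) i)) + (P (U C (suc n) (φ s)) i + - Q (U C (suc n) (φ t)) i)
        ≡⟨ cong (λ y → (act φ (alt t s n) r i + y) + (P (U C (suc n) (φ s)) i + - Q (U C (suc n) (φ t)) i))
             (sym (trans (Lq.cong-C (proj₁ (act-alt t s (trans (m-sym t s) eq) n)) i) (Lq.add-C _ _ i))) ⟩
      (act φ (alt t s n) r i + Q (act φ (alt t s n) (par n t s)) i) + (P (U C (suc n) (φ s)) i + - Q (U C (suc n) (φ t)) i)
        ≡⟨ cong (λ ψ → ψ r i + (P (U C (suc n) (φ s)) i + - Q (U C (suc n) (φ t)) i)) (sym (act-alt-suc φ t s n)) ⟩
      act φ (alt t s (suc n)) r i + (P (U C (suc n) (φ s)) i + - Q (U C (suc n) (φ t)) i) ∎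
      where
        open ≡-Reasoning
        P = coef (m (par n s t) r)
        Q = coef (m (par n t s) r)
        module Lp = Linear (coef-linear (m (par n s t) r))
        module Lq = Linear (coef-linear (m (par n t s) r))
        regroup : ∀ a q p p′ q′ → (a + (q + - p)) + (p′ + p) ≡ (a + (q′ + q)) + (p′ + - q′)
        regroup = solve-∀

  act-braid : ∀ φ s t k → m s t ≡ just k → act φ (alt s t k) ≃ act φ (alt t s k)
  act-braid φ s t zero          eq r i = refl
  -- Order 1 yields only `¬ (s ≢ t)`; equality of integers is stable under double negation, which is
  -- enough.
  act-braid φ s t (suc zero)    eq r i = decidable-stable (_ ℤ.≟ _)
    λ ne → same-generator s t eq λ { refl → ne refl }
  act-braid φ s t k@(suc (suc _)) eq r i = trans (act-alt-difference φ s t eq k r i)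
    (trans (cong₂ (λ a b → act φ (alt t s k) r i + (a + - b)) (vanish (m (par k t s) r) (φ s)) (vanish (m (par k s t) r) (φ t)))
      (ℤₚ.+-identityʳ _))
    where
      vanish : ∀ y f → coef y (U (coef (just k)) k f) i ≡ 0ℤ
      vanish y f = trans (Linear.cong-C (coef-linear y) (coef-vanishes k (s≤s (s≤s z≤n)) f) i) (linear-𝟘 (coef-linear y) i)

  act-≈ : ∀ {u v} → u ≈ v → ∀ φ → act φ u ≃ act φ v
  act-≈ refl≈           φ r n = refl
  act-≈ (sym≈ e)        φ r n = sym (act-≈ e φ r n)
  act-≈ (trans≈ e₁ e₂)  φ r n = trans (act-≈ e₁ φ r n) (act-≈ e₂ φ r n)
  act-≈ (cancel u s v)  φ r n rewrite act-++ φ u (s ∷ s ∷ v) | act-++ φ u v =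
    act-cong (fire-fire (act φ u) s) v r n
  act-≈ (braid u s t k v eq) φ r n
    rewrite act-++ φ u (alt s t k ++ v) | act-++ φ u (alt t s k ++ v)
          | act-++ (act φ u) (alt s t k) v | act-++ (act φ u) (alt t s k) v =
    act-cong (act-braid (act φ u) s t k eq) v r n

  -- The value is a sum of Chebyshev values with the indices n + 1 and n. Only the first index can
  -- reach the order, and there its summand is zero rather than negative.
  act-alt-pos : ∀ φ s t n → m s t ≢ just 1 → n <∞ m s t → Pos (φ s) → Pos (φ t) →
                Pos (act φ (alt s t n) (par n s t))
  act-alt-pos φ s t zero    _   _  pos-s _     i = pos-s i
  act-alt-pos φ s t (suc n) m≢1 n< pos-s pos-t i =
    subst (0ℤ ℤ.<_) (sym (proj₁ (act-alt φ s t refl (suc n)) i))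
      (ℤₚ.+-mono-≤-< (nonneg (m s t) refl) (coef-pos (m s t) n (m≢0 s t) m≢1 n< pos-t i))
    where
      below : ∀ {x} → suc (suc n) <∞ x → m s t ≡ x → 0ℤ ℤ.≤ U (coef (m s t)) (suc (suc n)) (φ s) i
      below lt refl = ℤₚ.<⇒≤ (coef-pos (m s t) (suc n) (m≢0 s t) m≢1 lt pos-s i)

      nonneg : ∀ x → m s t ≡ x → 0ℤ ℤ.≤ U (coef (m s t)) (suc (suc n)) (φ s) i
      nonneg nothing  eq = below (λ _ ()) eq
      nonneg (just k) eq with ℕₚ.m≤n⇒m<n∨m≡n (n< k eq)
      ... | inj₁ lt   = below (λ { _ refl → lt }) eq
      ... | inj₂ refl = ℤₚ.≤-reflexive (sym (trans
        (cong (λ x → U (coef x) (suc (suc n)) (φ s) i) eq) (coef-vanishes (suc (suc n)) (s≤s (s≤s z≤n)) (φ s) i)))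

  -- A point inside the fundamental chamber: all values are positive, as the empty word has no
  -- descents.
  origin : State
  origin _ _ = 1ℤ

  value : List S → S → V
  value a s = act origin a s

  value-≈ : ∀ {a b} → a ≈ b → ∀ s → value a s ≗ value b s
  value-≈ e s = act-≈ e origin s

  value-snoc : ∀ a s → value (a ++ [ s ]) s ≗ ⊝ value a s
  value-snoc a s i = trans (cong (λ ψ → ψ s i) (act-++ origin a [ s ])) (fire-self (act origin a) s i)

  -- Descents and the word problem

  ≈-setoid : Setoid _ _
  ≈-setoid = record { Carrier = List S ; _≈_ = _≈_ ; isEquivalence = record { refl = refl≈ ; sym = sym≈ ; trans = trans≈ } }

  module ≈-Reasoning = SetoidReasoning ≈-setoid

  ≡⇒≈ : ∀ {u v} → u ≡ v → u ≈ v
  ≡⇒≈ refl = refl≈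

  -- Congruence, inverses and cancellation in the group of words

  ++-congˡ : ∀ w {u v} → u ≈ v → w ++ u ≈ w ++ v
  ++-congˡ w refl≈ = refl≈
  ++-congˡ w (sym≈ e) = sym≈ (++-congˡ w e)
  ++-congˡ w (trans≈ e e′) = trans≈ (++-congˡ w e) (++-congˡ w e′)
  ++-congˡ w (cancel u s v)
    rewrite sym (Listₚ.++-assoc w u (s ∷ s ∷ v)) | sym (Listₚ.++-assoc w u v) = cancel (w ++ u) s v
  ++-congˡ w (braid u s t k v eq)
    rewrite sym (Listₚ.++-assoc w u (alt s t k ++ v)) | sym (Listₚ.++-assoc w u (alt t s k ++ v)) = braid (w ++ u) s t k v eq

  ++-congʳ : ∀ w {u v} → u ≈ v → u ++ w ≈ v ++ w
  ++-congʳ w refl≈ = refl≈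
  ++-congʳ w (sym≈ e) = sym≈ (++-congʳ w e)
  ++-congʳ w (trans≈ e e′) = trans≈ (++-congʳ w e) (++-congʳ w e′)
  ++-congʳ w (cancel u s v)
    rewrite Listₚ.++-assoc u (s ∷ s ∷ v) w | Listₚ.++-assoc u v w = cancel u s (v ++ w)
  ++-congʳ w (braid u s t k v eq)
    rewrite Listₚ.++-assoc u (alt s t k ++ v) w | Listₚ.++-assoc u (alt t s k ++ v) w
          | Listₚ.++-assoc (alt s t k) v w | Listₚ.++-assoc (alt t s k) v w = braid u s t k (v ++ w) eq

  ++-cong : ∀ {u u′ v v′} → u ≈ u′ → v ≈ v′ → u ++ v ≈ u′ ++ v′
  ++-cong {u′ = u′} {v} e e′ = trans≈ (++-congʳ v e) (++-congˡ u′ e′)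

  ∷-cong : ∀ s {u v} → u ≈ v → s ∷ u ≈ s ∷ v
  ∷-cong s = ++-congˡ [ s ]

  snoc-snoc : ∀ u s → (u ++ [ s ]) ++ [ s ] ≈ u
  snoc-snoc u s = trans≈ (≡⇒≈ (Listₚ.++-assoc u [ s ] [ s ])) (trans≈ (cancel u s []) (≡⇒≈ (Listₚ.++-identityʳ u)))

  snoc-flip : ∀ {u v} s → u ≈ v ++ [ s ] → u ++ [ s ] ≈ v
  snoc-flip {u} {v} s e = trans≈ (++-congʳ [ s ] e) (snoc-snoc v s)

  snoc-cancel : ∀ {u v} s → u ++ [ s ] ≈ v ++ [ s ] → u ≈ v
  snoc-cancel {u} s e = trans≈ (sym≈ (snoc-snoc u s)) (snoc-flip s e)

  cons-cons : ∀ s u → s ∷ s ∷ u ≈ u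
  cons-cons s u = cancel [] s u

  cons-flip : ∀ {u v} s → u ≈ s ∷ v → s ∷ u ≈ v
  cons-flip {v = v} s e = trans≈ (∷-cong s e) (cons-cons s v)

  inverseˡ : ∀ u → reverse u ++ u ≈ []
  inverseˡ []      = refl≈
  inverseˡ (s ∷ u) rewrite Listₚ.unfold-reverse s u | Listₚ.++-assoc (reverse u) [ s ] (s ∷ u) =
    trans≈ (cancel (reverse u) s u) (inverseˡ u)

  inverseʳ : ∀ u → u ++ reverse u ≈ []
  inverseʳ []      = refl≈
  inverseʳ (s ∷ u) rewrite Listₚ.unfold-reverse s u | sym (Listₚ.++-assoc u (reverse u) [ s ]) =
    trans≈ (∷-cong s (++-congʳ [ s ] (inverseʳ u))) (cons-cons s [])

  ++-cancelˡ-≈ : ∀ w {u v} → w ++ u ≈ w ++ v → u ≈ v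
  ++-cancelˡ-≈ []      e = e
  ++-cancelˡ-≈ (s ∷ w) {u} {v} e = ++-cancelˡ-≈ w
    (trans≈ (sym≈ (cons-cons s (w ++ u))) (cons-flip s e))

  ++-cancelʳ-≈ : ∀ w {u v} → u ++ w ≈ v ++ w → u ≈ v
  ++-cancelʳ-≈ w {u} {v} e = trans≈ (sym≈ (undo u)) (trans≈ (++-congʳ (reverse w) e) (undo v))
    where
      undo : ∀ x → (x ++ w) ++ reverse w ≈ x
      undo x = trans≈ (≡⇒≈ (Listₚ.++-assoc x w (reverse w)))
        (trans≈ (++-congˡ x (inverseʳ w)) (≡⇒≈ (Listₚ.++-identityʳ x)))

  reverse-cong : ∀ {u v} → u ≈ v → reverse u ≈ reverse v
  reverse-cong {u} {v} e = ++-cancelʳ-≈ v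
    (trans≈ (++-congˡ (reverse u) (sym≈ e)) (trans≈ (inverseˡ u) (sym≈ (inverseˡ v))))

  par-⊎ : ∀ n p q {s} → s ≡ p ⊎ s ≡ q → par n p q ≡ s ⊎ par n q p ≡ s
  par-⊎ zero    p q (inj₁ refl) = inj₁ refl
  par-⊎ zero    p q (inj₂ refl) = inj₂ refl
  par-⊎ (suc n) p q (inj₁ refl) = par-⊎ n q p (inj₂ refl)
  par-⊎ (suc n) p q (inj₂ refl) = par-⊎ n q p (inj₁ refl)

  par-par : ∀ j i p q → par j (par i p q) (par i q p) ≡ par (i ℕ.+ j) p q
  par-par j zero    p q = refl
  par-par j (suc i) p q = par-par j i q p

  alt-++ : ∀ p q i j → alt p q (i ℕ.+ j) ≡ alt p q i ++ alt (par i p q) (par i q p) j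
  alt-++ p q zero    j = refl
  alt-++ p q (suc i) j = cong (p ∷_) (alt-++ q p i j)

  length-alt : ∀ s t n → length (alt s t n) ≡ n
  length-alt s t zero    = refl
  length-alt s t (suc n) = cong suc (length-alt t s n)

  -- Descents are stated through an explicit shorter word because the length function depends on the
  -- reduction that is built from them.
  Drop : List S → S → Set
  Drop a s = ∃ λ a′ → length a′ < length a × a ≈ a′ ++ [ s ]

  -- A braid relation on the last j letters exchanges the two possible final letters.
  alt-swap-end : ∀ p q k j → m p q ≡ just j → j ≤ k →
                 ∃ λ d → suc (length d) ≡ k × alt p q k ≈ d ++ [ par k p q ]
  alt-swap-end p q k zero    eq _   = ⊥-elim (m≢0 p q eq)
  alt-swap-end p q k (suc j) eq j<k = d , length-d , (begin
    alt p q k                              ≡⟨ cong (alt p q) k≡ ⟩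
    alt p q (i ℕ.+ suc j)                  ≡⟨ alt-++ p q i (suc j) ⟩
    alt p q i ++ alt p′ q′ (suc j)         ≈⟨ ++-congˡ (alt p q i) swapped ⟩
    alt p q i ++ alt q′ p′ (suc j)         ≡⟨ cong (alt p q i ++_) (alt-snoc q′ p′ j) ⟩
    alt p q i ++ (alt q′ p′ j ++ [ par j q′ p′ ]) ≡⟨ sym (Listₚ.++-assoc (alt p q i) (alt q′ p′ j) _) ⟩
    d ++ [ par j q′ p′ ]                   ≡⟨ cong (λ x → d ++ [ x ]) last ⟩
    d ++ [ par k p q ] ∎)
    where
      open ≈-Reasoning
      i  = k ℕ.∸ suc j
      p′ = par i p q
      q′ = par i q p
      d  = alt p q i ++ alt q′ p′ j
      k≡ : k ≡ i ℕ.+ suc j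
      k≡ = sym (ℕₚ.m∸n+n≡m j<k)
      length-d : suc (length d) ≡ k
      length-d = trans (cong suc (trans (Listₚ.length-++ (alt p q i)) (cong₂ ℕ._+_ (length-alt p q i) (length-alt q′ p′ j))))
        (trans (sym (ℕₚ.+-suc i j)) (sym k≡))
      swapped : alt p′ q′ (suc j) ≈ alt q′ p′ (suc j)
      swapped = trans≈ (≡⇒≈ (sym (Listₚ.++-identityʳ _)))
        (trans≈ (braid [] p′ q′ (suc j) [] (trans (m-par p q i) eq)) (≡⇒≈ (Listₚ.++-identityʳ _)))
      last : par j q′ p′ ≡ par k p q
      last = trans (par-par j i q p) (sym (trans (cong (λ x → par x p q) (trans k≡ (ℕₚ.+-suc i j))) refl))

  <∞-dec : ∀ k x → k <∞ x ⊎ ∃ λ j → x ≡ just j × j ≤ k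
  <∞-dec k nothing = inj₁ λ _ ()
  <∞-dec k (just j) with k ℕ.<? j
  ... | yes k<j = inj₁ λ { _ refl → k<j }
  ... | no  k≮j = inj₂ (j , refl , ℕₚ.≮⇒≥ k≮j)

  -- Every element of the dihedral coset of a is written as v (alternating word) with v of minimal length, so that
  -- both values at v are positive; the values along the alternating word stay positive up to the order m p q.
  module _ (a : List S) where

    record Coset : Set where
      constructor coset
      field
        {v}    : List S
        {p q}  : S
        {k}    : ℕ
        a≈     : a ≈ v ++ alt p q k
        short  : length v ℕ.+ k ≤ length a

    module _ (N : ℕ) (descend : ∀ v s → length v ≤ N → Pos (value v s) ⊎ Drop v s) (s : S) where

      -- If `s` is the letter that would continue the alternating word, it is an ascent below the
      -- order, and from the order on a braid relation brings it to the end. Otherwise it already is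
      -- the last letter, or the alternating word is empty and the value is that of `v`.
      finish : (c : Coset) → let open Coset c in s ≡ p ⊎ s ≡ q → m p q ≢ just 1 →
               Pos (value v p) → Pos (value v q) → Pos (value a s) ⊎ Drop a s
      finish (coset {v} {p} {q} {k} a≈ short) s∈ m≢1 pos-p pos-q with par-⊎ k p q s∈
      ... | inj₁ refl with <∞-dec k (m p q)
      ...   | inj₁ k<m = inj₁ λ i → subst (0ℤ ℤ.<_)
                  (sym (trans (value-≈ a≈ s i) (cong (λ ψ → ψ s i) (act-++ origin v (alt p q k)))))
                  (act-alt-pos (act origin v) p q k m≢1 k<m pos-p pos-q i)
      ...   | inj₂ (j , eq , j≤k) with alt-swap-end p q k j eq j≤k
      ...     | d , refl , e = inj₂ (v ++ d , bound , trans≈ a≈ (trans≈ (++-congˡ v e) (≡⇒≈ (sym (Listₚ.++-assoc v d _)))))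
        where
          bound : length (v ++ d) < length a
          bound = subst (_≤ length a) (trans (ℕₚ.+-suc (length v) (length d)) (cong suc (sym (Listₚ.length-++ v)))) short
      finish (coset {v} {p} {q} {zero} a≈ short) s∈ m≢1 pos-p pos-q | inj₂ refl = inj₁ λ i →
        subst (0ℤ ℤ.<_) (sym (value-≈ (trans≈ a≈ (≡⇒≈ (Listₚ.++-identityʳ v))) q i)) (pos-q i)
      finish (coset {v} {p} {q} {suc k} a≈ short) s∈ m≢1 pos-p pos-q | inj₂ refl =
        inj₂ (v ++ alt p q k , bound , trans≈ a≈
          (≡⇒≈ (trans (cong (v ++_) (alt-snoc p q k)) (sym (Listₚ.++-assoc v (alt p q k) _)))))
        where
          bound : length (v ++ alt p q k) < length a
          bound = subst (_≤ length a) (trans (ℕₚ.+-suc (length v) k)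
            (cong suc (sym (trans (Listₚ.length-++ v) (cong (length v ℕ.+_) (length-alt p q k)))))) short

      -- A descent of `v` moves into the alternating word: `q` is put in front of it, `p` is put in
      -- front of an empty one and cancels the first letter of a nonempty one. Each move shortens
      -- `v`, whose length is bounded by `f`.
      minimise : ∀ f (c : Coset) → let open Coset c in length v ≤ f → f ≤ N → s ≡ p ⊎ s ≡ q → m p q ≢ just 1 →
                 Pos (value a s) ⊎ Drop a s
      minimise f c@(coset {v} {p} {q} {k} a≈ short) v≤f f≤N s∈ m≢1
        with descend v p (ℕₚ.≤-trans v≤f f≤N) | descend v q (ℕₚ.≤-trans v≤f f≤N)
      ... | inj₁ pos-p | inj₁ pos-q = finish c s∈ m≢1 pos-p pos-q
      minimise zero c v≤f f≤N s∈ m≢1 | inj₂ (v′ , v′<v , _) | _ = ⊥-elim (ℕₚ.n≮0 (ℕₚ.<-≤-trans v′<v v≤f))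
      minimise zero c v≤f f≤N s∈ m≢1 | inj₁ _ | inj₂ (v′ , v′<v , _) = ⊥-elim (ℕₚ.n≮0 (ℕₚ.<-≤-trans v′<v v≤f))
      minimise (suc f) (coset {v} {p} {q} {k} a≈ short) v≤f f≤N s∈ m≢1 | inj₁ _ | inj₂ (v′ , v′<v , v≈) =
        minimise f (coset {v = v′} {q} {p} {suc k} (trans≈ a≈ (trans≈ (++-congʳ _ v≈) (≡⇒≈ (Listₚ.++-assoc v′ [ q ] _))))
            (ℕₚ.≤-trans (ℕₚ.≤-trans (ℕₚ.≤-reflexive (ℕₚ.+-suc (length v′) k)) (ℕₚ.+-monoˡ-≤ k v′<v)) short))
          (ℕₚ.≤-pred (ℕₚ.<-≤-trans v′<v v≤f)) (ℕₚ.<⇒≤ f≤N) (swap s∈) (λ e → m≢1 (trans (m-sym p q) e))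
      minimise (suc f) (coset {v} {p} {q} {zero} a≈ short) v≤f f≤N s∈ m≢1 | inj₂ (v′ , v′<v , v≈) | _ =
        minimise f (coset {v = v′} {p} {q} {1} (trans≈ a≈ (trans≈ (≡⇒≈ (Listₚ.++-identityʳ v)) v≈))
            (ℕₚ.≤-trans (ℕₚ.≤-reflexive (ℕₚ.+-comm (length v′) 1)) (ℕₚ.≤-trans v′<v (ℕₚ.≤-trans (ℕₚ.m≤m+n (length v) 0) short))))
          (ℕₚ.≤-pred (ℕₚ.<-≤-trans v′<v v≤f)) (ℕₚ.<⇒≤ f≤N) s∈ m≢1
      minimise (suc f) (coset {v} {p} {q} {suc k} a≈ short) v≤f f≤N s∈ m≢1 | inj₂ (v′ , v′<v , v≈) | _ =
        minimise f (coset {v = v′} {q} {p} {k}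
            (trans≈ a≈ (trans≈ (++-congʳ _ v≈) (trans≈ (≡⇒≈ (Listₚ.++-assoc v′ [ p ] _)) (cancel v′ p (alt q p k)))))
            (ℕₚ.≤-trans (ℕₚ.+-mono-≤ (ℕₚ.<⇒≤ v′<v) (ℕₚ.n≤1+n k)) short))
          (ℕₚ.≤-pred (ℕₚ.<-≤-trans v′<v v≤f)) (ℕₚ.<⇒≤ f≤N) (swap s∈) (λ e → m≢1 (trans (m-sym p q) e))

  length-snoc : ∀ (a : List S) s → length (a ++ [ s ]) ≡ suc (length a)
  length-snoc a s = trans (Listₚ.length-++ a) (ℕₚ.+-comm (length a) 1)

  ascent-or-drop-≤ : ∀ N a s → length a ≤ N → Pos (value a s) ⊎ Drop a s
  ascent-or-drop-≤ N a s a≤N with initLast a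
  ... | [] = inj₁ λ _ → ℤ.+<+ (s≤s z≤n)
  ascent-or-drop-≤ zero    ._ s a≤N | a ∷ʳ′ t =
    ⊥-elim (ℕₚ.n≮0 (subst (_≤ 0) (length-snoc a t) a≤N))
  ascent-or-drop-≤ (suc N) ._ s a≤N | a ∷ʳ′ t with ≡-dec ℕ._≟_ (m s t) (just 1)
  -- The braid relation of order 1 rewrites the last letter `t` as `s`.
  ... | yes eq = inj₂ (a , ℕₚ.≤-reflexive (sym (length-snoc a t)) , sym≈ (braid a s t 1 [] eq))
  ... | no m≢1 = minimise (a ++ [ t ]) N (ascent-or-drop-≤ N) s N
        (coset {v = a} {t} {s} {1} refl≈ (ℕₚ.≤-reflexive (sym (Listₚ.length-++ a))))
        (ℕₚ.≤-pred (subst (_≤ suc N) (length-snoc a t) a≤N)) ℕₚ.≤-refl (inj₂ refl) (λ e → m≢1 (trans (m-sym s t) e))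

  ascent-or-drop : ∀ a s → Pos (value a s) ⊎ Drop a s
  ascent-or-drop a s = ascent-or-drop-≤ (length a) a s ℕₚ.≤-refl

  Reduced-≈-length : ∀ {a b} → Reduced a → Reduced b → a ≈ b → length a ≡ length b
  Reduced-≈-length ra rb e = ℕₚ.≤-antisym (ra _ (sym≈ e)) (rb _ e)

  -- A word b for r s that is no longer than r would have a negative value at s. So it would end in
  -- s up to equivalence, and dropping s would give a word for r that is shorter than r.
  Reduced-ascent : ∀ {r s} → Reduced r → Pos (value r s) → Reduced (r ++ [ s ])
  Reduced-ascent {r} {s} red pos b b≈ = subst (_≤ length b) (sym (length-snoc r s)) (ℕₚ.≰⇒> not-shorter)
    where
      negative : ∀ i → value b s i ≡ - value r s i
      negative i = trans (value-≈ b≈ s i) (value-snoc r s i)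
      not-shorter : ¬ (length b ≤ length r)
      not-shorter b≤r with ascent-or-drop b s
      ... | inj₁ pos′ = ℤₚ.<-asym (pos′ 0) (subst (ℤ._< 0ℤ) (sym (negative 0)) (ℤₚ.neg-mono-< (pos 0)))
      ... | inj₂ (b′ , b′<b , e) = ℕₚ.<⇒≱ (ℕₚ.<-≤-trans b′<b b≤r)
        (red b′ (trans≈ (sym≈ (snoc-flip s e)) (snoc-flip s b≈)))

  Reduced-drop : ∀ {r s} → Reduced r → (d : Drop r s) → Reduced (proj₁ d)
  Reduced-drop {r} {s} red (a′ , a′<r , e) b b≈a′ = ℕₚ.≤-pred (ℕₚ.≤-trans a′<r
    (subst (length r ≤_) (length-snoc b s) (red (b ++ [ s ]) (trans≈ (++-congʳ [ s ] b≈a′) (sym≈ e)))))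

  reduce-from : ∀ r → Reduced r → ∀ a → ∃ λ b → b ≈ r ++ a × Reduced b
  reduce-from r red []      = r , ≡⇒≈ (sym (Listₚ.++-identityʳ r)) , red
  reduce-from r red (s ∷ a) with ascent-or-drop r s
  ... | inj₁ pos with reduce-from (r ++ [ s ]) (Reduced-ascent red pos) a
  ...   | b , b≈ , redb = b , trans≈ b≈ (≡⇒≈ (Listₚ.++-assoc r [ s ] a)) , redb
  reduce-from r red (s ∷ a) | inj₂ d@(r′ , _ , e) with reduce-from r′ (Reduced-drop red d) a
  ...   | b , b≈ , redb = b , trans≈ b≈ (trans≈ (++-congʳ a (sym≈ (snoc-flip s e))) (≡⇒≈ (Listₚ.++-assoc r [ s ] a))) , redb

  reduce : ∀ a → ∃ λ b → b ≈ a × Reduced b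
  reduce = reduce-from [] (λ _ _ → z≤n)

  infix 4 _≈?_
  opaque
    -- Two words are equivalent exactly when the reduced form of a b⁻¹ is empty. Opacity keeps the
    -- reduction from unfolding in later goals.
    _≈?_ : ∀ a b → Dec (a ≈ b)
    a ≈? b with reduce (a ++ reverse b)
    ... | []    , e , _ = yes (++-cancelʳ-≈ (reverse b) (trans≈ (sym≈ e) (sym≈ (inverseʳ b))))
    ... | _ ∷ _ , e , r = no λ a≈b → ℕₚ.n≮0 (r [] (trans≈ (sym≈ (inverseʳ b)) (trans≈ (++-congʳ (reverse b) (sym≈ a≈b)) (sym≈ e))))

  opaque
    normal : List S → List S
    normal a = proj₁ (reduce a)

    normal-≈ : ∀ a → normal a ≈ a
    normal-≈ a = proj₁ (proj₂ (reduce a))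

    normal-Reduced : ∀ a → Reduced (normal a)
    normal-Reduced a = proj₂ (proj₂ (reduce a))

  -- The length function, ascents and descents

  ℓ : List S → ℕ
  ℓ a = length (normal a)

  ℓ-≈ : ∀ {a b} → a ≈ b → ℓ a ≡ ℓ b
  ℓ-≈ {a} {b} e = Reduced-≈-length (normal-Reduced a) (normal-Reduced b)
    (trans≈ (normal-≈ a) (trans≈ e (sym≈ (normal-≈ b))))

  ℓ-Reduced : ∀ {a} → Reduced a → ℓ a ≡ length a
  ℓ-Reduced {a} r = Reduced-≈-length (normal-Reduced a) r (normal-≈ a)

  ℓ≤length : ∀ a → ℓ a ≤ length a
  ℓ≤length a = normal-Reduced a a (sym≈ (normal-≈ a))

  Reduced-ℓ : ∀ {a} → length a ≤ ℓ a → Reduced a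
  Reduced-ℓ {a} le b b≈a = ℕₚ.≤-trans le (subst (_≤ length b) (ℓ-≈ b≈a) (ℓ≤length b))

  Up Down : List S → S → Set
  Up   u s = ℓ (u ++ [ s ]) ≡ suc (ℓ u)
  Down u s = ℓ u ≡ suc (ℓ (u ++ [ s ]))

  up-or-down : ∀ u s → Up u s ⊎ Down u s
  up-or-down u s with ascent-or-drop (normal u) s
  ... | inj₁ pos = inj₁ (trans (ℓ-≈ (++-congʳ [ s ] (sym≈ (normal-≈ u))))
        (trans (ℓ-Reduced (Reduced-ascent (normal-Reduced u) pos)) (length-snoc (normal u) s)))
  ... | inj₂ d@(a′ , lt , e) = inj₂ (ℕₚ.≤-antisym
        (ℕₚ.≤-trans (normal-Reduced u (a′ ++ [ s ]) (sym≈ e)) (ℕₚ.≤-reflexive (trans (length-snoc a′ s) (cong suc same))))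
        (subst (λ x → suc x ≤ ℓ u) same lt))
    where
      same : length a′ ≡ ℓ (u ++ [ s ])
      same = trans (sym (ℓ-Reduced (Reduced-drop (normal-Reduced u) d)))
        (ℓ-≈ (trans≈ (sym≈ (snoc-flip s e)) (++-congʳ [ s ] (normal-≈ u))))

  up-down : ∀ {u s} → Up u s → Down u s → ⊥
  up-down {u} p q = ℕₚ.<-irrefl (trans q (cong suc p)) (s≤s (ℕₚ.n≤1+n (ℓ u)))

  ℓ-reverse : ∀ u → ℓ (reverse u) ≡ ℓ u
  ℓ-reverse u = ℕₚ.≤-antisym (below u) (subst (λ x → ℓ x ≤ ℓ (reverse u)) (Listₚ.reverse-involutive u) (below (reverse u)))
    where
      below : ∀ u → ℓ (reverse u) ≤ ℓ u
      below u = ℕₚ.≤-trans (ℕₚ.≤-reflexive (ℓ-≈ (reverse-cong (sym≈ (normal-≈ u)))))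
        (ℕₚ.≤-trans (ℓ≤length _) (ℕₚ.≤-reflexive (Listₚ.length-reverse (normal u))))

  -- Reflections and strong exchange

  same : List S → List S → Bool
  same u v = does (u ≈? v)

  same-iff : ∀ {u v u′ v′} → (u ≈ v → u′ ≈ v′) → (u′ ≈ v′ → u ≈ v) → same u v ≡ same u′ v′
  same-iff {u} {v} {u′} {v′} f g with u ≈? v | u′ ≈? v′
  ... | yes _ | yes _ = refl
  ... | no  _ | no  _ = refl
  ... | yes p | no ¬q = ⊥-elim (¬q (f p))
  ... | no ¬p | yes q = ⊥-elim (¬p (g q))

  conj : S → List S → List S
  conj s x = s ∷ x ++ [ s ]

  conj-cong : ∀ s {x y} → x ≈ y → conj s x ≈ conj s y
  conj-cong s e = ∷-cong s (++-congʳ [ s ] e)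

  conj-conj : ∀ s x → conj s (conj s x) ≈ x
  conj-conj s x = trans≈ (cons-cons s _) (snoc-snoc x s)

  conj-cancel : ∀ s {x y} → conj s x ≈ conj s y → x ≈ y
  conj-cancel s {x} {y} e = trans≈ (sym≈ (conj-conj s x)) (trans≈ (conj-cong s e) (conj-conj s y))

  conj-self : ∀ s → conj s [ s ] ≈ [ s ]
  conj-self s = cons-cons s [ s ]

  -- The parity of the number of i with x = a₁⋯aᵢ₋₁ aᵢ aᵢ₋₁⋯a₁.
  η : List S → List S → Bool
  η []      x = false
  η (s ∷ a) x = same [ s ] x xor η a (conj s x)

  η-congʳ : ∀ a {x y} → x ≈ y → η a x ≡ η a y
  η-congʳ []      e = refl
  η-congʳ (s ∷ a) e = cong₂ _xor_ (same-iff (λ p → trans≈ p e) (λ p → trans≈ p (sym≈ e))) (η-congʳ a (conj-cong s e))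

  -- The cocycle rule for inversion sets modulo 2: inside u v, the reflections of v appear
  -- conjugated by u.
  η-++ : ∀ u v x → η (u ++ v) x ≡ η u x xor η v (reverse u ++ x ++ u)
  η-++ []      v x = η-congʳ v (≡⇒≈ (sym (Listₚ.++-identityʳ x)))
  η-++ (s ∷ u) v x = trans (cong (same [ s ] x xor_) (trans (η-++ u v (conj s x))
      (cong (λ y → η u (conj s x) xor η v y) shift)))
    (sym (Boolₚ.xor-assoc (same [ s ] x) _ _))
    where
      open ≡-Reasoning
      shift : reverse u ++ (conj s x ++ u) ≡ reverse (s ∷ u) ++ (x ++ s ∷ u)
      shift = begin
        reverse u ++ (s ∷ ((x ++ [ s ]) ++ u)) ≡⟨ cong (λ y → reverse u ++ s ∷ y) (Listₚ.++-assoc x [ s ] u) ⟩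
        reverse u ++ ([ s ] ++ (x ++ s ∷ u))   ≡⟨ sym (Listₚ.++-assoc (reverse u) [ s ] _) ⟩
        (reverse u ++ [ s ]) ++ (x ++ s ∷ u)   ≡⟨ cong (_++ (x ++ s ∷ u)) (sym (Listₚ.unfold-reverse s u)) ⟩
        reverse (s ∷ u) ++ (x ++ s ∷ u) ∎

  xor-cancel : ∀ a b → a xor (a xor b) ≡ b
  xor-cancel true  b = Boolₚ.not-involutive b
  xor-cancel false b = refl

  xors : (ℕ → Bool) → ℕ → Bool
  xors f zero    = false
  xors f (suc k) = xors f k xor f k

  xors-front : ∀ f k → xors f (suc k) ≡ f 0 xor xors (λ i → f (suc i)) k
  xors-front f zero    = sym (Boolₚ.xor-identityʳ (f 0))
  xors-front f (suc k) = trans (cong (_xor f (suc k)) (xors-front f k)) (Boolₚ.xor-assoc (f 0) _ _)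

  xors-reverse : ∀ k {f g : ℕ → Bool} → (∀ i j → suc (i ℕ.+ j) ≡ k → f i ≡ g j) → xors f k ≡ xors g k
  xors-reverse zero    h = refl
  xors-reverse (suc k) {f} {g} h = trans
    (trans (cong₂ _xor_ (xors-reverse k (λ i j e → h i (suc j) (cong suc (trans (ℕₚ.+-suc i j) e)))) (h k 0 (cong suc (ℕₚ.+-identityʳ k))))
      (Boolₚ.xor-comm _ (g 0)))
    (sym (xors-front g k))

  par-even : ∀ i s t → par (i ℕ.+ i) s t ≡ s
  par-even zero    s t = refl
  par-even (suc i) s t = trans (cong (λ n → par n t s) (ℕₚ.+-suc i i)) (par-even i s t)

  -- The reflections along an alternating word are the alternating words of odd length.
  alt-palindrome : ∀ s t k → alt s t k ++ (par k s t ∷ reverse (alt s t k)) ≡ alt s t (suc (k ℕ.+ k))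
  alt-palindrome s t zero    = refl
  alt-palindrome s t (suc k) = cong (s ∷_) (begin
    alt t s k ++ (par k t s ∷ reverse (s ∷ alt t s k))
      ≡⟨ cong (λ y → alt t s k ++ par k t s ∷ y) (Listₚ.unfold-reverse s (alt t s k)) ⟩
    alt t s k ++ (par k t s ∷ (reverse (alt t s k) ++ [ s ]))
      ≡⟨ sym (Listₚ.++-assoc (alt t s k) (par k t s ∷ reverse (alt t s k)) [ s ]) ⟩
    (alt t s k ++ (par k t s ∷ reverse (alt t s k))) ++ [ s ]
      ≡⟨ cong (_++ [ s ]) (alt-palindrome t s k) ⟩
    alt t s (suc (k ℕ.+ k)) ++ [ s ]
      ≡⟨ cong (λ y → alt t s (suc (k ℕ.+ k)) ++ [ y ]) (sym (par-even k s t)) ⟩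
    alt t s (suc (k ℕ.+ k)) ++ [ par (suc (k ℕ.+ k)) t s ]
      ≡⟨ sym (alt-snoc t s (suc (k ℕ.+ k))) ⟩
    alt t s (suc (suc (k ℕ.+ k)))
      ≡⟨ cong (λ n → alt t s (suc n)) (sym (ℕₚ.+-suc k k)) ⟩
    alt t s (suc (k ℕ.+ suc k)) ∎)
    where
      open ≡-Reasoning

  reverse-alt : ∀ s t k → reverse (alt s t k) ≡ alt (par k t s) (par k s t) k
  reverse-alt s t zero    = refl
  reverse-alt s t (suc k) = begin
    reverse (alt s t (suc k))              ≡⟨ cong reverse (alt-snoc s t k) ⟩
    reverse (alt s t k ++ [ par k s t ])   ≡⟨ Listₚ.reverse-++ (alt s t k) [ par k s t ] ⟩
    par k s t ∷ reverse (alt s t k)        ≡⟨ cong (par k s t ∷_) (reverse-alt s t k) ⟩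
    alt (par k s t) (par k t s) (suc k) ∎
    where open ≡-Reasoning

  same-conjugate : ∀ s u x → same [ s ] (reverse u ++ x ++ u) ≡ same (u ++ s ∷ reverse u) x
  same-conjugate s u x = same-iff to from
    where
      open ≈-Reasoning
      to : [ s ] ≈ reverse u ++ x ++ u → u ++ s ∷ reverse u ≈ x
      to e = begin
        u ++ ([ s ] ++ reverse u)                    ≈⟨ ++-congˡ u (++-congʳ (reverse u) e) ⟩
        u ++ ((reverse u ++ (x ++ u)) ++ reverse u)  ≡⟨ cong (u ++_) (Listₚ.++-assoc (reverse u) (x ++ u) (reverse u)) ⟩
        u ++ (reverse u ++ ((x ++ u) ++ reverse u))  ≡⟨ sym (Listₚ.++-assoc u (reverse u) _) ⟩
        (u ++ reverse u) ++ ((x ++ u) ++ reverse u)  ≈⟨ ++-congʳ _ (inverseʳ u) ⟩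
        (x ++ u) ++ reverse u                        ≡⟨ Listₚ.++-assoc x u (reverse u) ⟩
        x ++ (u ++ reverse u)                        ≈⟨ ++-congˡ x (inverseʳ u) ⟩
        x ++ []                                      ≡⟨ Listₚ.++-identityʳ x ⟩
        x ∎
      from : u ++ s ∷ reverse u ≈ x → [ s ] ≈ reverse u ++ x ++ u
      from e = begin
        [] ++ [ s ]                                     ≈⟨ ++-cong (sym≈ (inverseˡ u)) (sym≈ (++-congˡ [ s ] (inverseˡ u))) ⟩
        (reverse u ++ u) ++ ((s ∷ reverse u) ++ u)      ≡⟨ Listₚ.++-assoc (reverse u) u _ ⟩
        reverse u ++ (u ++ ((s ∷ reverse u) ++ u))      ≡⟨ cong (reverse u ++_) (sym (Listₚ.++-assoc u (s ∷ reverse u) u)) ⟩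
        reverse u ++ ((u ++ (s ∷ reverse u)) ++ u)      ≈⟨ ++-congˡ (reverse u) (++-congʳ u e) ⟩
        reverse u ++ (x ++ u) ∎

  η-alt : ∀ s t k x → η (alt s t k) x ≡ xors (λ i → same (alt s t (suc (i ℕ.+ i))) x) k
  η-alt s t zero    x = refl
  η-alt s t (suc k) x = begin
    η (alt s t (suc k)) x
      ≡⟨ cong (λ a → η a x) (alt-snoc s t k) ⟩
    η (alt s t k ++ [ par k s t ]) x
      ≡⟨ η-++ (alt s t k) [ par k s t ] x ⟩
    η (alt s t k) x xor (same [ par k s t ] (reverse (alt s t k) ++ x ++ alt s t k) xor false)
      ≡⟨ cong₂ _xor_ (η-alt s t k x) (Boolₚ.xor-identityʳ _) ⟩
    xors f k xor same [ par k s t ] (reverse (alt s t k) ++ x ++ alt s t k)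
      ≡⟨ cong (xors f k xor_) (same-conjugate (par k s t) (alt s t k) x) ⟩
    xors f k xor same (alt s t k ++ par k s t ∷ reverse (alt s t k)) x
      ≡⟨ cong (λ a → xors f k xor same a x) (alt-palindrome s t k) ⟩
    xors f k xor f k ∎
    where
      open ≡-Reasoning
      f : ℕ → Bool
      f i = same (alt s t (suc (i ℕ.+ i))) x

  -- The braid relation reverses the sequence of reflections along alt s t k.
  alt-odd-≈ : ∀ s t k → alt s t k ≈ alt t s k → ∀ i j → suc (i ℕ.+ j) ≡ k →
              alt s t (suc (i ℕ.+ i)) ≈ alt t s (suc (j ℕ.+ j))
  alt-odd-≈ s t k e i j refl = ++-cancelʳ-≈ (reverse (alt t s b)) (trans≈ left (sym≈ (inverseʳ (alt t s b))))
    where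
      a = suc (i ℕ.+ i)
      b = suc (j ℕ.+ j)
      sum : a ℕ.+ b ≡ k ℕ.+ k
      sum = cong suc (trans (ℕₚ.+-suc (i ℕ.+ i) (j ℕ.+ j)) (trans (cong suc (interchange ℕₚ.+-commutativeSemigroup i i j j)) (sym (ℕₚ.+-suc (i ℕ.+ j) (i ℕ.+ j)))))
      open ≈-Reasoning
      left : alt s t a ++ reverse (alt t s b) ≈ []
      left = begin
        alt s t a ++ reverse (alt t s b)
          ≡⟨ cong (alt s t a ++_) (reverse-alt t s b) ⟩
        alt s t a ++ alt (par b s t) (par b t s) b
          ≡⟨ cong₂ (λ x y → alt s t a ++ alt x y b) (trans (par-even j t s) (sym (par-even i t s))) (trans (par-even j s t) (sym (par-even i s t))) ⟩
        alt s t a ++ alt (par a s t) (par a t s) b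
          ≡⟨ sym (alt-++ s t a b) ⟩
        alt s t (a ℕ.+ b)
          ≡⟨ cong (alt s t) sum ⟩
        alt s t (k ℕ.+ k)
          ≡⟨ alt-++ s t k k ⟩
        alt s t k ++ alt (par k s t) (par k t s) k
          ≡⟨ cong (alt s t k ++_) (sym (reverse-alt t s k)) ⟩
        alt s t k ++ reverse (alt t s k)
          ≈⟨ ++-congʳ _ e ⟩
        alt t s k ++ reverse (alt t s k)
          ≈⟨ inverseʳ (alt t s k) ⟩
        [] ∎

  η-braid : ∀ s t k x → alt s t k ≈ alt t s k → η (alt s t k) x ≡ η (alt t s k) x
  η-braid s t k x e = trans (η-alt s t k x) (trans
    (xors-reverse k λ i j eq → let e′ = alt-odd-≈ s t k e i j eq in
      same-iff (λ p → trans≈ (sym≈ e′) p) (λ p → trans≈ e′ p))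
    (sym (η-alt t s k x)))

  conjugate-cong : ∀ {u v} x → u ≈ v → reverse u ++ x ++ u ≈ reverse v ++ x ++ v
  conjugate-cong x e = ++-cong (reverse-cong e) (++-congˡ x e)

  -- Counting modulo 2 takes care of ss = 1, since both letters contribute the same reflection. The
  -- two sides of a braid relation contribute the same reflections in opposite order.
  η-≈ : ∀ {a b} → a ≈ b → ∀ x → η a x ≡ η b x
  η-≈ refl≈ x = refl
  η-≈ (sym≈ e) x = sym (η-≈ e x)
  η-≈ (trans≈ e e′) x = trans (η-≈ e x) (η-≈ e′ x)
  η-≈ (cancel u s v) x = trans (η-++ u (s ∷ s ∷ v) x) (trans (cong (η u x xor_) step) (sym (η-++ u v x)))
    where
      y = reverse u ++ x ++ u
      step : η (s ∷ s ∷ v) y ≡ η v y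
      step = trans (cong (same [ s ] y xor_) (cong₂ _xor_
          (same-iff {[ s ]} {conj s y} {[ s ]} {y}
            (λ p → conj-cancel s (trans≈ (conj-self s) p)) (λ p → trans≈ (sym≈ (conj-self s)) (conj-cong s p)))
          (η-congʳ v (conj-conj s y))))
        (xor-cancel (same [ s ] y) (η v y))
  η-≈ (braid u s t k v eq) x = trans (η-++ u (alt s t k ++ v) x)
    (trans (cong (η u x xor_) step) (sym (η-++ u (alt t s k ++ v) x)))
    where
      y = reverse u ++ x ++ u
      e : alt s t k ≈ alt t s k
      e = ++-cancelʳ-≈ v (braid [] s t k v eq)
      step : η (alt s t k ++ v) y ≡ η (alt t s k ++ v) y
      step = trans (η-++ (alt s t k) v y) (trans
        (cong₂ _xor_ (η-braid s t k y e) (η-congʳ v (conjugate-cong y e)))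
        (sym (η-++ (alt t s k) v y)))

  reflection : List S → S → List S
  reflection p s = p ++ s ∷ reverse p

  reflection-∷ : ∀ r p s → reflection (r ∷ p) s ≡ conj r (reflection p s)
  reflection-∷ r p s = cong (r ∷_) (trans (cong (λ y → p ++ s ∷ y) (Listₚ.unfold-reverse r p))
    (sym (Listₚ.++-assoc p (s ∷ reverse p) [ r ])))

  -- Conjugation by r adds one letter at each end. Both ends contribute the test whether r is the
  -- inner reflection, so the parity does not change.
  η-reflection : ∀ p s → η (reflection p s) (reflection p s) ≡ true
  η-reflection [] s with [ s ] ≈? [ s ]
  ... | yes _ = refl
  ... | no ¬e = ⊥-elim (¬e refl≈)
  η-reflection (r ∷ p) s = trans (cong (λ y → η y y) (reflection-∷ r p s)) (begin
    same [ r ] (conj r x) xor η (x ++ [ r ]) (conj r (conj r x))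
      ≡⟨ cong₂ _xor_ (same-iff {[ r ]} {conj r x} {[ r ]} {x}
            (λ q → conj-cancel r (trans≈ (conj-self r) q)) (λ q → trans≈ (sym≈ (conj-self r)) (conj-cong r q)))
          (trans (η-congʳ (x ++ [ r ]) (conj-conj r x)) (η-++ x [ r ] x)) ⟩
    same [ r ] x xor (η x x xor (same [ r ] (reverse x ++ x ++ x) xor false))
      ≡⟨ cong₂ (λ b c → same [ r ] x xor (b xor c)) (η-reflection p s)
          (trans (Boolₚ.xor-identityʳ _) (same-iff {[ r ]} {reverse x ++ x ++ x} {[ r ]} {x}
            (λ q → trans≈ q fixed) (λ q → trans≈ q (sym≈ fixed)))) ⟩
    same [ r ] x xor not (same [ r ] x)
      ≡⟨ excluded (same [ r ] x) ⟩
    true ∎)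
    where
      open ≡-Reasoning
      x = reflection p s
      fixed : reverse x ++ x ++ x ≈ x
      fixed = trans≈ (≡⇒≈ (sym (Listₚ.++-assoc (reverse x) x x))) (++-congʳ x (inverseˡ x))
      excluded : ∀ b → b xor not b ≡ true
      excluded true  = refl
      excluded false = refl

  Del : List S → List S → Set
  Del c d = ∃ λ c₁ → ∃ λ s → ∃ λ c₂ → c ≡ c₁ ++ s ∷ c₂ × d ≈ c₁ ++ c₂

  -- An odd count means that x occurs among the reflections along a; multiplication by the i-th of
  -- these removes the i-th letter.
  η⇒Del : ∀ a x → η a x ≡ true → Del a (x ++ a)
  η⇒Del (s ∷ a) x eq with [ s ] ≈? x
  ... | yes e = [] , s , a , refl , trans≈ (++-congʳ (s ∷ a) (sym≈ e)) (cons-cons s a)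
  ... | no _ with η⇒Del a (conj s x) eq
  ...   | c₁ , r , c₂ , refl , e = s ∷ c₁ , r , c₂ , refl ,
          trans≈ (sym≈ (cons-cons s _)) (∷-cong s (trans≈ (≡⇒≈ (cong (s ∷_) (sym (Listₚ.++-assoc x [ s ] _)))) e))

  Del-ℓ : ∀ {c d} → Del c d → ℓ d < length c
  Del-ℓ {c} {d} (c₁ , s , c₂ , refl , e) = ℕₚ.≤-trans
    (s≤s (ℕₚ.≤-trans (ℕₚ.≤-reflexive (ℓ-≈ e)) (ℓ≤length (c₁ ++ c₂))))
    (ℕₚ.≤-reflexive (sym (Listₚ.length-++-sucʳ c₁ s c₂)))

  module _ (p : List S) (x : S) where

    private
      t = reflection p x

    reflection-self-inverse : ∀ a → t ++ (t ++ a) ≈ a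
    reflection-self-inverse a = trans≈ (≡⇒≈ (sym (Listₚ.++-assoc t t a))) (++-congʳ a square)
      where
        reverse-t : reverse t ≡ t
        reverse-t = trans (Listₚ.reverse-++ p (x ∷ reverse p)) (trans
          (cong (_++ reverse p) (trans (Listₚ.unfold-reverse x (reverse p)) (cong (_++ [ x ]) (Listₚ.reverse-involutive p))))
          (Listₚ.++-assoc p [ x ] (reverse p)))
        square : t ++ t ≈ []
        square = trans≈ (≡⇒≈ (cong (t ++_) (sym reverse-t))) (inverseʳ t)

    -- This turns `η-true⇒<` into an equivalence: where the parity is even at a, it is odd at t a.
    η-reflect : ∀ a → η (t ++ a) t ≡ not (η a t)
    η-reflect a = trans (η-++ t a t) (cong₂ _xor_ (η-reflection p x)
      (η-congʳ a (trans≈ (≡⇒≈ (sym (Listₚ.++-assoc (reverse t) t t))) (++-congʳ t (inverseˡ t)))))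

    η-true⇒< : ∀ a → η a t ≡ true → ℓ (t ++ a) < ℓ a
    η-true⇒< a eq = subst (_< ℓ a) (ℓ-≈ (++-congˡ t (normal-≈ a)))
      (Del-ℓ (η⇒Del (normal a) t (trans (η-≈ (normal-≈ a) t) eq)))

    η-false⇒< : ∀ a → η a t ≡ false → ℓ a < ℓ (t ++ a)
    η-false⇒< a eq = subst (_< ℓ (t ++ a)) (ℓ-≈ (reflection-self-inverse a))
      (η-true⇒< (t ++ a) (trans (η-reflect a) (cong not eq)))

    reflection-insert : ∀ u → t ++ (p ++ u) ≈ p ++ x ∷ u
    reflection-insert u = begin
      t ++ (p ++ u)                    ≡⟨ Listₚ.++-assoc p (x ∷ reverse p) (p ++ u) ⟩
      p ++ (x ∷ (reverse p ++ (p ++ u))) ≡⟨ cong (λ y → p ++ x ∷ y) (sym (Listₚ.++-assoc (reverse p) p u)) ⟩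
      p ++ (x ∷ ((reverse p ++ p) ++ u)) ≈⟨ ++-congˡ p (∷-cong x (++-congʳ u (inverseˡ p))) ⟩
      p ++ (x ∷ u) ∎
      where open ≈-Reasoning

    -- The reflection t carries c to p u. An even parity would make p u longer than c, against the
    -- hypothesis; an odd one yields the letter to delete. The word c may be non-reduced, which
    -- matters for subwords of arbitrary expressions.
    strong-exchange : ∀ u c → c ≈ p ++ x ∷ u → ℓ (p ++ u) < ℓ (p ++ x ∷ u) → Del c (p ++ u)
    strong-exchange u c e lt with η c t in eq
    ... | true with η⇒Del c t eq
    ...   | c₁ , s , c₂ , c≡ , e′ = c₁ , s , c₂ , c≡ , trans≈ (sym≈ tc) e′
      where
        tc : t ++ c ≈ p ++ u
        tc = trans≈ (++-congˡ t (trans≈ e (sym≈ (reflection-insert u)))) (reflection-self-inverse (p ++ u))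
    strong-exchange u c e lt | false = ⊥-elim (ℕₚ.<-asym lt (subst (_< ℓ (p ++ u)) (ℓ-≈ e)
      (subst (ℓ c <_) (ℓ-≈ tc) (η-false⇒< c eq))))
      where
        tc : t ++ c ≈ p ++ u
        tc = trans≈ (++-congˡ t (trans≈ e (sym≈ (reflection-insert u)))) (reflection-self-inverse (p ++ u))

    -- By the cocycle rule, the parity of p u at t is the sum of the parities of p at t and of u at
    -- x. Both are even because x lengthens p on the right and u on the left.
    insert-< : ℓ p < ℓ (p ++ [ x ]) → ∀ u → ℓ u < ℓ (x ∷ u) → ℓ (p ++ u) < ℓ (p ++ x ∷ u)
    insert-< p< u u< with η (p ++ u) t in eq
    ... | false = subst (ℓ (p ++ u) <_) (ℓ-≈ (reflection-insert u)) (η-false⇒< (p ++ u) eq)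
    ... | true with η p t in eq-p
    ...   | true  = ⊥-elim (ℕₚ.<-asym p< (subst (_< ℓ p) (ℓ-≈ tp) (η-true⇒< p eq-p)))
      where
        tp : t ++ p ≈ p ++ [ x ]
        tp = trans≈ (≡⇒≈ (cong (t ++_) (sym (Listₚ.++-identityʳ p)))) (reflection-insert [])
    ...   | false with η⇒Del (normal u) [ x ] (trans (η-≈ (normal-≈ u) [ x ]) (trans (η-congʳ u (sym≈ conjugate)) eq-u))
      where
        conjugate : reverse p ++ t ++ p ≈ [ x ]
        conjugate = begin
          reverse p ++ (t ++ p)                       ≡⟨ cong (λ y → reverse p ++ (t ++ y)) (sym (Listₚ.++-identityʳ p)) ⟩
          reverse p ++ (t ++ (p ++ []))               ≈⟨ ++-congˡ (reverse p) (reflection-insert []) ⟩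
          reverse p ++ (p ++ [ x ])                   ≡⟨ sym (Listₚ.++-assoc (reverse p) p [ x ]) ⟩
          (reverse p ++ p) ++ [ x ]                   ≈⟨ ++-congʳ [ x ] (inverseˡ p) ⟩
          [ x ] ∎
          where open ≈-Reasoning
        eq-u : η u (reverse p ++ t ++ p) ≡ true
        eq-u = trans (sym (cong (_xor η u (reverse p ++ t ++ p)) eq-p)) (trans (sym (η-++ p u t)) eq)
    ...     | del = ⊥-elim (ℕₚ.<-asym u< (subst (_< ℓ u) (ℓ-≈ (∷-cong x (normal-≈ u))) (Del-ℓ del)))

  exchange : ∀ {a s} → Down a s → Del a (a ++ [ s ])
  exchange {a} {s} down with strong-exchange (a ++ [ s ]) s [] a (sym≈ (snoc-snoc a s)) shorter
    where
      shorter : ℓ ((a ++ [ s ]) ++ []) < ℓ ((a ++ [ s ]) ++ [ s ])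
      shorter = ℕₚ.≤-reflexive (trans (cong suc (cong ℓ (Listₚ.++-identityʳ (a ++ [ s ])))) (trans (sym down) (ℓ-≈ (sym≈ (snoc-snoc a s)))))
  ... | c₁ , r , c₂ , a≡ , e = c₁ , r , c₂ , a≡ , trans≈ (≡⇒≈ (sym (Listₚ.++-identityʳ (a ++ [ s ])))) e

  exchangeˡ : ∀ {a s} → ℓ (s ∷ a) < ℓ a → Del a (s ∷ a)
  exchangeˡ {a} {s} lt = strong-exchange [] s (s ∷ a) a (sym≈ (cons-cons s a)) (subst (ℓ (s ∷ a) <_) (ℓ-≈ (sym≈ (cons-cons s a))) lt)

  -- Bruhat order

  Upˡ Downˡ : S → List S → Set
  Upˡ   s u = ℓ (s ∷ u) ≡ suc (ℓ u)
  Downˡ s u = ℓ u ≡ suc (ℓ (s ∷ u))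

  ℓ-reverse-snoc : ∀ u s → ℓ (reverse u ++ [ s ]) ≡ ℓ (s ∷ u)
  ℓ-reverse-snoc u s = trans (cong ℓ (sym (Listₚ.unfold-reverse s u))) (ℓ-reverse (s ∷ u))

  upˡ-or-downˡ : ∀ s u → Upˡ s u ⊎ Downˡ s u
  upˡ-or-downˡ s u with up-or-down (reverse u) s
  ... | inj₁ up   = inj₁ (trans (sym (ℓ-reverse-snoc u s)) (trans up (cong suc (ℓ-reverse u))))
  ... | inj₂ down = inj₂ (trans (sym (ℓ-reverse u)) (trans down (cong suc (ℓ-reverse-snoc u s))))

  Upˡ⇒Up : ∀ {s u} → Upˡ s u → Up (reverse u) s
  Upˡ⇒Up {s} {u} up = trans (ℓ-reverse-snoc u s) (trans up (cong suc (sym (ℓ-reverse u))))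

  Downˡ⇒Down : ∀ {s u} → Downˡ s u → Down (reverse u) s
  Downˡ⇒Down {s} {u} down = trans (ℓ-reverse u) (trans down (cong suc (sym (ℓ-reverse-snoc u s))))

  Up-≈ : ∀ {u v s} → u ≈ v → Up u s → Up v s
  Up-≈ {s = s} e up = trans (ℓ-≈ (++-congʳ [ s ] (sym≈ e))) (trans up (cong suc (ℓ-≈ e)))

  Down-≈ : ∀ {u v s} → u ≈ v → Down u s → Down v s
  Down-≈ {s = s} e down = trans (ℓ-≈ (sym≈ e)) (trans down (cong suc (ℓ-≈ (++-congʳ [ s ] e))))

  ℓ-++ : ∀ u v → ℓ (u ++ v) ≤ ℓ u ℕ.+ ℓ v
  ℓ-++ u v = ℕₚ.≤-trans (ℕₚ.≤-reflexive (ℓ-≈ (++-cong (sym≈ (normal-≈ u)) (sym≈ (normal-≈ v)))))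
    (ℕₚ.≤-trans (ℓ≤length (normal u ++ normal v)) (ℕₚ.≤-reflexive (Listₚ.length-++ (normal u))))

  Reduced-++ˡ : ∀ p q → Reduced (p ++ q) → Reduced p
  Reduced-++ˡ p q red = Reduced-ℓ (ℕₚ.+-cancelʳ-≤ (length q) (length p) (ℓ p)
    (ℕₚ.≤-trans (ℕₚ.≤-reflexive (trans (sym (Listₚ.length-++ p)) (sym (ℓ-Reduced red))))
      (ℕₚ.≤-trans (ℓ-++ p q) (ℕₚ.+-monoʳ-≤ (ℓ p) (ℓ≤length q)))))

  Reduced-++ʳ : ∀ p q → Reduced (p ++ q) → Reduced q
  Reduced-++ʳ p q red = Reduced-ℓ (ℕₚ.+-cancelˡ-≤ (length p) (length q) (ℓ q)
    (ℕₚ.≤-trans (ℕₚ.≤-reflexive (trans (sym (Listₚ.length-++ p)) (sym (ℓ-Reduced red))))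
      (ℕₚ.≤-trans (ℓ-++ p q) (ℕₚ.+-monoˡ-≤ (ℓ q) (ℓ≤length p)))))

  Reduced-snoc : ∀ {a s} → Reduced a → Up a s → Reduced (a ++ [ s ])
  Reduced-snoc {a} {s} red up = Reduced-ℓ (ℕₚ.≤-reflexive
    (trans (length-snoc a s) (trans (cong suc (sym (ℓ-Reduced red))) (sym up))))

  snoc-Reduced : ∀ {a s} → Reduced (a ++ [ s ]) → Up a s
  snoc-Reduced {a} {s} red = trans (ℓ-Reduced red) (trans (length-snoc a s) (cong suc (sym (ℓ-Reduced (Reduced-++ˡ a [ s ] red)))))

  Reduced-reverse : ∀ {a} → Reduced a → Reduced (reverse a)
  Reduced-reverse {a} red = Reduced-ℓ (ℕₚ.≤-reflexive
    (trans (Listₚ.length-reverse a) (trans (sym (ℓ-Reduced red)) (sym (ℓ-reverse a)))))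

  Reduced-sub-length : ∀ {a b} → Reduced a → a ≈ b → length a ≡ ℓ b
  Reduced-sub-length red e = trans (sym (ℓ-Reduced red)) (ℓ-≈ e)

  del-⊆ : ∀ (c₁ : List S) s c₂ → c₁ ++ c₂ ⊆ c₁ ++ s ∷ c₂
  del-⊆ c₁ s c₂ = Subₚ.++⁺ (⊆-refl {x = c₁}) (s ∷ʳ ⊆-refl)

  exchange-Downˡ : ∀ {s a} → Reduced a → Downˡ s a → ∃ λ a′ → a′ ⊆ a × s ∷ a ≈ a′ × Reduced a′ × length a ≡ suc (length a′)
  exchange-Downˡ {s} {a} red down with exchangeˡ (ℕₚ.≤-reflexive (sym down))
  ... | c₁ , r , c₂ , refl , e = c₁ ++ c₂ , del-⊆ c₁ r c₂ , e ,
    Reduced-ℓ (ℕₚ.≤-reflexive (ℕₚ.suc-injective (begin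
      suc (length (c₁ ++ c₂))     ≡⟨ sym (Listₚ.length-++-sucʳ c₁ r c₂) ⟩
      length (c₁ ++ r ∷ c₂)       ≡⟨ sym (ℓ-Reduced red) ⟩
      ℓ (c₁ ++ r ∷ c₂)            ≡⟨ down ⟩
      suc (ℓ (s ∷ c₁ ++ r ∷ c₂))  ≡⟨ cong suc (ℓ-≈ e) ⟩
      suc (ℓ (c₁ ++ c₂)) ∎))) , Listₚ.length-++-sucʳ c₁ r c₂
    where open ≡-Reasoning

  -- Built from the right: a letter that lengthens is kept, and one that shortens is absorbed by
  -- deleting a letter through the exchange condition.
  reduced-sublist : ∀ a → ∃ λ a′ → a′ ⊆ a × a′ ≈ a × Reduced a′
  reduced-sublist [] = [] , [] , refl≈ , λ _ _ → z≤n
  reduced-sublist (s ∷ a) with reduced-sublist a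
  ... | a′ , sub , e , red with upˡ-or-downˡ s a′
  ...   | inj₁ up = s ∷ a′ , refl ∷ sub , ∷-cong s e ,
          Reduced-ℓ (ℕₚ.≤-reflexive (trans (cong suc (sym (ℓ-Reduced red))) (sym up)))
  ...   | inj₂ down with exchange-Downˡ red down
  ...     | a″ , sub′ , e′ , red′ , _ = a″ , s ∷ʳ ⊆-trans sub′ sub , trans≈ (sym≈ e′) (∷-cong s e) , red′

  ≤-resp-≈ : ∀ {u u′ v v′} → u ≈ u′ → v ≈ v′ → u ≤B v → u′ ≤B v′
  ≤-resp-≈ eu ev (a , b , ea , eb , ra , rb , sub) = a , b , trans≈ ea eu , trans≈ eb ev , ra , rb , sub

  ⊆⇒≤ : ∀ {a b} → Reduced b → a ⊆ b → a ≤B b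
  ⊆⇒≤ {a} {b} red sub with reduced-sublist a
  ... | a′ , sub′ , e , red′ = a′ , b , e , refl≈ , red′ , red , ⊆-trans sub′ sub

  -- At the first letter x of b that the greedy subword for u skips, inserting x lengthens u.
  insertion : ∀ p b u → Reduced (p ++ b) → u ⊆ b → Reduced u → length u < length b →
              ∃ λ g → ∃ λ x → ∃ λ h → p ++ u ≈ g ++ h × ℓ (g ++ h) < ℓ (g ++ x ∷ h) × ∃ λ d → d ⊆ p ++ b × d ≈ g ++ x ∷ h
  insertion p (x ∷ b) u red sub red-u lt with upˡ-or-downˡ x u
  insertion p (x ∷ b) u red (.x ∷ʳ sub) red-u lt | inj₁ up =
    p , x , u , refl≈ , insert-< p x p< u (ℕₚ.≤-reflexive (sym up)) , p ++ x ∷ u , Subₚ.++⁺ (⊆-refl {x = p}) (refl ∷ sub) , refl≈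
    where
      p< : ℓ p < ℓ (p ++ [ x ])
      p< = ℕₚ.≤-reflexive (sym (snoc-Reduced (Reduced-++ˡ (p ++ [ x ]) b (subst Reduced (sym (Listₚ.++-assoc p [ x ] b)) red))))
  insertion p (x ∷ b) (.x ∷ u) red (refl ∷ sub) red-u lt | inj₁ up =
    ⊥-elim (ℕₚ.<-irrefl (trans (ℓ-≈ (sym≈ (cons-cons x u))) up)
      (s≤s (ℕₚ.≤-trans (ℓ≤length u) (ℕₚ.≤-trans (ℕₚ.n≤1+n _) (ℕₚ.≤-reflexive (sym (ℓ-Reduced red-u)))))))
  insertion p (x ∷ b) u red sub red-u lt | inj₂ down with split sub
    where
      split : u ⊆ x ∷ b → ∃ λ u′ → u′ ⊆ b × Reduced u′ × length u ≡ suc (length u′) × u ≈ x ∷ u′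
      split (.x ∷ʳ sub) with exchange-Downˡ red-u down
      ... | u′ , sub′ , e , red′ , len = u′ , ⊆-trans sub′ sub , red′ , len , trans≈ (sym≈ (cons-cons x u)) (∷-cong x e)
      split (refl ∷ sub) = _ , sub , Reduced-++ʳ [ x ] _ red-u , refl , refl≈
  ... | u′ , sub′ , red′ , len , e
    with insertion (p ++ [ x ]) b u′ (subst Reduced (sym (Listₚ.++-assoc p [ x ] b)) red) sub′ red′ (ℕₚ.≤-pred (subst (_< suc (length b)) len lt))
  ...   | g , y , h , eg , lt′ , d , sub-d , ed = g , y , h ,
          trans≈ (trans≈ (++-congˡ p e) (≡⇒≈ (sym (Listₚ.++-assoc p [ x ] u′)))) eg , lt′ ,
          d , subst (d ⊆_) (Listₚ.++-assoc p [ x ] b) sub-d , ed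

  -- The subword property, by induction on the length difference, bounded by `n`. `insertion` gives
  -- a longer element g x h below b; by induction it is a subword of c, and strong exchange deletes
  -- one letter of this subword to reach g h = a.
  subword-of-reduced : ∀ n {a b c} → length b ≤ n ℕ.+ length a → a ⊆ b → Reduced a → Reduced b → c ≈ b →
                       ∃ λ a′ → a′ ⊆ c × a′ ≈ a
  subword-of-reduced n {a} {b} {c} bound sub red-a red-b e with ℕₚ.m≤n⇒m<n∨m≡n (Subₚ.length-mono-≤ sub)
  ... | inj₂ eq = c , ⊆-refl , trans≈ e (≡⇒≈ (sym (≋⇒≡ (Subₚ.to-≋ eq sub))))
  subword-of-reduced zero bound sub red-a red-b e | inj₁ lt = ⊥-elim (ℕₚ.<⇒≱ lt bound)
  subword-of-reduced (suc n) {a} {b} {c} bound sub red-a red-b e | inj₁ lt with insertion [] b a red-b sub red-a lt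
  ... | g , x , h , eg , lt′ , d , sub-d , ed with reduced-sublist d
  ...   | d′ , sub-d′ , ed′ , red-d with subword-of-reduced n (ℕₚ.≤-trans bound longer) (⊆-trans sub-d′ sub-d) red-d red-b e
    where
      longer : suc n ℕ.+ length a ≤ n ℕ.+ length d′
      longer = ℕₚ.≤-trans (ℕₚ.≤-reflexive (sym (ℕₚ.+-suc n (length a)))) (ℕₚ.+-monoʳ-≤ n
        (ℕₚ.≤-trans (s≤s (ℕₚ.≤-reflexive (Reduced-sub-length red-a eg)))
          (ℕₚ.≤-trans lt′ (ℕₚ.≤-reflexive (sym (Reduced-sub-length red-d (trans≈ ed′ ed)))))))
  ...     | a′ , sub-a′ , ea′ with strong-exchange g x h a′ (trans≈ ea′ (trans≈ ed′ ed)) lt′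
  ...       | c₁ , r , c₂ , refl , ec = c₁ ++ c₂ , ⊆-trans (del-⊆ c₁ r c₂) sub-a′ , trans≈ (sym≈ ec) (sym≈ eg)

  subword : ∀ {u v c} → u ≤B v → c ≈ v → ∃ λ a → a ⊆ c × a ≈ u × Reduced a
  subword (a , b , ea , eb , ra , rb , sub) e
    with subword-of-reduced (length b) (ℕₚ.m≤m+n (length b) (length a)) sub ra rb (trans≈ e (sym≈ eb))
  ... | a′ , sub′ , e′ with reduced-sublist a′
  ...   | a″ , sub″ , e″ , red = a″ , ⊆-trans sub″ sub′ , trans≈ e″ (trans≈ e′ ea) , red

  ≤-reflexive : ∀ {u v} → u ≈ v → u ≤B v
  ≤-reflexive {u} {v} e = normal u , normal u , normal-≈ u , trans≈ (normal-≈ u) e , normal-Reduced u , normal-Reduced u , ⊆-refl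

  ≤-trans : ∀ {u v w} → u ≤B v → v ≤B w → u ≤B w
  ≤-trans u≤v (a , b , ea , eb , ra , rb , sub) with subword u≤v ea
  ... | a′ , sub′ , e′ , ra′ = a′ , b , e′ , eb , ra′ , rb , ⊆-trans sub′ sub

  ≤⇒ℓ≤ : ∀ {u v} → u ≤B v → ℓ u ≤ ℓ v
  ≤⇒ℓ≤ (a , b , ea , eb , ra , rb , sub) = ℕₚ.≤-trans (ℕₚ.≤-reflexive (sym (Reduced-sub-length ra ea)))
    (ℕₚ.≤-trans (Subₚ.length-mono-≤ sub) (ℕₚ.≤-reflexive (Reduced-sub-length rb eb)))

  ≤-ℓ-antisym : ∀ {u v} → u ≤B v → ℓ v ≤ ℓ u → u ≈ v
  ≤-ℓ-antisym {u} {v} u≤v@(a , b , ea , eb , ra , rb , sub) le = trans≈ (sym≈ ea) (trans≈ (≡⇒≈ (≋⇒≡ (Subₚ.to-≋ len sub))) eb)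
    where
      len : length a ≡ length b
      len = trans (Reduced-sub-length ra ea) (trans (ℕₚ.≤-antisym (≤⇒ℓ≤ u≤v) le) (sym (Reduced-sub-length rb eb)))

  <⇒ℓ< : ∀ {u v} → u <B v → ℓ u < ℓ v
  <⇒ℓ< (u≤v , u≉v) = ℕₚ.≰⇒> λ le → u≉v (≤-ℓ-antisym u≤v le)

  ⊆-snoc : ∀ {a : List S} b {s} → a ⊆ b ++ [ s ] → a ⊆ b ⊎ ∃ λ a′ → a ≡ a′ ++ [ s ] × a′ ⊆ b
  ⊆-snoc [] (_ ∷ʳ sub) = inj₁ sub
  ⊆-snoc [] (refl ∷ []) = inj₂ ([] , refl , [])
  ⊆-snoc (x ∷ b) (.x ∷ʳ sub) with ⊆-snoc b sub
  ... | inj₁ sub′ = inj₁ (x ∷ʳ sub′)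
  ... | inj₂ (a′ , eq , sub′) = inj₂ (a′ , eq , x ∷ʳ sub′)
  ⊆-snoc (x ∷ b) (refl ∷ sub) with ⊆-snoc b sub
  ... | inj₁ sub′ = inj₁ (refl ∷ sub′)
  ... | inj₂ (a′ , refl , sub′) = inj₂ (x ∷ a′ , refl , refl ∷ sub′)

  module _ {u v : List S} {s : S} (u≤v : u ≤B v) where

    Up-mono : Up v s → u ++ [ s ] ≤B v ++ [ s ]
    Up-mono up with subword u≤v (normal-≈ v)
    ... | a , sub , e , _ = ≤-resp-≈ (++-congʳ [ s ] e) (++-congʳ [ s ] (normal-≈ v))
          (⊆⇒≤ (Reduced-snoc (normal-Reduced v) (Up-≈ (sym≈ (normal-≈ v)) up)) (Subₚ.++⁺ sub ⊆-refl))

    private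
      v′ = normal (v ++ [ s ])

      -- This expression of `v` is reduced only if s is a descent of `v`. As `subword` accepts any
      -- expression, the next lemmas need no case distinction on `v`.
      v′s≈v : v′ ++ [ s ] ≈ v
      v′s≈v = trans≈ (++-congʳ [ s ] (normal-≈ (v ++ [ s ]))) (snoc-snoc v s)

      below : ∀ {a b} → a ≈ b → a ⊆ v′ → b ≤B v ++ [ s ]
      below e sub = ≤-resp-≈ e (normal-≈ (v ++ [ s ])) (⊆⇒≤ (normal-Reduced (v ++ [ s ])) sub)

    lifting : Up u s → u ≤B v ++ [ s ]
    lifting up with subword u≤v v′s≈v
    ... | a , sub , e , red with ⊆-snoc v′ sub
    ...   | inj₁ sub′ = below e sub′
    ...   | inj₂ (a′ , refl , _) = ⊥-elim (up-down up (trans (sym (Reduced-sub-length red e))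
              (trans (length-snoc a′ s) (cong suc (trans (sym (ℓ-Reduced (Reduced-++ˡ a′ [ s ] red))) (ℓ-≈ (sym≈ (snoc-flip s (sym≈ e)))))))))

    Down-mono : Down u s → u ++ [ s ] ≤B v ++ [ s ]
    Down-mono down with subword u≤v v′s≈v
    ... | a , sub , e , red with ⊆-snoc v′ sub
    ...   | inj₂ (a′ , refl , sub′) = below (sym≈ (snoc-flip s (sym≈ e))) sub′
    ...   | inj₁ sub′ = ≤-trans us≤u (below e sub′)
      where
        us≤u : u ++ [ s ] ≤B u
        us≤u = ≤-resp-≈ (normal-≈ _) (trans≈ (++-congʳ [ s ] (normal-≈ (u ++ [ s ]))) (snoc-snoc u s))
          (⊆⇒≤ (Reduced-snoc (normal-Reduced _) (trans (ℓ-≈ (trans≈ (++-congʳ [ s ] (normal-≈ (u ++ [ s ]))) (snoc-snoc u s)))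
             (trans down (cong suc (ℓ-≈ (sym≈ (normal-≈ (u ++ [ s ])))))))) (Subₚ.++⁺ʳ [ s ] ⊆-refl))

  Up⇒≤ : ∀ {u s} → Up u s → u ≤B u ++ [ s ]
  Up⇒≤ {u} {s} up = ≤-resp-≈ (normal-≈ u) (++-congʳ [ s ] (normal-≈ u))
    (⊆⇒≤ (Reduced-snoc (normal-Reduced u) (Up-≈ (sym≈ (normal-≈ u)) up)) (Subₚ.++⁺ʳ [ s ] ⊆-refl))

  Down⇒Up : ∀ {u s} → Down u s → Up (u ++ [ s ]) s
  Down⇒Up {u} {s} down = trans (ℓ-≈ (snoc-snoc u s)) down

  Up⇒Down : ∀ {u s} → Up u s → Down (u ++ [ s ]) s
  Up⇒Down {u} {s} up = trans up (cong suc (ℓ-≈ (sym≈ (snoc-snoc u s))))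

  Down⇒≤ : ∀ {u s} → Down u s → u ++ [ s ] ≤B u
  Down⇒≤ {u} {s} down = ≤-resp-≈ refl≈ (snoc-snoc u s) (Up⇒≤ (Down⇒Up down))

  Down-snoc-≤ : ∀ {u v s} → u ≤B v → Down v s → u ++ [ s ] ≤B v
  Down-snoc-≤ {u} {v} {s} u≤v down with up-or-down u s
  ... | inj₂ down-u = ≤-trans (Down⇒≤ down-u) u≤v
  ... | inj₁ up-u   = ≤-resp-≈ refl≈ (snoc-snoc v s) (Up-mono (lifting u≤v up-u) (Down⇒Up down))

  ≤-reverse : ∀ {u v} → u ≤B v → reverse u ≤B reverse v
  ≤-reverse (a , b , ea , eb , ra , rb , sub) = reverse a , reverse b , reverse-cong ea , reverse-cong eb ,
    Reduced-reverse ra , Reduced-reverse rb , Subₚ.reverse⁺ sub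

  ≤-unreverse : ∀ {u v u′ v′} → reverse u ≡ u′ → reverse v ≡ v′ → u′ ≤B v′ → u ≤B v
  ≤-unreverse {u} {v} refl refl le = ≤-resp-≈ (≡⇒≈ (Listₚ.reverse-involutive u)) (≡⇒≈ (Listₚ.reverse-involutive v)) (≤-reverse le)

  module _ {u v : List S} {s : S} (u≤v : u ≤B v) where

    Upˡ-mono : Upˡ s v → s ∷ u ≤B s ∷ v
    Upˡ-mono up = ≤-unreverse (Listₚ.unfold-reverse s u) (Listₚ.unfold-reverse s v) (Up-mono (≤-reverse u≤v) (Upˡ⇒Up up))

    Downˡ-mono : Downˡ s u → s ∷ u ≤B s ∷ v
    Downˡ-mono down = ≤-unreverse (Listₚ.unfold-reverse s u) (Listₚ.unfold-reverse s v) (Down-mono (≤-reverse u≤v) (Downˡ⇒Down down))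

    liftingˡ : Upˡ s u → u ≤B s ∷ v
    liftingˡ up = ≤-unreverse refl (Listₚ.unfold-reverse s v) (lifting (≤-reverse u≤v) (Upˡ⇒Up up))

  -- Decidability of the Bruhat order

  subword? : ∀ c u → Dec (∃ λ a → a ⊆ c × a ≈ u)
  subword? [] u = map′ (λ e → [] , [] , e) (λ { (_ , [] , e) → e }) ([] ≈? u)
  subword? (s ∷ c) u = map′ to from (subword? c u ⊎-dec subword? c (s ∷ u))
    where
      Sub : List S → List S → Set
      Sub c u = ∃ λ a → a ⊆ c × a ≈ u
      to : Sub c u ⊎ Sub c (s ∷ u) → Sub (s ∷ c) u
      to (inj₁ (a , sub , e)) = a , s ∷ʳ sub , e
      to (inj₂ (a , sub , e)) = s ∷ a , refl ∷ sub , cons-flip s e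
      from : Sub (s ∷ c) u → Sub c u ⊎ Sub c (s ∷ u)
      from (a , .s ∷ʳ sub , e) = inj₁ (a , sub , e)
      from (.s ∷ a , refl ∷ sub , e) = inj₂ (a , sub , sym≈ (cons-flip s (sym≈ e)))

  infix 4 _≤?_
  _≤?_ : ∀ u v → Dec (u ≤B v)
  u ≤? v = map′
    (λ { (a , sub , e) → ≤-resp-≈ e (normal-≈ v) (⊆⇒≤ (normal-Reduced v) sub) })
    (λ u≤v → let (a , sub , e , _) = subword u≤v (normal-≈ v) in a , sub , e)
    (subword? (normal v) u)

  -- Shifted descents along a suffix

  -- Equivalently, each letter of `d` is an ascent of the product before it, which is what a
  -- constant mask demands of a suffix of ones.
  Additive : List S → List S → Set
  Additive u d = ℓ (u ++ d) ≡ ℓ u ℕ.+ length d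

  Additive-≥ : ∀ u d → ℓ u ℕ.+ length d ≤ ℓ (u ++ d) → Additive u d
  Additive-≥ u d le = ℕₚ.≤-antisym (ℕₚ.≤-trans (ℓ-++ u d) (ℕₚ.+-monoʳ-≤ (ℓ u) (ℓ≤length d))) le

  Additive-[] : ∀ u → Additive u []
  Additive-[] u = trans (cong ℓ (Listₚ.++-identityʳ u)) (sym (ℕₚ.+-identityʳ (ℓ u)))

  Additive-≈ : ∀ {u v} d → u ≈ v → Additive u d → Additive v d
  Additive-≈ d e add = trans (ℓ-≈ (++-congʳ d (sym≈ e))) (trans add (cong (ℕ._+ length d) (ℓ-≈ e)))

  Additive-++ˡ : ∀ u d₁ d₂ → Additive u (d₁ ++ d₂) → Additive u d₁
  Additive-++ˡ u d₁ d₂ add = Additive-≥ u d₁ (ℕₚ.+-cancelʳ-≤ (length d₂) _ _ (begin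
    ℓ u ℕ.+ length d₁ ℕ.+ length d₂    ≡⟨ ℕₚ.+-assoc (ℓ u) _ _ ⟩
    ℓ u ℕ.+ (length d₁ ℕ.+ length d₂)  ≡⟨ cong (ℓ u ℕ.+_) (sym (Listₚ.length-++ d₁)) ⟩
    ℓ u ℕ.+ length (d₁ ++ d₂)          ≡⟨ sym add ⟩
    ℓ (u ++ (d₁ ++ d₂))                ≡⟨ cong ℓ (sym (Listₚ.++-assoc u d₁ d₂)) ⟩
    ℓ ((u ++ d₁) ++ d₂)                ≤⟨ ℓ-++ (u ++ d₁) d₂ ⟩
    ℓ (u ++ d₁) ℕ.+ ℓ d₂               ≤⟨ ℕₚ.+-monoʳ-≤ (ℓ (u ++ d₁)) (ℓ≤length d₂) ⟩
    ℓ (u ++ d₁) ℕ.+ length d₂ ∎))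
    where open ℕₚ.≤-Reasoning

  Additive-Up : ∀ u d s → Additive u d → Up (u ++ d) s → Additive u (d ++ [ s ])
  Additive-Up u d s add up = begin
    ℓ (u ++ (d ++ [ s ]))        ≡⟨ cong ℓ (sym (Listₚ.++-assoc u d [ s ])) ⟩
    ℓ ((u ++ d) ++ [ s ])        ≡⟨ up ⟩
    suc (ℓ (u ++ d))             ≡⟨ cong suc add ⟩
    suc (ℓ u ℕ.+ length d)       ≡⟨ sym (ℕₚ.+-suc (ℓ u) (length d)) ⟩
    ℓ u ℕ.+ suc (length d)       ≡⟨ cong (ℓ u ℕ.+_) (sym (length-snoc d s)) ⟩
    ℓ u ℕ.+ length (d ++ [ s ]) ∎
    where open ≡-Reasoning

  Additive-snoc : ∀ u d s → Additive u (d ++ [ s ]) → Up (u ++ d) s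
  Additive-snoc u d s add = begin
    ℓ ((u ++ d) ++ [ s ])        ≡⟨ cong ℓ (Listₚ.++-assoc u d [ s ]) ⟩
    ℓ (u ++ (d ++ [ s ]))        ≡⟨ add ⟩
    ℓ u ℕ.+ length (d ++ [ s ])  ≡⟨ cong (ℓ u ℕ.+_) (length-snoc d s) ⟩
    ℓ u ℕ.+ suc (length d)       ≡⟨ ℕₚ.+-suc (ℓ u) (length d) ⟩
    suc (ℓ u ℕ.+ length d)       ≡⟨ cong suc (sym (Additive-++ˡ u d [ s ] add)) ⟩
    suc (ℓ (u ++ d)) ∎
    where open ≡-Reasoning

  ℓ-∷ : ∀ h u → ℓ (h ∷ u) ≤ suc (ℓ u)
  ℓ-∷ h u = ℕₚ.≤-trans (ℓ-++ [ h ] u) (ℕₚ.+-monoˡ-≤ (ℓ u) (ℓ≤length [ h ]))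

  Additive-Upˡ : ∀ {h u} d → Upˡ h u → Additive (h ∷ u) d → Additive u d
  Additive-Upˡ {h} {u} d up add = Additive-≥ u d (ℕₚ.≤-pred (ℕₚ.≤-trans (ℕₚ.≤-reflexive
    (trans (cong (ℕ._+ length d) (sym up)) (sym add))) (ℓ-∷ h (u ++ d))))

  Additive-Upˡ-++ : ∀ {h u} d → Upˡ h u → Additive (h ∷ u) d → Upˡ h (u ++ d)
  Additive-Upˡ-++ {h} {u} d up add = trans add (trans (cong (ℕ._+ length d) up) (cong suc (sym (Additive-Upˡ d up add))))

  Additive-∷ : ∀ p s d → Additive p (s ∷ d) → Up p s × Additive (p ++ [ s ]) d
  Additive-∷ p s d add = up , trans (cong ℓ (Listₚ.++-assoc p [ s ] d)) (trans add
      (trans (ℕₚ.+-suc (ℓ p) (length d)) (cong (ℕ._+ length d) (sym up))))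
    where
      up : Up p s
      up = Up-≈ (≡⇒≈ (Listₚ.++-identityʳ p)) (Additive-snoc p [] s (Additive-++ˡ p [ s ] d add))

  ∷-Additive : ∀ p s d → Up p s → Additive (p ++ [ s ]) d → Additive p (s ∷ d)
  ∷-Additive p s d up add = trans (cong ℓ (sym (Listₚ.++-assoc p [ s ] d)))
    (trans add (trans (cong (ℕ._+ length d) up) (sym (ℕₚ.+-suc (ℓ p) (length d)))))

  Additive-mono : ∀ {u v} d → u ≤B v → Additive v d → u ++ d ≤B v ++ d
  Additive-mono {u} {v} [] le add = ≤-resp-≈ (≡⇒≈ (sym (Listₚ.++-identityʳ u))) (≡⇒≈ (sym (Listₚ.++-identityʳ v))) le
  Additive-mono {u} {v} (s ∷ d) le add = let up , add′ = Additive-∷ v s d add in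
    ≤-resp-≈ (≡⇒≈ (Listₚ.++-assoc u [ s ] d)) (≡⇒≈ (Listₚ.++-assoc v [ s ] d)) (Additive-mono d (Up-mono le up) add′)

  -- d is a suffix on which both masks consist of ones, after the prefixes θ and x; it contains a shifted descent.
  Shifted : List S → List S → List S → Set
  Shifted θ x d = ∃ λ d₁ → ∃ λ g → ∃ λ d₂ → d ≡ d₁ ++ g ∷ d₂ × (θ ++ d₁) ++ [ g ] ≤B x ++ d₁

  Upˡ-≈ : ∀ {h u v} → u ≈ v → Upˡ h u → Upˡ h v
  Upˡ-≈ {h} e up = trans (ℓ-≈ (∷-cong h (sym≈ e))) (trans up (cong suc (ℓ-≈ e)))

  Upˡ⇒≤ : ∀ {h u} → Upˡ h u → u ≤B h ∷ u
  Upˡ⇒≤ {h} {u} up = liftingˡ (≤-reflexive refl≈) up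

  Downˡ⇒Upˡ : ∀ {h u} → Downˡ h u → Upˡ h (h ∷ u)
  Downˡ⇒Upˡ {h} {u} down = trans (ℓ-≈ (cons-cons h u)) down

  upˡ-downˡ : ∀ {s u} → Upˡ s u → Downˡ s u → ⊥
  upˡ-downˡ {s} {u} p q = ℕₚ.<-irrefl (trans q (cong suc p)) (s≤s (ℕₚ.n≤1+n (ℓ u)))

  -- Lifting u ≤ u g along h gives u ≤ h u g. Both sides have the same length, so they are equal.
  crossing : ∀ {h u g} → Upˡ h u → Up u g → Downˡ h (u ++ [ g ]) → h ∷ u ≈ u ++ [ g ]
  crossing {h} {u} {g} upˡ up down = trans≈ (∷-cong h (≤-ℓ-antisym (liftingˡ (Up⇒≤ up) upˡ)
      (ℕₚ.≤-reflexive (ℕₚ.suc-injective (trans (sym down) up)))))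
    (cons-cons h (u ++ [ g ]))

  first-crossing : ∀ h θ d → Upˡ h θ → Additive θ d → Downˡ h (θ ++ d) →
                   ∃ λ d₁ → ∃ λ g → ∃ λ d₂ → d ≡ d₁ ++ g ∷ d₂ × h ∷ (θ ++ d₁) ≈ (θ ++ d₁) ++ [ g ]
  first-crossing h θ [] up add down = ⊥-elim (upˡ-downˡ (Upˡ-≈ (≡⇒≈ (sym (Listₚ.++-identityʳ θ))) up) down)
  first-crossing h θ (g ∷ d) up add down with Additive-∷ θ g d add | upˡ-or-downˡ h (θ ++ [ g ])
  ... | up-g , _ | inj₂ down′ = [] , g , d , refl , trans≈ (∷-cong h (≡⇒≈ (Listₚ.++-identityʳ θ)))
        (trans≈ (crossing up up-g down′) (++-congʳ [ g ] (≡⇒≈ (sym (Listₚ.++-identityʳ θ)))))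
  ... | _ , add′ | inj₁ up′ with first-crossing h (θ ++ [ g ]) d up′ add′ (subst (Downˡ h) (sym (Listₚ.++-assoc θ [ g ] d)) down)
  ...   | d₁ , g′ , d₂ , refl , e = g ∷ d₁ , g′ , d₂ , refl ,
          trans≈ (∷-cong h (≡⇒≈ (sym (Listₚ.++-assoc θ [ g ] d₁)))) (trans≈ e (++-congʳ [ g′ ] (≡⇒≈ (Listₚ.++-assoc θ [ g ] d₁))))

  ¬conjugate : ∀ r d s → Reduced (r ∷ d ++ [ s ]) → ¬ (d ++ [ s ] ≈ r ∷ d)
  ¬conjugate r d s red e = ℕₚ.<⇒≱ longer (red d (sym≈ (trans≈ (∷-cong r e) (cons-cons r d))))
    where
      longer : length d < length (r ∷ d ++ [ s ])
      longer = s≤s (ℕₚ.≤-trans (ℕₚ.n≤1+n _) (ℕₚ.≤-reflexive (sym (length-snoc d s))))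

  -- The prefix before a shifted descent in d s leaves out at least one letter, so additivity along
  -- d suffices for it.
  Additive-snoc-prefix : ∀ {u d s} d₁ {g d₂} → d ++ [ s ] ≡ d₁ ++ g ∷ d₂ → Additive u d → Additive u d₁
  Additive-snoc-prefix {u} {d} d₁ {g} {d₂} eq add with snoc-prefix d d₁ eq
    where
      snoc-prefix : ∀ (d d₁ : List S) {d₂ s g} → d ++ [ s ] ≡ d₁ ++ g ∷ d₂ → ∃ λ d₃ → d ≡ d₁ ++ d₃
      snoc-prefix d [] eq = d , refl
      snoc-prefix [] (x ∷ []) ()
      snoc-prefix [] (x ∷ _ ∷ _) ()
      snoc-prefix (y ∷ d) (x ∷ d₁) eq with Listₚ.∷-injective eq
      ... | refl , eq′ with snoc-prefix d d₁ eq′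
      ...   | d₃ , refl = d₃ , refl
  ... | d₃ , refl = Additive-++ˡ u d₁ d₃ add

  -- Multiplication on the left by a descent h of x does not see r, d, s, so it reduces to x = 1.
  shifted-if-below : ∀ x θ r d s → Reduced x → θ ≤B x → Additive θ (d ++ [ s ]) → Additive x d → Additive x (r ∷ d) →
                     Reduced (r ∷ d ++ [ s ]) → θ ++ (d ++ [ s ]) ≤B x ++ r ∷ d → Shifted θ x (d ++ [ s ])
  shifted-if-below [] θ r d s _ θ≤x add-θ add-d add-rd red le = ⊥-elim (¬conjugate r d s red (≤-ℓ-antisym
      (≤-resp-≈ (++-congʳ (d ++ [ s ]) θ≈[]) refl≈ le)
      (ℕₚ.≤-trans (ℓ≤length (r ∷ d)) (ℕₚ.≤-reflexive (trans (sym (length-snoc d s)) (sym (ℓ-Reduced (Reduced-++ʳ [ r ] (d ++ [ s ]) red))))))))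
    where
      θ≈[] : θ ≈ []
      θ≈[] = ≤-ℓ-antisym θ≤x (ℕₚ.≤-trans (ℓ≤length []) z≤n)
  shifted-if-below (h ∷ x) θ r d s red-x θ≤x add-θ add-d add-rd red le = by-cases (upˡ-or-downˡ h θ)
    where
      E : List S
      E = d ++ [ s ]

      up-x : Upˡ h x
      up-x = trans (ℓ-Reduced red-x) (cong suc (sym (ℓ-Reduced (Reduced-++ʳ [ h ] x red-x))))

      recurse : ∀ θ → θ ≤B x → Additive θ E → θ ++ E ≤B x ++ r ∷ d → Shifted θ x E
      recurse θ θ≤x add-θ le = shifted-if-below x θ r d s (Reduced-++ʳ [ h ] x red-x) θ≤x add-θ
        (Additive-Upˡ d up-x add-d) (Additive-Upˡ (r ∷ d) up-x add-rd) red le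

      up-prefix : ∀ d₁ {g d₂} → E ≡ d₁ ++ g ∷ d₂ → Upˡ h (x ++ d₁)
      up-prefix d₁ eq = Additive-Upˡ-++ d₁ up-x (Additive-snoc-prefix d₁ eq add-d)

      strip : ∀ w {v} → v ≤B h ∷ (h ∷ w) → v ≤B w
      strip w = ≤-resp-≈ refl≈ (cons-cons h w)

      descent : Downˡ h θ → Shifted θ (h ∷ x) E
      descent down = lift (recurse (h ∷ θ) (strip x (Downˡ-mono θ≤x down)) add-hθ (strip (x ++ r ∷ d) (Downˡ-mono le down-z)))
        where
          add-hθ : Additive (h ∷ θ) E
          add-hθ = Additive-Upˡ E (Downˡ⇒Upˡ down) (Additive-≈ E (sym≈ (cons-cons h θ)) add-θ)
          down-z : Downˡ h (θ ++ E)
          down-z = trans add-θ (trans (cong (ℕ._+ length E) down) (cong suc (sym add-hθ)))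
          lift : Shifted (h ∷ θ) x E → Shifted θ (h ∷ x) E
          lift (d₁ , g , d₂ , eq , le′) = d₁ , g , d₂ , eq ,
            ≤-resp-≈ (cons-cons h ((θ ++ d₁) ++ [ g ])) refl≈ (Upˡ-mono le′ (up-prefix d₁ eq))

      ascent : Upˡ h θ → Upˡ h (θ ++ E) ⊎ Downˡ h (θ ++ E) → Shifted θ (h ∷ x) E
      ascent up (inj₁ up-z) = lift (recurse θ (strip x (liftingˡ θ≤x up)) add-θ (strip (x ++ r ∷ d) (liftingˡ le up-z)))
        where
          lift : Shifted θ x E → Shifted θ (h ∷ x) E
          lift (d₁ , g , d₂ , eq , le′) = d₁ , g , d₂ , eq , ≤-trans le′ (Upˡ⇒≤ (up-prefix d₁ eq))
      ascent up (inj₂ down-z) = cross (first-crossing h θ E up add-θ down-z)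
        where
          cross : (∃ λ d₁ → ∃ λ g → ∃ λ d₂ → E ≡ d₁ ++ g ∷ d₂ × h ∷ (θ ++ d₁) ≈ (θ ++ d₁) ++ [ g ]) → Shifted θ (h ∷ x) E
          cross (d₁ , g , d₂ , eq , e) = d₁ , g , d₂ , eq , ≤-resp-≈ e refl≈
            (Upˡ-mono (Additive-mono d₁ (strip x (liftingˡ θ≤x up)) (Additive-Upˡ d₁ up-x (Additive-snoc-prefix d₁ eq add-d)))
              (up-prefix d₁ eq))

      by-cases : Upˡ h θ ⊎ Downˡ h θ → Shifted θ (h ∷ x) E
      by-cases (inj₁ up)   = ascent up (upˡ-or-downˡ h (θ ++ E))
      by-cases (inj₂ down) = descent down

  Shifted-≈ : ∀ {θ x x′ d} → x ≈ x′ → Shifted θ x d → Shifted θ x′ d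
  Shifted-≈ e (d₁ , g , d₂ , eq , le) = d₁ , g , d₂ , eq , ≤-resp-≈ refl≈ (++-congʳ d₁ e) le

  Shifted-weaken : ∀ {θ x d} d′ → Shifted θ x d → Shifted θ x (d ++ d′)
  Shifted-weaken d′ (d₁ , g , d₂ , refl , le) = d₁ , g , d₂ ++ d′ , Listₚ.++-assoc d₁ (g ∷ d₂) d′ , le

  Shifted-snoc⁻ : ∀ {θ x} d s → Shifted θ x (d ++ [ s ]) → Shifted θ x d ⊎ (θ ++ d) ++ [ s ] ≤B x ++ d
  Shifted-snoc⁻ d s (d₁ , g , d₂ , eq , le) with initLast d₂
  ... | [] with Listₚ.∷ʳ-injective d d₁ eq
  ...   | refl , refl = inj₂ le
  Shifted-snoc⁻ d s (d₁ , g , .(d₂ ++ [ s′ ]) , eq , le) | d₂ ∷ʳ′ s′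
    with Listₚ.∷ʳ-injective d (d₁ ++ g ∷ d₂) (trans eq (sym (Listₚ.++-assoc d₁ (g ∷ d₂) [ s′ ])))
  ... | refl , refl = inj₁ (d₁ , g , d₂ , refl , le)

  module _ {θ x : List S} {r : S} (θ≤x : θ ≤B x) (up-r : Up x r) where

    private
      assoc-r : ∀ d → (x ++ [ r ]) ++ d ≡ x ++ r ∷ d
      assoc-r d = Listₚ.++-assoc x [ r ] d

      x≤xr : ∀ d → Additive (x ++ [ r ]) d → x ++ d ≤B (x ++ [ r ]) ++ d
      x≤xr d add = Additive-mono d (Up⇒≤ up-r) add

    -- The easy direction: x d₁ ≤ x r d₁, so a shifted descent for x is one for x r. A descent s of
    -- x d would give θ d s ≤ x d by the lifting property, which is again a shifted descent.
    lower : ∀ {d} → Reverse d → Additive θ d → Additive (x ++ [ r ]) d → ¬ Shifted θ (x ++ [ r ]) d →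
            Additive x d × ¬ Shifted θ x d
    lower [] add-θ add-xr ns = Additive-[] x , λ { ([] , _ , _ , () , _) ; (_ ∷ _ , _ , _ , () , _) }
    lower (d ∶ rd ∶ʳ s) add-θ add-xr ns with lower rd (Additive-++ˡ θ d [ s ] add-θ) (Additive-++ˡ (x ++ [ r ]) d [ s ] add-xr) (λ sh → ns (Shifted-weaken [ s ] sh))
    ... | add-x , ns-x = Additive-Up x d s add-x up-s , not-shifted
      where
        add-xr-d = Additive-++ˡ (x ++ [ r ]) d [ s ] add-xr
        not-below : ¬ ((θ ++ d) ++ [ s ] ≤B x ++ d)
        not-below le = ns (d , s , [] , refl , ≤-trans le (x≤xr d add-xr-d))
        up-s : Up (x ++ d) s
        up-s with up-or-down (x ++ d) s
        ... | inj₁ up   = up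
        ... | inj₂ down = ⊥-elim (not-below (Down-snoc-≤ (Additive-mono d θ≤x add-x) down))
        not-shifted : ¬ Shifted θ x (d ++ [ s ])
        not-shifted sh with Shifted-snoc⁻ d s sh
        ... | inj₁ sh′ = ns-x sh′
        ... | inj₂ le  = not-below le

    -- The hard direction, which rests on `shifted-if-below`. For additivity: if s were a descent of
    -- x r d, then x d s ≤ x r d with equal lengths, hence d s = r d, although r d s is reduced.
    raise : ∀ {d} → Reverse d → Reduced (r ∷ d) → Additive θ d → Additive x d → ¬ Shifted θ x d →
            Additive (x ++ [ r ]) d × ¬ Shifted θ (x ++ [ r ]) d
    raise [] red add-θ add-x ns = Additive-[] (x ++ [ r ]) , λ { ([] , _ , _ , () , _) ; (_ ∷ _ , _ , _ , () , _) }
    raise (d ∶ rd ∶ʳ s) red add-θ add-x ns with raise rd (Reduced-++ˡ (r ∷ d) [ s ] red) (Additive-++ˡ θ d [ s ] add-θ) (Additive-++ˡ x d [ s ] add-x) (λ sh → ns (Shifted-weaken [ s ] sh))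
    ... | add-xr , ns-xr = Additive-Up (x ++ [ r ]) d s add-xr up-s , not-shifted
      where
        add-x-d = Additive-++ˡ x d [ s ] add-x
        up-s : Up ((x ++ [ r ]) ++ d) s
        up-s with up-or-down ((x ++ [ r ]) ++ d) s
        ... | inj₁ up   = up
        ... | inj₂ down = ⊥-elim (¬conjugate r d s red (++-cancelˡ-≈ x (trans≈
                (trans≈ (≡⇒≈ (sym (Listₚ.++-assoc x d [ s ])))
                  (≤-ℓ-antisym (Down-snoc-≤ (x≤xr d add-xr) down) (ℕₚ.≤-reflexive (begin
                    ℓ ((x ++ [ r ]) ++ d)        ≡⟨ add-xr ⟩
                    ℓ (x ++ [ r ]) ℕ.+ length d  ≡⟨ cong (ℕ._+ length d) up-r ⟩
                    suc (ℓ x ℕ.+ length d)       ≡⟨ cong suc (sym add-x-d) ⟩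
                    suc (ℓ (x ++ d))             ≡⟨ sym (Additive-snoc x d s add-x) ⟩
                    ℓ ((x ++ d) ++ [ s ]) ∎))))
                (≡⇒≈ (assoc-r d)))))
          where open ≡-Reasoning
        not-shifted : ¬ Shifted θ (x ++ [ r ]) (d ++ [ s ])
        not-shifted sh with Shifted-snoc⁻ d s sh
        ... | inj₁ sh′ = ns-xr sh′
        ... | inj₂ le  = ns (Shifted-≈ (normal-≈ x) (shifted-if-below (normal x) θ r d s (normal-Reduced x)
                (≤-resp-≈ refl≈ x≈ θ≤x) add-θ (Additive-≈ d x≈ add-x-d) (Additive-≈ (r ∷ d) x≈ add-rd) red
                (≤-resp-≈ (≡⇒≈ (Listₚ.++-assoc θ d [ s ])) (trans≈ (≡⇒≈ (assoc-r d)) (++-congʳ (r ∷ d) x≈)) le)))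
          where
            x≈ : x ≈ normal x
            x≈ = sym≈ (normal-≈ x)
            add-rd : Additive x (r ∷ d)
            add-rd = trans (cong ℓ (sym (assoc-r d))) (trans add-xr (trans (cong (ℕ._+ length d) up-r) (sym (ℕₚ.+-suc (ℓ x) (length d)))))

  -- Constant masks

  -- The index `p` is the product selected so far; it allows a mask to be cut at any position. The
  -- ascent condition appears in both constructors because a defect does not depend on the bit at
  -- its own position.
  data Constant (p : List S) : List S → List Bool → Set where
    []   : Constant p [] []
    keep : ∀ {s w σ} → Up p s → Constant (p ++ [ s ]) w σ → Constant p (s ∷ w) (true ∷ σ)
    skip : ∀ {s w σ} → Up p s → Constant p w σ → Constant p (s ∷ w) (false ∷ σ)

  Constant-≈ : ∀ {p p′ w σ} → p ≈ p′ → Constant p w σ → Constant p′ w σ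
  Constant-≈ e []          = []
  Constant-≈ e (keep up c) = keep (Up-≈ e up) (Constant-≈ (++-congʳ _ e) c)
  Constant-≈ e (skip up c) = skip (Up-≈ e up) (Constant-≈ e c)

  Constant-length : ∀ {p w σ} → Constant p w σ → length σ ≡ length w
  Constant-length []         = refl
  Constant-length (keep _ c) = cong suc (Constant-length c)
  Constant-length (skip _ c) = cong suc (Constant-length c)

  Down⇒<B : ∀ {u s} → Down u s → u ++ [ s ] <B u
  Down⇒<B down = Down⇒≤ down , λ e → ℕₚ.<-irrefl (ℓ-≈ e) (ℕₚ.≤-reflexive (sym down))

  <B⇒Down : ∀ {u s} → u ++ [ s ] <B u → Down u s
  <B⇒Down {u} {s} lt with up-or-down u s
  ... | inj₂ down = down
  ... | inj₁ up   = ⊥-elim (ℕₚ.<-asym (<⇒ℓ< lt) (ℕₚ.≤-reflexive (sym up)))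

  ‼-< : ∀ {A : Set} {w : List A} j {s} → w ‼ j ≡ just s → j < length w
  ‼-< {w = _ ∷ w} zero    eq = s≤s z≤n
  ‼-< {w = _ ∷ w} (suc j) eq = s≤s (‼-< {w = w} j eq)

  Constant⇒Up : ∀ {p w σ} → Constant p w σ → ∀ j {s} → w ‼ j ≡ just s → Up (p ++ prefix w σ j) s
  Constant⇒Up {p} (keep up c) zero refl = Up-≈ (≡⇒≈ (sym (Listₚ.++-identityʳ p))) up
  Constant⇒Up {p} (skip up c) zero refl = Up-≈ (≡⇒≈ (sym (Listₚ.++-identityʳ p))) up
  Constant⇒Up {p} (keep {r} up c) (suc j) eq = Up-≈ (≡⇒≈ (Listₚ.++-assoc p [ r ] _)) (Constant⇒Up c j eq)
  Constant⇒Up (skip up c) (suc j) eq = Constant⇒Up c j eq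

  Up⇒Constant : ∀ p w σ → length σ ≡ length w → (∀ j {s} → w ‼ j ≡ just s → Up (p ++ prefix w σ j) s) → Constant p w σ
  Up⇒Constant p [] [] _ ups = []
  Up⇒Constant p (s ∷ w) (true ∷ σ) len ups = keep (Up-≈ (≡⇒≈ (Listₚ.++-identityʳ p)) (ups 0 refl))
    (Up⇒Constant (p ++ [ s ]) w σ (ℕₚ.suc-injective len) λ j eq → Up-≈ (≡⇒≈ (sym (Listₚ.++-assoc p [ s ] _))) (ups (suc j) eq))
  Up⇒Constant p (s ∷ w) (false ∷ σ) len ups = skip (Up-≈ (≡⇒≈ (Listₚ.++-identityʳ p)) (ups 0 refl))
    (Up⇒Constant p w σ (ℕₚ.suc-injective len) λ j eq → ups (suc j) eq)

  Constant⇒ConstantMask : ∀ {w σ} → Constant [] w σ → ConstantMask w σ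
  Constant⇒ConstantMask c = Constant-length c , λ { j _ (s , eq , lt) → up-down (Constant⇒Up c j eq) (<B⇒Down lt) }

  ConstantMask⇒Constant : ∀ {w σ} → ConstantMask w σ → Constant [] w σ
  ConstantMask⇒Constant {w} {σ} (len , no-defect) = Up⇒Constant [] w σ len up
    where
      up : ∀ j {s} → w ‼ j ≡ just s → Up (prefix w σ j) s
      up j {s} eq with up-or-down (prefix w σ j) s
      ... | inj₁ up   = up
      ... | inj₂ down = ⊥-elim (no-defect j (‼-< {w = w} j eq) (s , eq , Down⇒<B down))

  Constant-++ : ∀ {p w₁ σ₁ w₂ σ₂} → Constant p w₁ σ₁ → Constant (p ++ sel w₁ σ₁) w₂ σ₂ → Constant p (w₁ ++ w₂) (σ₁ ++ σ₂)
  Constant-++ {p} []          c₂ = Constant-≈ (≡⇒≈ (Listₚ.++-identityʳ p)) c₂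
  Constant-++ {p} (keep {s} up c₁) c₂ = keep up (Constant-++ c₁ (Constant-≈ (≡⇒≈ (sym (Listₚ.++-assoc p [ s ] _))) c₂))
  Constant-++ (skip up c₁)    c₂ = skip up (Constant-++ c₁ c₂)

  Constant-++⁻ : ∀ {p} w₁ {σ₁ w₂ σ₂} → length w₁ ≡ length σ₁ → Constant p (w₁ ++ w₂) (σ₁ ++ σ₂) →
                 Constant p w₁ σ₁ × Constant (p ++ sel w₁ σ₁) w₂ σ₂
  Constant-++⁻ {p} [] {[]} _ c = [] , Constant-≈ (≡⇒≈ (sym (Listₚ.++-identityʳ p))) c
  Constant-++⁻ {p} (s ∷ w₁) {true ∷ σ₁} len (keep up c) with Constant-++⁻ w₁ (ℕₚ.suc-injective len) c
  ... | c₁ , c₂ = keep up c₁ , Constant-≈ (≡⇒≈ (Listₚ.++-assoc p [ s ] _)) c₂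
  Constant-++⁻ (s ∷ w₁) {false ∷ σ₁} len (skip up c) with Constant-++⁻ w₁ (ℕₚ.suc-injective len) c
  ... | c₁ , c₂ = skip up c₁ , c₂

  sel-⊆ : ∀ w σ → sel w σ ⊆ w
  sel-⊆ [] σ = []
  sel-⊆ (s ∷ w) [] = Subₚ.[]⊆-universal (s ∷ w)
  sel-⊆ (s ∷ w) (true ∷ σ)  = refl ∷ sel-⊆ w σ
  sel-⊆ (s ∷ w) (false ∷ σ) = s ∷ʳ sel-⊆ w σ

  sel-++ : ∀ w₁ σ₁ {w₂ σ₂} → length w₁ ≡ length σ₁ → sel (w₁ ++ w₂) (σ₁ ++ σ₂) ≡ sel w₁ σ₁ ++ sel w₂ σ₂
  sel-++ [] [] _ = refl
  sel-++ (s ∷ w₁) (true ∷ σ₁)  len = cong (s ∷_) (sel-++ w₁ σ₁ (ℕₚ.suc-injective len))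
  sel-++ (s ∷ w₁) (false ∷ σ₁) len = sel-++ w₁ σ₁ (ℕₚ.suc-injective len)

  Constant-sel-Reduced : ∀ {p w σ} → Reduced p → Constant p w σ → Reduced (p ++ sel w σ)
  Constant-sel-Reduced {p} red []          = subst Reduced (sym (Listₚ.++-identityʳ p)) red
  Constant-sel-Reduced {p} red (keep {s} up c) = subst Reduced (Listₚ.++-assoc p [ s ] _) (Constant-sel-Reduced (Reduced-snoc red up) c)
  Constant-sel-Reduced red (skip up c)     = Constant-sel-Reduced red c

  -- Induction from the right: the last bit is one exactly if the last letter s is a descent of the
  -- element a. If a does not use the final s, the exchange condition still finds a s as a subword
  -- of a.
  Constant-exists : ∀ {w} → Reverse w → ∀ a → Reduced a → a ⊆ w → ∃ λ σ → Constant [] w σ × sel w σ ≈ a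
  Constant-exists [] .[] red [] = [] , [] , refl≈
  Constant-exists (w ∶ rw ∶ʳ s) a red sub = extend (⊆-snoc w sub)
    where
      Goal = ∃ λ σ → Constant [] (w ++ [ s ]) σ × sel (w ++ [ s ]) σ ≈ a

      append-true : ∀ a′ → Up a′ s → a′ ++ [ s ] ≈ a → (∃ λ σ → Constant [] w σ × sel w σ ≈ a′) → Goal
      append-true a′ up e (σ , c , e′) = σ ++ [ true ] , Constant-++ c (keep (Up-≈ (sym≈ e′) up) []) ,
        trans≈ (≡⇒≈ (sel-++ w σ (sym (Constant-length c)))) (trans≈ (++-congʳ [ s ] e′) e)

      append-false : Up a s → (∃ λ σ → Constant [] w σ × sel w σ ≈ a) → Goal
      append-false up (σ , c , e) = σ ++ [ false ] , Constant-++ c (skip (Up-≈ (sym≈ e) up) []) ,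
        trans≈ (≡⇒≈ (trans (sel-++ w σ (sym (Constant-length c))) (Listₚ.++-identityʳ _))) e

      exchanged : Down a s → a ⊆ w → Del a (a ++ [ s ]) → Goal
      exchanged down sub (c₁ , r , c₂ , refl , e) with reduced-sublist (c₁ ++ c₂)
      ... | a′ , sub′ , e′ , red′ = append-true a′ (Up-≈ a≈ (Down⇒Up down)) (trans≈ (++-congʳ [ s ] (sym≈ a≈)) (snoc-snoc _ s))
            (Constant-exists rw a′ red′ (⊆-trans sub′ (⊆-trans (del-⊆ c₁ r c₂) sub)))
        where
          a≈ : (c₁ ++ r ∷ c₂) ++ [ s ] ≈ a′
          a≈ = trans≈ e (sym≈ e′)

      extend : a ⊆ w ⊎ (∃ λ a′ → a ≡ a′ ++ [ s ] × a′ ⊆ w) → Goal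
      extend (inj₂ (a′ , refl , sub′)) = append-true a′ (snoc-Reduced red) refl≈ (Constant-exists rw a′ (Reduced-++ˡ a′ [ s ] red) sub′)
      extend (inj₁ sub′) with up-or-down a s
      ... | inj₁ up   = append-false up (Constant-exists rw a red sub′)
      ... | inj₂ down = exchanged down sub′ (exchange down)

  constant-mask : ∀ {u v w} → u ≤B v → w ≈ v → ∃ λ σ → Constant [] w σ × sel w σ ≈ u
  constant-mask {w = w} le e with subword le e
  ... | a , sub , ea , red with Constant-exists (reverseView w) a red sub
  ...   | σ , c , e′ = σ , c , trans≈ e′ ea

  split-snoc : ∀ {p} w {s σ} → Constant p (w ++ [ s ]) σ → ∃ λ σ′ → ∃ λ b → σ ≡ σ′ ++ [ b ] × length w ≡ length σ′
  split-snoc []      (keep _ []) = [] , true , refl , refl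
  split-snoc []      (skip _ []) = [] , false , refl , refl
  split-snoc (x ∷ w) (keep _ c) with split-snoc w c
  ... | σ′ , b , refl , len = true ∷ σ′ , b , refl , cong suc len
  split-snoc (x ∷ w) (skip _ c) with split-snoc w c
  ... | σ′ , b , refl , len = false ∷ σ′ , b , refl , cong suc len

  -- The element forces the last bit: a kept letter is a descent of it, a skipped one an ascent.
  Constant-unique : ∀ {w} → Reverse w → ∀ {σ σ′} → Constant [] w σ → Constant [] w σ′ → sel w σ ≈ sel w σ′ → σ ≡ σ′
  Constant-unique [] [] [] _ = refl
  Constant-unique (w ∶ rw ∶ʳ s) c c′ e with split-snoc w c | split-snoc w c′
  ... | σ , b , refl , len | σ′ , b′ , refl , len′ = last b b′ (Constant-++⁻ w len c) (Constant-++⁻ w len′ c′)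
      (trans≈ (≡⇒≈ (sym (sel-++ w σ len))) (trans≈ e (≡⇒≈ (sel-++ w σ′ len′))))
    where
      last : ∀ b b′ → Constant [] w σ × Constant (sel w σ) [ s ] [ b ] → Constant [] w σ′ × Constant (sel w σ′) [ s ] [ b′ ] →
             sel w σ ++ sel [ s ] [ b ] ≈ sel w σ′ ++ sel [ s ] [ b′ ] → σ ++ [ b ] ≡ σ′ ++ [ b′ ]
      last true true (c , _) (c′ , _) e = cong (_++ [ true ]) (Constant-unique rw c c′ (snoc-cancel s e))
      last false false (c , _) (c′ , _) e = cong (_++ [ false ]) (Constant-unique rw c c′
        (trans≈ (≡⇒≈ (sym (Listₚ.++-identityʳ _))) (trans≈ e (≡⇒≈ (Listₚ.++-identityʳ _)))))
      last true false (c , keep up _) (c′ , skip up′ _) e =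
        ⊥-elim (up-down up′ (Down-≈ (trans≈ e (≡⇒≈ (Listₚ.++-identityʳ _))) (Up⇒Down up)))
      last false true (c , skip up _) (c′ , keep up′ _) e =
        ⊥-elim (up-down up (Down-≈ (trans≈ (sym≈ e) (≡⇒≈ (Listₚ.++-identityʳ _))) (Up⇒Down up′)))

  -- Relative masks and positions

  Is : List S → List Entry
  Is d = replicate (length d) I

  Is-++ : ∀ d₁ g d₂ → Is (d₁ ++ g ∷ d₂) ≡ Is d₁ ++ I ∷ Is d₂
  Is-++ []       g d₂ = refl
  Is-++ (s ∷ d₁) g d₂ = cong (I ∷_) (Is-++ d₁ g d₂)

  length-Is : ∀ d → length (Is d) ≡ length d
  length-Is d = Listₚ.length-replicate (length d)

  Ξ-++ : ∀ σ₁ σ₂ → Ξ (σ₁ ++ σ₂) ≡ Ξ σ₁ ++ Ξ σ₂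
  Ξ-++ []       σ₂ = refl
  Ξ-++ (O ∷ σ₁) σ₂ = cong (true ∷_) (Ξ-++ σ₁ σ₂)
  Ξ-++ (I ∷ σ₁) σ₂ = cong (true ∷_) (Ξ-++ σ₁ σ₂)
  Ξ-++ (X ∷ σ₁) σ₂ = cong (false ∷_) (Ξ-++ σ₁ σ₂)

  ones-++ : ∀ σ₁ σ₂ → ones (σ₁ ++ σ₂) ≡ ones σ₁ ++ ones σ₂
  ones-++ []       σ₂ = refl
  ones-++ (O ∷ σ₁) σ₂ = cong (false ∷_) (ones-++ σ₁ σ₂)
  ones-++ (I ∷ σ₁) σ₂ = cong (true ∷_) (ones-++ σ₁ σ₂)
  ones-++ (X ∷ σ₁) σ₂ = cong (false ∷_) (ones-++ σ₁ σ₂)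

  length-Ξ : ∀ σ → length (Ξ σ) ≡ length σ
  length-Ξ []      = refl
  length-Ξ (O ∷ σ) = cong suc (length-Ξ σ)
  length-Ξ (I ∷ σ) = cong suc (length-Ξ σ)
  length-Ξ (X ∷ σ) = cong suc (length-Ξ σ)

  length-ones : ∀ σ → length (ones σ) ≡ length σ
  length-ones []      = refl
  length-ones (O ∷ σ) = cong suc (length-ones σ)
  length-ones (I ∷ σ) = cong suc (length-ones σ)
  length-ones (X ∷ σ) = cong suc (length-ones σ)

  sel-Ξ-Is : ∀ d → sel d (Ξ (Is d)) ≡ d
  sel-Ξ-Is []      = refl
  sel-Ξ-Is (s ∷ d) = cong (s ∷_) (sel-Ξ-Is d)

  sel-ones-Is : ∀ d → sel d (ones (Is d)) ≡ d
  sel-ones-Is []      = refl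
  sel-ones-Is (s ∷ d) = cong (s ∷_) (sel-ones-Is d)

  sel-restrict : ∀ w σ → sel (sel w (Ξ σ)) (restrict σ) ≡ sel w (ones σ)
  sel-restrict []      []      = refl
  sel-restrict []      (O ∷ σ) = refl
  sel-restrict []      (I ∷ σ) = refl
  sel-restrict []      (X ∷ σ) = refl
  sel-restrict (s ∷ w) []      = refl
  sel-restrict (s ∷ w) (O ∷ σ) = sel-restrict w σ
  sel-restrict (s ∷ w) (I ∷ σ) = cong (s ∷_) (sel-restrict w σ)
  sel-restrict (s ∷ w) (X ∷ σ) = sel-restrict w σ

  sel-Ξ-++ : ∀ c {σ₀} w₂ σ₂ → length c ≡ length σ₀ → sel (c ++ w₂) (Ξ (σ₀ ++ σ₂)) ≡ sel c (Ξ σ₀) ++ sel w₂ (Ξ σ₂)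
  sel-Ξ-++ c {σ₀} w₂ σ₂ len = trans (cong (sel (c ++ w₂)) (Ξ-++ σ₀ σ₂)) (sel-++ c (Ξ σ₀) (trans len (sym (length-Ξ σ₀))))

  sel-ones-++ : ∀ c {σ₀} w₂ σ₂ → length c ≡ length σ₀ → sel (c ++ w₂) (ones (σ₀ ++ σ₂)) ≡ sel c (ones σ₀) ++ sel w₂ (ones σ₂)
  sel-ones-++ c {σ₀} w₂ σ₂ len = trans (cong (sel (c ++ w₂)) (ones-++ σ₀ σ₂)) (sel-++ c (ones σ₀) (trans len (sym (length-ones σ₀))))

  Ξ-overwrite : ∀ σ ρ → Ξ (overwrite σ ρ) ≡ Ξ σ
  Ξ-overwrite []      ρ           = refl
  Ξ-overwrite (X ∷ σ) ρ           = cong (false ∷_) (Ξ-overwrite σ ρ)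
  Ξ-overwrite (O ∷ σ) []          = refl
  Ξ-overwrite (I ∷ σ) []          = refl
  Ξ-overwrite (O ∷ σ) (true ∷ ρ)  = cong (true ∷_) (Ξ-overwrite σ ρ)
  Ξ-overwrite (O ∷ σ) (false ∷ ρ) = cong (true ∷_) (Ξ-overwrite σ ρ)
  Ξ-overwrite (I ∷ σ) (true ∷ ρ)  = cong (true ∷_) (Ξ-overwrite σ ρ)
  Ξ-overwrite (I ∷ σ) (false ∷ ρ) = cong (true ∷_) (Ξ-overwrite σ ρ)

  restrict-overwrite : ∀ σ ρ → length ρ ≡ length (restrict σ) → restrict (overwrite σ ρ) ≡ ρ
  restrict-overwrite []      []          _   = refl
  restrict-overwrite (X ∷ σ) ρ           len = restrict-overwrite σ ρ len
  restrict-overwrite (O ∷ σ) (true ∷ ρ)  len = cong (true ∷_) (restrict-overwrite σ ρ (ℕₚ.suc-injective len))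
  restrict-overwrite (O ∷ σ) (false ∷ ρ) len = cong (false ∷_) (restrict-overwrite σ ρ (ℕₚ.suc-injective len))
  restrict-overwrite (I ∷ σ) (true ∷ ρ)  len = cong (true ∷_) (restrict-overwrite σ ρ (ℕₚ.suc-injective len))
  restrict-overwrite (I ∷ σ) (false ∷ ρ) len = cong (false ∷_) (restrict-overwrite σ ρ (ℕₚ.suc-injective len))

  -- Two masks with the same X-mask are recovered from each other by overwriting, so the third and
  -- the fourth case of φ undo each other.
  overwrite-restrict : ∀ σ σ′ → Ξ σ ≡ Ξ σ′ → overwrite σ (restrict σ′) ≡ σ′
  overwrite-restrict []      []       _  = refl
  overwrite-restrict []      (O ∷ _)  ()
  overwrite-restrict []      (I ∷ _)  ()
  overwrite-restrict []      (X ∷ _)  ()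
  overwrite-restrict (O ∷ _) []       ()
  overwrite-restrict (I ∷ _) []       ()
  overwrite-restrict (X ∷ _) []       ()
  overwrite-restrict (O ∷ _) (X ∷ _)  ()
  overwrite-restrict (I ∷ _) (X ∷ _)  ()
  overwrite-restrict (X ∷ _) (O ∷ _)  ()
  overwrite-restrict (X ∷ _) (I ∷ _)  ()
  overwrite-restrict (O ∷ σ) (O ∷ σ′) eq = cong (O ∷_) (overwrite-restrict σ σ′ (Listₚ.∷-injectiveʳ eq))
  overwrite-restrict (O ∷ σ) (I ∷ σ′) eq = cong (I ∷_) (overwrite-restrict σ σ′ (Listₚ.∷-injectiveʳ eq))
  overwrite-restrict (I ∷ σ) (O ∷ σ′) eq = cong (O ∷_) (overwrite-restrict σ σ′ (Listₚ.∷-injectiveʳ eq))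
  overwrite-restrict (I ∷ σ) (I ∷ σ′) eq = cong (I ∷_) (overwrite-restrict σ σ′ (Listₚ.∷-injectiveʳ eq))
  overwrite-restrict (X ∷ σ) (X ∷ σ′) eq = cong (X ∷_) (overwrite-restrict σ σ′ (Listₚ.∷-injectiveʳ eq))

  -- p and q are the values σ[j] and τ[j] of the prefix that precedes w.
  data Relative (p q : List S) : List S → List Entry → Set where
    []  : Relative p q [] []
    X∷_ : ∀ {s w σ} → Up q s × Relative p q w σ → Relative p q (s ∷ w) (X ∷ σ)
    O∷_ : ∀ {s w σ} → Up q s × Up p s × Relative p (q ++ [ s ]) w σ → Relative p q (s ∷ w) (O ∷ σ)
    I∷_ : ∀ {s w σ} → Up q s × Up p s × Relative (p ++ [ s ]) (q ++ [ s ]) w σ → Relative p q (s ∷ w) (I ∷ σ)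

  Relative-length : ∀ {p q w σ} → Relative p q w σ → length w ≡ length σ
  Relative-length []                = refl
  Relative-length (X∷ (_ , r))      = cong suc (Relative-length r)
  Relative-length (O∷ (_ , _ , r))  = cong suc (Relative-length r)
  Relative-length (I∷ (_ , _ , r))  = cong suc (Relative-length r)

  Relative-≈ : ∀ {p p′ q q′ w σ} → p ≈ p′ → q ≈ q′ → Relative p q w σ → Relative p′ q′ w σ
  Relative-≈ e e′ []                   = []
  Relative-≈ e e′ (X∷ (up , r))        = X∷ (Up-≈ e′ up , Relative-≈ e e′ r)
  Relative-≈ e e′ (O∷ (up , up′ , r))  = O∷ (Up-≈ e′ up , Up-≈ e up′ , Relative-≈ e (++-congʳ _ e′) r)
  Relative-≈ e e′ (I∷ (up , up′ , r))  = I∷ (Up-≈ e′ up , Up-≈ e up′ , Relative-≈ (++-congʳ _ e) (++-congʳ _ e′) r)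

  Relative⇒Constant : ∀ {p q w σ} → Relative p q w σ → Constant q w (Ξ σ) × Constant p (sel w (Ξ σ)) (restrict σ)
  Relative⇒Constant []                  = [] , []
  Relative⇒Constant (X∷ (up , r))       = let c , c′ = Relative⇒Constant r in skip up c , c′
  Relative⇒Constant (O∷ (up , up′ , r)) = let c , c′ = Relative⇒Constant r in keep up c , skip up′ c′
  Relative⇒Constant (I∷ (up , up′ , r)) = let c , c′ = Relative⇒Constant r in keep up c , keep up′ c′

  Constant⇒Relative : ∀ {p q} w σ → Constant q w (Ξ σ) → Constant p (sel w (Ξ σ)) (restrict σ) → Relative p q w σ
  Constant⇒Relative []      []      c          c′            = []
  Constant⇒Relative []      (O ∷ _) ()
  Constant⇒Relative []      (I ∷ _) ()
  Constant⇒Relative []      (X ∷ _) ()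
  Constant⇒Relative (s ∷ w) (X ∷ σ) (skip up c) c′           = X∷ (up , Constant⇒Relative w σ c c′)
  Constant⇒Relative (s ∷ w) (O ∷ σ) (keep up c) (skip up′ c′) = O∷ (up , up′ , Constant⇒Relative w σ c c′)
  Constant⇒Relative (s ∷ w) (I ∷ σ) (keep up c) (keep up′ c′) = I∷ (up , up′ , Constant⇒Relative w σ c c′)

  Relative-++ : ∀ {p q w₁ σ₁ w₂ σ₂} → Relative p q w₁ σ₁ → Relative (p ++ sel w₁ (ones σ₁)) (q ++ sel w₁ (Ξ σ₁)) w₂ σ₂ →
                Relative p q (w₁ ++ w₂) (σ₁ ++ σ₂)
  Relative-++ {p} {q} [] r₂ = Relative-≈ (≡⇒≈ (Listₚ.++-identityʳ p)) (≡⇒≈ (Listₚ.++-identityʳ q)) r₂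
  Relative-++ (X∷ (up , r₁)) r₂ = X∷ (up , Relative-++ r₁ r₂)
  Relative-++ {q = q} (O∷_ {s} (up , up′ , r₁)) r₂ = O∷ (up , up′ , Relative-++ r₁ (Relative-≈ refl≈ (≡⇒≈ (sym (Listₚ.++-assoc q [ s ] _))) r₂))
  Relative-++ {p} {q} (I∷_ {s} (up , up′ , r₁)) r₂ = I∷ (up , up′ , Relative-++ r₁
    (Relative-≈ (≡⇒≈ (sym (Listₚ.++-assoc p [ s ] _))) (≡⇒≈ (sym (Listₚ.++-assoc q [ s ] _))) r₂))

  Relative-++⁻ : ∀ {p q} w₁ σ₁ {w₂ σ₂} → length w₁ ≡ length σ₁ → Relative p q (w₁ ++ w₂) (σ₁ ++ σ₂) →
                 Relative p q w₁ σ₁ × Relative (p ++ sel w₁ (ones σ₁)) (q ++ sel w₁ (Ξ σ₁)) w₂ σ₂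
  Relative-++⁻ {p} {q} [] [] _ r = [] , Relative-≈ (≡⇒≈ (sym (Listₚ.++-identityʳ p))) (≡⇒≈ (sym (Listₚ.++-identityʳ q))) r
  Relative-++⁻ (s ∷ w₁) (X ∷ σ₁) len (X∷ (up , r)) with Relative-++⁻ w₁ σ₁ (ℕₚ.suc-injective len) r
  ... | r₁ , r₂ = X∷ (up , r₁) , r₂
  Relative-++⁻ {q = q} (s ∷ w₁) (O ∷ σ₁) len (O∷ (up , up′ , r)) with Relative-++⁻ w₁ σ₁ (ℕₚ.suc-injective len) r
  ... | r₁ , r₂ = O∷ (up , up′ , r₁) , Relative-≈ refl≈ (≡⇒≈ (Listₚ.++-assoc q [ s ] _)) r₂
  Relative-++⁻ {p} {q} (s ∷ w₁) (I ∷ σ₁) len (I∷ (up , up′ , r)) with Relative-++⁻ w₁ σ₁ (ℕₚ.suc-injective len) r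
  ... | r₁ , r₂ = I∷ (up , up′ , r₁) , Relative-≈ (≡⇒≈ (Listₚ.++-assoc p [ s ] _)) (≡⇒≈ (Listₚ.++-assoc q [ s ] _)) r₂

  Relative-Is : ∀ p q d → Additive p d → Additive q d → Relative p q d (Is d)
  Relative-Is p q []      add add′ = []
  Relative-Is p q (s ∷ d) add add′ with Additive-∷ p s d add | Additive-∷ q s d add′
  ... | up , add-p | up′ , add-q = I∷ (up′ , up , Relative-Is (p ++ [ s ]) (q ++ [ s ]) d add-p add-q)

  Is-Additive : ∀ p q d → Relative p q d (Is d) → Additive p d × Additive q d
  Is-Additive p q []      r = Additive-[] p , Additive-[] q
  Is-Additive p q (s ∷ d) (I∷ (up , up′ , r)) with Is-Additive (p ++ [ s ]) (q ++ [ s ]) d r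
  ... | add-p , add-q = ∷-Additive p s d up′ add-p , ∷-Additive q s d up add-q

  InR⇒Relative : ∀ {w y σ} → InR w y σ → Relative [] [] w σ × sel w (ones σ) ≈ y
  InR⇒Relative {w} {y} {σ} (x , _ , _ , _ , (c , _) , (c′ , e)) =
    Constant⇒Relative w σ (ConstantMask⇒Constant c) (ConstantMask⇒Constant c′) ,
    trans≈ (≡⇒≈ (sym (sel-restrict w σ))) e

  Relative⇒InR : ∀ {w y σ} → Reduced w → Relative [] [] w σ → sel w (ones σ) ≈ y → InR w y σ
  Relative⇒InR {w} {y} {σ} red r e with Relative⇒Constant r
  ... | c , c′ = sel w (Ξ σ) ,
    ≤-resp-≈ (trans≈ (≡⇒≈ (sel-restrict w σ)) e) refl≈
      (⊆⇒≤ (Constant-sel-Reduced (λ _ _ → z≤n) c) (sel-⊆ (sel w (Ξ σ)) (restrict σ))) ,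
    ⊆⇒≤ red (sel-⊆ w (Ξ σ)) ,
    sym (Relative-length r) ,
    (Constant⇒ConstantMask c , refl≈) ,
    Constant⇒ConstantMask c′ , trans≈ (≡⇒≈ (sel-restrict w σ)) e

  Relative⇒≤ : ∀ {w σ} → Relative [] [] w σ → sel w (ones σ) ≤B sel w (Ξ σ)
  Relative⇒≤ {w} {σ} r with Relative⇒Constant r
  ... | c , c′ = ≤-resp-≈ (≡⇒≈ (sel-restrict w σ)) refl≈
    (⊆⇒≤ (Constant-sel-Reduced (λ _ _ → z≤n) c) (sel-⊆ (sel w (Ξ σ)) (restrict σ)))

  -- Positions in concatenated lists

  ‼-++ : ∀ {A B : Set} (c : List B) (xs : List A) {a ys} → length c ≡ length xs → (xs ++ a ∷ ys) ‼ length c ≡ just a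
  ‼-++ []      []       _   = refl
  ‼-++ (_ ∷ c) (_ ∷ xs) len = ‼-++ c xs (ℕₚ.suc-injective len)

  take-++ : ∀ {A B : Set} (c : List B) (xs : List A) {ys} → length c ≡ length xs → take (length c) (xs ++ ys) ≡ xs
  take-++ []      []       _   = refl
  take-++ (_ ∷ c) (x ∷ xs) len = cong (x ∷_) (take-++ c xs (ℕₚ.suc-injective len))

  drop-++ : ∀ {A B : Set} (c : List B) (xs : List A) {a ys} → length c ≡ length xs → drop (suc (length c)) (xs ++ a ∷ ys) ≡ ys
  drop-++ []      []       _   = refl
  drop-++ (_ ∷ c) (x ∷ xs) len = drop-++ c xs (ℕₚ.suc-injective len)

  prefix-++ : ∀ c (β : List Bool) {w₂ β₂} → length c ≡ length β → prefix (c ++ w₂) (β ++ β₂) (length c) ≡ sel c β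
  prefix-++ c β len = cong₂ sel (take-++ c c refl) (take-++ c β len)

  prefix-suc-++ : ∀ c (β : List Bool) r b {d β₂} → length c ≡ length β →
                  prefix (c ++ r ∷ d) (β ++ b ∷ β₂) (suc (length c)) ≡ sel c β ++ sel [ r ] [ b ]
  prefix-suc-++ []      []          r true  _   = refl
  prefix-suc-++ []      []          r false _   = refl
  prefix-suc-++ (s ∷ c) (true ∷ β)  r b     len = cong (s ∷_) (prefix-suc-++ c β r b (ℕₚ.suc-injective len))
  prefix-suc-++ (s ∷ c) (false ∷ β) r b     len = prefix-suc-++ c β r b (ℕₚ.suc-injective len)

  module Position (c : List S) (σ₀ : List Entry) (r : S) (d : List S) (κ : List Entry) (len : length c ≡ length σ₀) where

    w : List S
    w = c ++ r ∷ d

    j : ℕ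
    j = length c

    j<w : j < length w
    j<w = ℕₚ.≤-trans (s≤s (ℕₚ.m≤m+n (length c) (length d))) (ℕₚ.≤-reflexive (trans (sym (ℕₚ.+-suc (length c) (length d))) (sym (Listₚ.length-++ c))))

    π x : List S
    π = sel c (ones σ₀)
    x = sel c (Ξ σ₀)

    letter : w ‼ j ≡ just r
    letter = ‼-++ c c refl

    module _ (e : Entry) where

      σ : List Entry
      σ = σ₀ ++ e ∷ κ

      entry : σ ‼ j ≡ just e
      entry = ‼-++ c σ₀ len

      σpre-j : σpre w σ j ≡ π
      σpre-j = trans (cong (λ β → prefix w β j) (ones-++ σ₀ (e ∷ κ))) (prefix-++ c (ones σ₀) (trans len (sym (length-ones σ₀))))

      τpre-j : τpre w σ j ≡ x
      τpre-j = trans (cong (λ β → prefix w β j) (Ξ-++ σ₀ (e ∷ κ))) (prefix-++ c (Ξ σ₀) (trans len (sym (length-Ξ σ₀))))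

      replaceAt-j : ∀ e′ → replaceAt σ j e′ ≡ σ₀ ++ e′ ∷ κ
      replaceAt-j e′ = cong₂ (λ a b → a ++ e′ ∷ b) (take-++ c σ₀ len) (drop-++ c σ₀ len)

      Defect⇒Down : Defect w σ j → Down π r
      Defect⇒Down (s , eq , lt) with trans (sym eq) letter
      ... | refl = subst (λ u → Down u r) σpre-j (<B⇒Down lt)

      Down⇒Defect : Down π r → Defect w σ j
      Down⇒Defect down = r , letter , Down⇒<B (subst (λ u → Down u r) (sym σpre-j) down)

    σpre-suc : σpre w (σ I) (suc j) ≡ π ++ [ r ]
    σpre-suc = trans (cong (λ β → prefix w β (suc j)) (ones-++ σ₀ (I ∷ κ))) (prefix-suc-++ c (ones σ₀) r true (trans len (sym (length-ones σ₀))))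

  Shifted-∷⁻ : ∀ {θ x} s d → Shifted θ x (s ∷ d) → θ ++ [ s ] ≤B x ⊎ Shifted (θ ++ [ s ]) (x ++ [ s ]) d
  Shifted-∷⁻ {θ} {x} s d ([] , .s , .d , refl , le) =
    inj₁ (≤-resp-≈ (≡⇒≈ (cong (_++ [ s ]) (Listₚ.++-identityʳ θ))) (≡⇒≈ (Listₚ.++-identityʳ x)) le)
  Shifted-∷⁻ {θ} {x} s .(d₁ ++ g ∷ d₂) (.s ∷ d₁ , g , d₂ , refl , le) = inj₂ (d₁ , g , d₂ , refl ,
    ≤-resp-≈ (≡⇒≈ (cong (_++ [ g ]) (sym (Listₚ.++-assoc θ [ s ] d₁)))) (≡⇒≈ (sym (Listₚ.++-assoc x [ s ] d₁))) le)

  split-at : ∀ (c d : List S) k → length c ≤ k → k < length (c ++ d) →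
             ∃ λ d₁ → ∃ λ g → ∃ λ d₂ → d ≡ d₁ ++ g ∷ d₂ × k ≡ length (c ++ d₁)
  split-at (_ ∷ c) d (suc k) (s≤s le) (s≤s lt) with split-at c d k le lt
  ... | d₁ , g , d₂ , eq , k≡ = d₁ , g , d₂ , eq , cong suc k≡
  split-at [] (s ∷ d) zero le lt = [] , s , d , refl , refl
  split-at [] (s ∷ d) (suc k) le (s≤s lt) with split-at [] d k z≤n lt
  ... | d₁ , g , d₂ , refl , k≡ = s ∷ d₁ , g , d₂ , refl , cong suc k≡

  -- At an entry `I` only the fourth condition can hold, and at the letter g it is the inequality of
  -- `Shifted`.
  no-later-condition : ∀ c σ₀ d → length c ≡ length σ₀ → ¬ Shifted (sel c (ones σ₀)) (sel c (Ξ σ₀)) d →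
                       ∀ k → length c ≤ k → k < length (c ++ d) → ¬ Cond (c ++ d) (σ₀ ++ Is d) k
  no-later-condition c σ₀ d len ns k c≤k k<w cond with split-at c d k c≤k k<w
  ... | d₁ , g , d₂ , refl , refl = refute (subst₂ (λ w σ → Cond w σ (length (c ++ d₁)))
          (sym (Listₚ.++-assoc c d₁ (g ∷ d₂)))
          (trans (cong (σ₀ ++_) (Is-++ d₁ g d₂)) (sym (Listₚ.++-assoc σ₀ (Is d₁) (I ∷ Is d₂)))) cond)
    where
      len′ : length (c ++ d₁) ≡ length (σ₀ ++ Is d₁)
      len′ = trans (Listₚ.length-++ c) (trans (cong₂ ℕ._+_ len (sym (length-Is d₁))) (sym (Listₚ.length-++ σ₀)))
      module P = Position (c ++ d₁) (σ₀ ++ Is d₁) g d₂ (Is d₂) len′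
      not-I : ∀ {e} → P.σ I ‼ P.j ≡ just e → e ≡ I
      not-I eq = just-injective (trans (sym eq) (P.entry I))
      π≡ : P.π ≡ sel c (ones σ₀) ++ d₁
      π≡ = trans (sel-ones-++ c d₁ (Is d₁) len) (cong (sel c (ones σ₀) ++_) (sel-ones-Is d₁))
      x≡ : P.x ≡ sel c (Ξ σ₀) ++ d₁
      x≡ = trans (sel-Ξ-++ c d₁ (Is d₁) len) (cong (sel c (Ξ σ₀) ++_) (sel-Ξ-Is d₁))
      refute : ¬ Cond P.w (P.σ I) P.j
      refute (inj₁ (eq , _)) with not-I eq
      ... | ()
      refute (inj₂ (inj₁ eq)) with not-I eq
      ... | ()
      refute (inj₂ (inj₂ (inj₁ (eq , _)))) with not-I eq
      ... | ()
      refute (inj₂ (inj₂ (inj₂ (_ , le)))) = ns (d₁ , g , d₂ , refl ,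
        subst₂ _≤B_ (trans P.σpre-suc (cong (_++ [ g ]) π≡)) (trans (P.τpre-j I) x≡) le)

  -- The entry at j separates all conditions except the first and the third, which differ in the
  -- defect. The mask ρ is unique by `Constant-unique`.
  Step-functional : ∀ {w σ j σ′ σ″} → Step w σ j σ′ → Step w σ j σ″ → σ″ ≡ σ′
  Step-functional {w} {σ} {j} = go
    where
      clash : ∀ {e e′} → σ ‼ j ≡ just e → σ ‼ j ≡ just e′ → e ≢ e′ → ⊥
      clash p q ne = ne (just-injective (trans (sym p) q))

      unique : ∀ {v ρ ρ′ z} → ConstantMaskFor v ρ z → ConstantMaskFor v ρ′ z → ρ ≡ ρ′
      unique {v} (c , e) (c′ , e′) = Constant-unique (reverseView v) (ConstantMask⇒Constant c) (ConstantMask⇒Constant c′) (trans≈ e (sym≈ e′))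

      go : ∀ {σ′ σ″} → Step w σ j σ′ → Step w σ j σ″ → σ″ ≡ σ′
      go (inj₁ (_ , refl)) (inj₁ (_ , refl)) = refl
      go (inj₁ ((p , _) , _)) (inj₂ (inj₁ (q , _))) = ⊥-elim (clash p q λ ())
      go (inj₁ ((_ , nd) , _)) (inj₂ (inj₂ (inj₁ ((_ , def) , _)))) = ⊥-elim (nd def)
      go (inj₁ ((p , _) , _)) (inj₂ (inj₂ (inj₂ ((q , _) , _)))) = ⊥-elim (clash p q λ ())
      go (inj₂ (inj₁ (p , _))) (inj₁ ((q , _) , _)) = ⊥-elim (clash p q λ ())
      go (inj₂ (inj₁ (_ , refl))) (inj₂ (inj₁ (_ , refl))) = refl
      go (inj₂ (inj₁ (p , _))) (inj₂ (inj₂ (inj₁ ((q , _) , _)))) = ⊥-elim (clash p q λ ())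
      go (inj₂ (inj₁ (p , _))) (inj₂ (inj₂ (inj₂ ((q , _) , _)))) = ⊥-elim (clash p q λ ())
      go (inj₂ (inj₂ (inj₁ ((_ , def) , _)))) (inj₁ ((_ , nd) , _)) = ⊥-elim (nd def)
      go (inj₂ (inj₂ (inj₁ ((p , _) , _)))) (inj₂ (inj₁ (q , _))) = ⊥-elim (clash p q λ ())
      go (inj₂ (inj₂ (inj₁ (_ , s , eq , ρ , m , refl)))) (inj₂ (inj₂ (inj₁ (_ , s′ , eq′ , ρ′ , m′ , refl))))
        with just-injective (trans (sym eq) eq′)
      ... | refl with unique m m′
      ...   | refl = refl
      go (inj₂ (inj₂ (inj₁ ((p , _) , _)))) (inj₂ (inj₂ (inj₂ ((q , _) , _)))) = ⊥-elim (clash p q λ ())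
      go (inj₂ (inj₂ (inj₂ ((p , _) , _)))) (inj₁ ((q , _) , _)) = ⊥-elim (clash p q λ ())
      go (inj₂ (inj₂ (inj₂ ((p , _) , _)))) (inj₂ (inj₁ (q , _))) = ⊥-elim (clash p q λ ())
      go (inj₂ (inj₂ (inj₂ ((p , _) , _)))) (inj₂ (inj₂ (inj₁ ((q , _) , _)))) = ⊥-elim (clash p q λ ())
      go (inj₂ (inj₂ (inj₂ (_ , ρ , m , refl)))) (inj₂ (inj₂ (inj₂ (_ , ρ′ , m′ , refl)))) with unique m m′
      ... | refl = refl

  Step⇒Cond : ∀ {w σ j σ′} → Step w σ j σ′ → Cond w σ j
  Step⇒Cond (inj₁ (c , _))               = inj₁ c
  Step⇒Cond (inj₂ (inj₁ (c , _)))        = inj₂ (inj₁ c)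
  Step⇒Cond (inj₂ (inj₂ (inj₁ (c , _)))) = inj₂ (inj₂ (inj₁ c))
  Step⇒Cond (inj₂ (inj₂ (inj₂ (c , _)))) = inj₂ (inj₂ (inj₂ c))

  Φ-functional : ∀ {w σ σ′ σ″} → Φ w σ σ′ → Φ w σ σ″ → σ″ ≡ σ′
  Φ-functional {w} {σ} (j , j<w , step , later) (j′ , j′<w , step′ , later′) with ℕₚ.<-cmp j j′
  ... | tri< lt _ _   = ⊥-elim (later j′ lt j′<w (Step⇒Cond step′))
  ... | tri≈ _ refl _ = Step-functional step step′
  ... | tri> _ _ gt   = ⊥-elim (later′ j gt j<w (Step⇒Cond step))

  -- The matching

  -- The lengths differ by one, which leaves no room for an element strictly in between.
  insert-cover : ∀ x r d → Up x r → Additive x d → Additive (x ++ [ r ]) d → x ++ d ⋖ x ++ r ∷ d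
  insert-cover x r d up add-x add-xr = (below , λ e → ℕₚ.<-irrefl (ℓ-≈ e) (ℕₚ.≤-reflexive (sym one-longer))) ,
    λ { (z , u<z , z<v) → ℕₚ.<⇒≱ (<⇒ℓ< z<v) (ℕₚ.≤-trans (ℕₚ.≤-reflexive one-longer) (<⇒ℓ< u<z)) }
    where
      below : x ++ d ≤B x ++ r ∷ d
      below = ≤-resp-≈ refl≈ (≡⇒≈ (Listₚ.++-assoc x [ r ] d)) (Additive-mono d (Up⇒≤ up) add-xr)
      one-longer : ℓ (x ++ r ∷ d) ≡ suc (ℓ (x ++ d))
      one-longer = trans (∷-Additive x r d up add-xr) (trans (ℕₚ.+-suc (ℓ x) (length d)) (cong suc (sym add-x)))

  Shifted-resp-≈ : ∀ {θ θ′ x x′ d} → θ ≈ θ′ → x ≈ x′ → Shifted θ x d → Shifted θ′ x′ d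
  Shifted-resp-≈ e e′ (d₁ , g , d₂ , eq , le) = d₁ , g , d₂ , eq ,
    ≤-resp-≈ (++-congʳ [ g ] (++-congʳ d₁ e)) (++-congʳ d₁ e′) le

  -- A pair oriented upwards, with φ in both directions, so each kind of pair is verified once,
  -- whichever member is given.
  record Matched (w y : List S) (low high : List Entry) : Set where
    field
      low-InR  : InR w y low
      high-InR : InR w y high
      low→high : Φ w low high
      high→low : Φ w high low
      distinct : low ≢ high
      covered  : sel w (Ξ low) ⋖ sel w (Ξ high)

  after : ∀ c σ₀ r d (e : Entry) → length c ≡ length σ₀ →
          ¬ Shifted (sel c (ones σ₀) ++ sel [ r ] (ones [ e ])) (sel c (Ξ σ₀) ++ sel [ r ] (Ξ [ e ])) d →
          ∀ k → length c < k → k < length (c ++ r ∷ d) → ¬ Cond (c ++ r ∷ d) (σ₀ ++ e ∷ Is d) k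
  after c σ₀ r d e len ns k c<k k<w cond = no-later-condition (c ++ [ r ]) (σ₀ ++ [ e ]) d
    (trans (length-snoc c r) (trans (cong suc len) (sym (trans (Listₚ.length-++ σ₀) (ℕₚ.+-comm (length σ₀) 1)))))
    (λ sh → ns (Shifted-resp-≈ (≡⇒≈ (sel-ones-++ c [ r ] [ e ] len)) (≡⇒≈ (sel-Ξ-++ c [ r ] [ e ] len)) sh))
    k (subst (_≤ k) (sym (length-snoc c r)) c<k)
    (subst (λ w → k < length w) (sym w≡) k<w)
    (subst₂ (λ w σ → Cond w σ k) (sym w≡) (sym (Listₚ.++-assoc σ₀ [ e ] (Is d))) cond)
    where
      w≡ : (c ++ [ r ]) ++ d ≡ c ++ r ∷ d
      w≡ = Listₚ.++-assoc c [ r ] d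

  -- Produces the prefix that the third and the fourth case of φ write: the entries `X` stay, and
  -- the others follow the constant mask for z on the selected subword.
  remask : ∀ {c σ₀ z} → Relative [] [] c σ₀ → z ≤B sel c (Ξ σ₀) →
           ∃ λ σ₁ → Ξ σ₁ ≡ Ξ σ₀ × Relative [] [] c σ₁ × sel c (ones σ₁) ≈ z
  remask {c} {σ₀} {z} rel le with constant-mask le refl≈ | Relative⇒Constant rel
  ... | ρ , c-ρ , e | c-τ , c-ν = overwrite σ₀ ρ , Ξ≡ ,
        Constant⇒Relative c (overwrite σ₀ ρ) (subst (Constant [] c) (sym Ξ≡) c-τ)
          (subst₂ (Constant []) (cong (sel c) (sym Ξ≡)) (sym restrict≡) c-ρ) ,
        trans≈ (≡⇒≈ (trans (sym (sel-restrict c (overwrite σ₀ ρ))) (cong₂ (λ τ ν → sel (sel c τ) ν) Ξ≡ restrict≡))) e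
    where
      Ξ≡ : Ξ (overwrite σ₀ ρ) ≡ Ξ σ₀
      Ξ≡ = Ξ-overwrite σ₀ ρ
      restrict≡ : restrict (overwrite σ₀ ρ) ≡ ρ
      restrict≡ = restrict-overwrite σ₀ ρ (trans (Constant-length c-ρ) (sym (Constant-length c-ν)))

  module Pair (c : List S) (r : S) (d : List S) (y : List S) (red : Reduced (c ++ r ∷ d)) where

    mask : List Entry → Entry → List Entry
    mask σ₀ e = σ₀ ++ e ∷ Is d

    module _ {σ₀ : List Entry} (rel : Relative [] [] c σ₀) where

      private
        len = Relative-length rel
        module P = Position c σ₀ r d (Is d) len

      open P using (π; x)

      constant-below : ∀ {v z} → v ≡ x → π ≈ z → ConstantMaskFor v (restrict σ₀) z
      constant-below refl e = Constant⇒ConstantMask (proj₂ (Relative⇒Constant rel)) , trans≈ (≡⇒≈ (sel-restrict c σ₀)) e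

      sel-ones : ∀ e → sel (c ++ r ∷ d) (ones (mask σ₀ e)) ≡ π ++ sel (r ∷ d) (ones (e ∷ Is d))
      sel-ones e = sel-ones-++ c (r ∷ d) (e ∷ Is d) len

      X-InR : Up x r → Additive π d → Additive x d → π ++ d ≈ y → InR (c ++ r ∷ d) y (mask σ₀ X)
      X-InR up add-π add-x e = Relative⇒InR red (Relative-++ rel (X∷ (up , Relative-Is π x d add-π add-x)))
        (trans≈ (≡⇒≈ (trans (sel-ones X) (cong (π ++_) (sel-ones-Is d)))) e)

      O-InR : Up x r → Up π r → Additive π d → Additive (x ++ [ r ]) d → π ++ d ≈ y → InR (c ++ r ∷ d) y (mask σ₀ O)
      O-InR up up-π add-π add-x e = Relative⇒InR red (Relative-++ rel (O∷ (up , up-π , Relative-Is π (x ++ [ r ]) d add-π add-x)))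
        (trans≈ (≡⇒≈ (trans (sel-ones O) (cong (π ++_) (sel-ones-Is d)))) e)

      I-InR : Up x r → Up π r → Additive (π ++ [ r ]) d → Additive (x ++ [ r ]) d → π ++ r ∷ d ≈ y → InR (c ++ r ∷ d) y (mask σ₀ I)
      I-InR up up-π add-π add-x e = Relative⇒InR red (Relative-++ rel (I∷ (up , up-π , Relative-Is (π ++ [ r ]) (x ++ [ r ]) d add-π add-x)))
        (trans≈ (≡⇒≈ (trans (sel-ones I) (cong (λ z → π ++ r ∷ z) (sel-ones-Is d)))) e)

      sel-Ξ-X : sel (c ++ r ∷ d) (Ξ (mask σ₀ X)) ≡ x ++ d
      sel-Ξ-X = trans (sel-Ξ-++ c (r ∷ d) (X ∷ Is d) len) (cong (x ++_) (sel-Ξ-Is d))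

      sel-Ξ-O : sel (c ++ r ∷ d) (Ξ (mask σ₀ O)) ≡ x ++ r ∷ d
      sel-Ξ-O = trans (sel-Ξ-++ c (r ∷ d) (O ∷ Is d) len) (cong (λ z → x ++ r ∷ z) (sel-Ξ-Is d))

      sel-Ξ-I : sel (c ++ r ∷ d) (Ξ (mask σ₀ I)) ≡ x ++ r ∷ d
      sel-Ξ-I = trans (sel-Ξ-++ c (r ∷ d) (I ∷ Is d) len) (cong (λ z → x ++ r ∷ z) (sel-Ξ-Is d))

      matched-X-O : Up x r → Up π r → Additive π d → π ++ d ≈ y →
                    Additive x d × ¬ Shifted π x d → Additive (x ++ [ r ]) d × ¬ Shifted π (x ++ [ r ]) d →
                    Matched (c ++ r ∷ d) y (mask σ₀ X) (mask σ₀ O)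
      matched-X-O up up-π add-π e (add-x , ns) (add-xr , ns′) = record
        { low-InR  = X-InR up add-π add-x e
        ; high-InR = O-InR up up-π add-π add-xr e
        ; low→high = P.j , P.j<w , inj₁ ((P.entry X , λ def → up-down up-π (P.Defect⇒Down X def)) , sym (P.replaceAt-j X O)) ,
            after c σ₀ r d X len (λ sh → ns (Shifted-resp-≈ (≡⇒≈ (Listₚ.++-identityʳ π)) (≡⇒≈ (Listₚ.++-identityʳ x)) sh))
        ; high→low = P.j , P.j<w , inj₂ (inj₁ (P.entry O , sym (P.replaceAt-j O X))) ,
            after c σ₀ r d O len (λ sh → ns′ (Shifted-resp-≈ (≡⇒≈ (Listₚ.++-identityʳ π)) refl≈ sh))
        ; distinct = λ eq → X≢O (just-injective (trans (sym (P.entry X)) (trans (cong (_‼ P.j) eq) (P.entry O))))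
        ; covered  = subst₂ _⋖_ (sym sel-Ξ-X) (sym sel-Ξ-O) (insert-cover x r d up add-x add-xr)
        }
        where
          X≢O : X ≢ O
          X≢O ()

    -- The third case of φ against the fourth. The two prefixes share their X-mask, and their ones
    -- multiply to π and π r; the entry `I` turns π r back into π, so both masks belong to y = π d.
    matched-X-I : ∀ {σ₀ σ₁} → Relative [] [] c σ₀ → Relative [] [] c σ₁ → Ξ σ₁ ≡ Ξ σ₀ →
                  let π = sel c (ones σ₀) ; x = sel c (Ξ σ₀) in
                  sel c (ones σ₁) ≈ π ++ [ r ] → Up x r → Down π r → Additive π d → π ++ d ≈ y →
                  Additive x d × ¬ Shifted π x d → Additive (x ++ [ r ]) d × ¬ Shifted π (x ++ [ r ]) d →
                  Matched (c ++ r ∷ d) y (mask σ₀ X) (mask σ₁ I)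
    matched-X-I {σ₀} {σ₁} rel₀ rel₁ Ξ≡ π₁≈ up down add-π e (add-x , ns) (add-xr , ns′) = record
      { low-InR  = X-InR rel₀ up add-π add-x e
      ; high-InR = I-InR rel₁ (Up-≈ (sym≈ x₁≈) up) (Up-≈ (sym≈ π₁≈) (Down⇒Up down)) (Additive-≈ d (sym≈ π₁r≈) add-π)
          (Additive-≈ d (++-congʳ [ r ] (sym≈ x₁≈)) add-xr)
          (trans≈ (≡⇒≈ (sym (Listₚ.++-assoc P₁.π [ r ] d))) (trans≈ (++-congʳ d π₁r≈) e))
      ; low→high = P₀.j , P₀.j<w , inj₂ (inj₂ (inj₁ ((P₀.entry X , P₀.Down⇒Defect X down) , r , P₀.letter , restrict σ₁ ,
            constant-below rel₁ (trans (P₀.τpre-j X) (sym x₁≡)) (trans≈ π₁≈ (≡⇒≈ (cong (_++ [ r ]) (sym (P₀.σpre-j X))))) ,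
            sym (cong₂ (λ a b → a ++ I ∷ b)
              (trans (cong (λ σ → overwrite σ (restrict σ₁)) (take-++ c σ₀ len₀)) (overwrite-restrict σ₀ σ₁ (sym Ξ≡)))
              (drop-++ c σ₀ len₀))))) ,
          after c σ₀ r d X len₀ (λ sh → ns (Shifted-resp-≈ (≡⇒≈ (Listₚ.++-identityʳ P₀.π)) (≡⇒≈ (Listₚ.++-identityʳ P₀.x)) sh))
      -- After its entry `I` the high mask has the product π again. The shifted descent is therefore
      -- π ≤ x, which holds for every relative mask.
      ; high→low = P₁.j , P₁.j<w , inj₂ (inj₂ (inj₂ ((P₁.entry I , ≤-resp-≈ (sym≈ σpre≈) (≡⇒≈ (sym (trans (P₁.τpre-j I) x₁≡))) (Relative⇒≤ rel₀)) ,
            restrict σ₀ , constant-below rel₀ (trans (P₁.τpre-j I) x₁≡) (sym≈ σpre≈) ,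
            sym (cong₂ (λ a b → a ++ X ∷ b)
              (trans (cong (λ σ → overwrite σ (restrict σ₀)) (take-++ c σ₁ len₁)) (overwrite-restrict σ₁ σ₀ Ξ≡))
              (drop-++ c σ₁ len₁))))) ,
          after c σ₁ r d I len₁ (λ sh → ns′ (Shifted-resp-≈ π₁r≈ (++-congʳ [ r ] x₁≈) sh))
      ; distinct = λ eq → X≢I (just-injective (trans (sym (P₀.entry X)) (trans (cong (_‼ P₀.j) eq) (P₁.entry I))))
      ; covered  = subst₂ _⋖_ (sym (sel-Ξ-X rel₀)) (sym (trans (sel-Ξ-I rel₁) (cong (_++ r ∷ d) x₁≡)))
          (insert-cover P₀.x r d up add-x add-xr)
      }
      where
        len₀ = Relative-length rel₀
        len₁ = Relative-length rel₁
        module P₀ = Position c σ₀ r d (Is d) len₀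
        module P₁ = Position c σ₁ r d (Is d) len₁
        x₁≡ : P₁.x ≡ P₀.x
        x₁≡ = cong (sel c) Ξ≡
        x₁≈ : P₁.x ≈ P₀.x
        x₁≈ = ≡⇒≈ x₁≡
        π₁r≈ : P₁.π ++ [ r ] ≈ P₀.π
        π₁r≈ = trans≈ (++-congʳ [ r ] π₁≈) (snoc-snoc P₀.π r)
        σpre≈ : σpre (c ++ r ∷ d) (mask σ₁ I) (suc P₁.j) ≈ P₀.π
        σpre≈ = trans≈ (≡⇒≈ P₁.σpre-suc) π₁r≈
        X≢I : X ≢ I
        X≢I ()

    Partner : List Entry → Set
    Partner σ = ∃ λ σ′ → Matched (c ++ r ∷ d) y σ σ′ ⊎ Matched (c ++ r ∷ d) y σ′ σ

    red-rd : Reduced (r ∷ d)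
    red-rd = Reduced-++ʳ c (r ∷ d) red

    module _ {σ₀ : List Entry} (rel : Relative [] [] c σ₀) (up-x : Up (sel c (Ξ σ₀)) r) where

      private
        π = sel c (ones σ₀)
        x = sel c (Ξ σ₀)

      partner-X : Additive π d → Additive x d → π ++ d ≈ y → ¬ Shifted π x d → Up π r ⊎ Down π r → Partner (mask σ₀ X)
      partner-X add-π add-x y≈ ns (inj₁ up) = mask σ₀ O , inj₁ (matched-X-O rel up-x up add-π y≈ (add-x , ns)
        (raise (Relative⇒≤ rel) up-x (reverseView d) red-rd add-π add-x ns))
      -- At a defect π r < π ≤ x, so the constant mask required by the third case exists.
      partner-X add-π add-x y≈ ns (inj₂ down) = remasked (remask rel (≤-trans (Down⇒≤ down) (Relative⇒≤ rel)))
        where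
          remasked : (∃ λ σ₁ → Ξ σ₁ ≡ Ξ σ₀ × Relative [] [] c σ₁ × sel c (ones σ₁) ≈ π ++ [ r ]) → Partner (mask σ₀ X)
          remasked (σ₁ , Ξ≡ , rel₁ , π₁≈) = mask σ₁ I , inj₁ (matched-X-I rel rel₁ Ξ≡ π₁≈ up-x down add-π y≈ (add-x , ns)
            (raise (Relative⇒≤ rel) up-x (reverseView d) red-rd add-π add-x ns))

      partner-O : Up π r → Additive π d → Additive (x ++ [ r ]) d → π ++ d ≈ y → ¬ Shifted π (x ++ [ r ]) d → Partner (mask σ₀ O)
      partner-O up-π add-π add-xr y≈ ns = mask σ₀ X , inj₂ (matched-X-O rel up-x up-π add-π y≈
        (lower (Relative⇒≤ rel) up-x (reverseView d) add-π add-xr ns) (add-xr , ns))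

      partner-I : Up π r → Additive (π ++ [ r ]) d → Additive (x ++ [ r ]) d → π ++ r ∷ d ≈ y → π ++ [ r ] ≤B x →
                  ¬ Shifted (π ++ [ r ]) (x ++ [ r ]) d → Partner (mask σ₀ I)
      partner-I up-π add-π add-xr y≈ below ns = remasked (remask rel below)
        where
          remasked : (∃ λ σ₁ → Ξ σ₁ ≡ Ξ σ₀ × Relative [] [] c σ₁ × sel c (ones σ₁) ≈ π ++ [ r ]) → Partner (mask σ₀ I)
          -- The low mask has the product π r before the letter r. As r is an ascent of π, it is a
          -- descent of π r, so the entry `X` stands at a defect.
          remasked (σ₁ , Ξ≡ , rel₁ , π₁≈) = mask σ₁ X , inj₂ (matched-X-I rel₁ rel (sym Ξ≡)
              (trans≈ (sym≈ (snoc-snoc π r)) (++-congʳ [ r ] (sym≈ π₁≈)))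
              up-x₁ (Down-≈ (sym≈ π₁≈) (Up⇒Down up-π)) add-π₁
              (trans≈ (++-congʳ d π₁≈) (trans≈ (≡⇒≈ (Listₚ.++-assoc π [ r ] d)) y≈))
              (lower (Relative⇒≤ rel₁) up-x₁ (reverseView d) add-π₁ add-x₁r ns₁) (add-x₁r , ns₁))
            where
              x₁≈ : sel c (Ξ σ₁) ≈ x
              x₁≈ = ≡⇒≈ (cong (sel c) Ξ≡)
              up-x₁ : Up (sel c (Ξ σ₁)) r
              up-x₁ = Up-≈ (sym≈ x₁≈) up-x
              add-π₁ : Additive (sel c (ones σ₁)) d
              add-π₁ = Additive-≈ d (sym≈ π₁≈) add-π
              add-x₁r : Additive (sel c (Ξ σ₁) ++ [ r ]) d
              add-x₁r = Additive-≈ d (++-congʳ [ r ] (sym≈ x₁≈)) add-xr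
              ns₁ : ¬ Shifted (sel c (ones σ₁)) (sel c (Ξ σ₁) ++ [ r ]) d
              ns₁ sh = ns (Shifted-resp-≈ π₁≈ (++-congʳ [ r ] x₁≈) sh)

      partner-by-entry : ∀ e → Relative π x (r ∷ d) (e ∷ Is d) → π ++ sel (r ∷ d) (ones (e ∷ Is d)) ≈ y →
                         (e ≡ I → π ++ [ r ] ≤B x) → ¬ Shifted (π ++ sel [ r ] (ones [ e ])) (x ++ sel [ r ] (Ξ [ e ])) d →
                         Partner (mask σ₀ e)
      partner-by-entry X (X∷ (_ , tail)) y≈ _ ns = let add-π , add-x = Is-Additive π x d tail in
        partner-X add-π add-x (subst (λ z → π ++ z ≈ y) (sel-ones-Is d) y≈)
          (λ sh → ns (Shifted-resp-≈ (≡⇒≈ (sym (Listₚ.++-identityʳ π))) (≡⇒≈ (sym (Listₚ.++-identityʳ x))) sh)) (up-or-down π r)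
      partner-by-entry O (O∷ (_ , up-π , tail)) y≈ _ ns = let add-π , add-xr = Is-Additive π (x ++ [ r ]) d tail in
        partner-O up-π add-π add-xr (subst (λ z → π ++ z ≈ y) (sel-ones-Is d) y≈)
          (λ sh → ns (Shifted-resp-≈ (≡⇒≈ (sym (Listₚ.++-identityʳ π))) refl≈ sh))
      partner-by-entry I (I∷ (_ , up-π , tail)) y≈ below ns = let add-πr , add-xr = Is-Additive (π ++ [ r ]) (x ++ [ r ]) d tail in
        partner-I up-π add-πr add-xr (subst (λ z → π ++ r ∷ z ≈ y) (sel-ones-Is d) y≈) (below refl) ns

    head-Up : ∀ {p q e κ} → Relative p q (r ∷ d) (e ∷ κ) → Up q r
    head-Up (X∷ (up , _)) = up
    head-Up (O∷ (up , _)) = up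
    head-Up (I∷ (up , _)) = up

    partner : ∀ σ₀ e → length c ≡ length σ₀ → Relative [] [] (c ++ r ∷ d) (mask σ₀ e) →
              sel (c ++ r ∷ d) (ones (mask σ₀ e)) ≈ y →
              (e ≡ I → sel c (ones σ₀) ++ [ r ] ≤B sel c (Ξ σ₀)) →
              ¬ Shifted (sel c (ones σ₀) ++ sel [ r ] (ones [ e ])) (sel c (Ξ σ₀) ++ sel [ r ] (Ξ [ e ])) d →
              Partner (mask σ₀ e)
    partner σ₀ e len rel y≈ below ns = let rel₀ , tail = Relative-++⁻ c σ₀ len rel in
      partner-by-entry rel₀ (head-Up tail) e tail (trans≈ (≡⇒≈ (sym (sel-ones rel₀ e))) y≈) below ns

  -- `e` is the entry at which φ acts. The first and the third condition together cover `X`, and the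
  -- second covers `O`; only for `I` does the fourth condition have to be recorded.
  data Decomposition : List S → List Entry → Set where
    at : ∀ c r d σ₀ e → length c ≡ length σ₀ →
         (e ≡ I → sel c (ones σ₀) ++ [ r ] ≤B sel c (Ξ σ₀)) →
         ¬ Shifted (sel c (ones σ₀) ++ sel [ r ] (ones [ e ])) (sel c (Ξ σ₀) ++ sel [ r ] (Ξ [ e ])) d →
         Decomposition (c ++ r ∷ d) (σ₀ ++ e ∷ Is d)

  -- A scan from the right: `d` collects the ones that are not shifted descents. If it reaches the
  -- front, the mask consists of ones only.
  decompose : ∀ {w} → Reverse w → ∀ σ d → length w ≡ length σ → ¬ Shifted (sel w (ones σ)) (sel w (Ξ σ)) d →
              Decomposition (w ++ d) (σ ++ Is d) ⊎ sel (w ++ d) (ones (σ ++ Is d)) ≡ w ++ d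
  decompose [] [] d len ns = inj₂ (sel-ones-Is d)
  decompose (w ∶ rw ∶ʳ r) σ d len ns with initLast σ
  ... | [] = ⊥-elim (absurd (trans (sym (length-snoc w r)) len))
    where
      absurd : ∀ {n} → suc n ≢ 0
      absurd ()
  ... | σ₀ ∷ʳ′ e = subst₂ (λ w′ σ′ → Decomposition w′ σ′ ⊎ sel w′ (ones σ′) ≡ w′)
        (sym (Listₚ.++-assoc w [ r ] d)) (sym (Listₚ.++-assoc σ₀ [ e ] (Is d))) (by-entry e ns′)
    where
      len₀ : length w ≡ length σ₀
      len₀ = ℕₚ.suc-injective (trans (sym (length-snoc w r)) (trans len (trans (Listₚ.length-++ σ₀) (ℕₚ.+-comm (length σ₀) 1))))
      ns′ : ¬ Shifted (sel w (ones σ₀) ++ sel [ r ] (ones [ e ])) (sel w (Ξ σ₀) ++ sel [ r ] (Ξ [ e ])) d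
      ns′ sh = ns (Shifted-resp-≈ (≡⇒≈ (sym (sel-ones-++ w [ r ] [ e ] len₀))) (≡⇒≈ (sym (sel-Ξ-++ w [ r ] [ e ] len₀))) sh)
      by-entry : ∀ e → ¬ Shifted (sel w (ones σ₀) ++ sel [ r ] (ones [ e ])) (sel w (Ξ σ₀) ++ sel [ r ] (Ξ [ e ])) d →
                 Decomposition (w ++ r ∷ d) (σ₀ ++ e ∷ Is d) ⊎ sel (w ++ r ∷ d) (ones (σ₀ ++ e ∷ Is d)) ≡ w ++ r ∷ d
      by-entry O ns = inj₁ (at w r d σ₀ O len₀ (λ ()) ns)
      by-entry X ns = inj₁ (at w r d σ₀ X len₀ (λ ()) ns)
      by-entry I ns with (sel w (ones σ₀) ++ [ r ]) ≤? sel w (Ξ σ₀)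
      ... | yes le = inj₁ (at w r d σ₀ I len₀ (λ _ → le) ns)
      ... | no ¬le = decompose rw σ₀ (r ∷ d) len₀ λ sh → not-shifted (Shifted-∷⁻ r d sh)
        where
          not-shifted : ¬ (sel w (ones σ₀) ++ [ r ] ≤B sel w (Ξ σ₀) ⊎ Shifted (sel w (ones σ₀) ++ [ r ]) (sel w (Ξ σ₀) ++ [ r ]) d)
          not-shifted (inj₁ le) = ¬le le
          not-shifted (inj₂ sh) = ns sh

  Matching : List S → List S → List Entry → Set
  Matching w y σ = Σ (List Entry) λ σ′ →
    Φ w σ σ′ × (∀ σ″ → Φ w σ σ″ → σ″ ≡ σ′) ×
    InR w y σ′ × Φ w σ′ σ × σ′ ≢ σ ×
    ((sel w (Ξ σ) ⋖ sel w (Ξ σ′)) ⊎ (sel w (Ξ σ′) ⋖ sel w (Ξ σ)))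

  matching : ∀ w y → Reduced w → y <B w → ∀ σ → InR w y σ → Matching w y σ
  matching w y red (_ , y≉w) σ inR with InR⇒Relative {w} {y} {σ} inR
  ... | rel , y≈ = conclude (subst₂ (λ w′ σ′ → Decomposition w′ σ′ ⊎ sel w′ (ones σ′) ≡ w′)
        (Listₚ.++-identityʳ w) (Listₚ.++-identityʳ σ)
        (decompose (reverseView w) σ [] (Relative-length rel) λ { ([] , _ , _ , () , _) ; (_ ∷ _ , _ , _ , () , _) }))
    where
      found : Decomposition w σ → ∃ λ σ′ → Matched w y σ σ′ ⊎ Matched w y σ′ σ
      found (at c r d σ₀ e len shifted ns) = Pair.partner c r d y red σ₀ e len rel y≈ shifted ns

      conclude : Decomposition w σ ⊎ sel w (ones σ) ≡ w → Matching w y σ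
      -- If all entries are ones, then y = w; this is where y < w enters.
      conclude (inj₂ eq) = ⊥-elim (y≉w (trans≈ (sym≈ y≈) (≡⇒≈ eq)))
      conclude (inj₁ dec) with found dec
      ... | σ′ , inj₁ mt = σ′ , low→high , (λ σ″ → Φ-functional low→high) , high-InR , high→low , (λ e → distinct (sym e)) , inj₁ covered
        where open Matched mt
      ... | σ′ , inj₂ mt = σ′ , high→low , (λ σ″ → Φ-functional high→low) , low-InR , low→high , distinct , inj₂ covered
        where open Matched mt

theorem2p12 : {S : Set} (M : CoxeterMatrix S) → let open Coxeter M in
    (w y : List S) → Reduced w → y <B w →
    (σ : List Entry) → InR w y σ →
    Σ (List Entry) λ σ' →
    Φ w σ σ' × (∀ σ'' → Φ w σ σ'' → σ'' ≡ σ') ×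
    InR w y σ' × Φ w σ' σ × σ' ≢ σ ×
    ((sel w (Ξ σ) ⋖ sel w (Ξ σ')) ⊎ (sel w (Ξ σ') ⋖ sel w (Ξ σ)))
theorem2p12 M w y = matching M w y
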